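{- For all integers $n\ge 1$ and $g\ge 0$, $$P_{g,n}(\mathbf{w})=(n+2g-1)!\;T_n(\mathbf{w})\;R_{g,n}(\mathbf{w}).$$
   Context: Let $\mathbb{C}_n[\mathbf{w}]$ be the ring of polynomials in commuting variables $w_{ij}$, $1\le i,j\le n$, $i\ne j$, modulo the relations $w_{ij}=w_{ji}$. For a transposition $\tau\in S_n$ exchanging $i$ and $j$, put $w(\tau)=w_{ij}$. A genus $g$ cycle factorization is a list of transpositions $\tau_1,\dots,\tau_{n+2g-1}\in S_n$ such that the product $\tau_{n+2g-1}\cdots\tau_1$ is an $n$-cycle. The Hurwitz polynomial is $P_{g,n}(\mathbf{w})=\sum w(\tau_1)\cdots w(\tau_{n+2g-1})$, where the sum runs over all genus $g$ cycle factorizations. $T_n(\mathbf{w})$ is the sum, over all spanning trees of the complete graph on $\{1,\dots,n\}$, of the product of the variables $w_{ij}$ over the edges $\{i,j\}$ of the tree. By convention $T_1=1$. $A_n$ is the $n\times n$ symmetric matrix with entries $(A_n)_{ii}=\sum_{j\ne i}w_{ij}$ and $(A_n)_{ij}=-w_{ij}$ for $i\ne j$. Let $\phi(t)=\frac{\sinh(t/2)}{t/2}$. Then $R_n(\mathbf{w})=\det\phi(A_n)$ is a formal power series in the $w_{ij}$, and $R_{g,n}$ denotes its homogeneous part of degree $2g$. -}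

module Defs where

open import Data.Nat using (ℕ; zero; suc; _+_; _*_; _∸_; _^_; _!; _<ᵇ_; _≡ᵇ_)
open import Data.Nat.Properties using (m*n≢0; m^n≢0; _!≢0)
open import Data.Integer using (+_)
open import Data.Rational using (ℚ; 0ℚ; 1ℚ; _/_) renaming (_+_ to _+ℚ_; _*_ to _*ℚ_; -_ to -ℚ_)
open import Data.Bool using (Bool; true; false; _∧_; _∨_; not; if_then_else_)
open import Data.Fin using (Fin; zero; suc; toℕ; punchIn; _≟_)
open import Data.Fin.Permutation.Components using (transpose)
open import Data.List using (List; []; _∷_; _++_; map; concatMap; foldr; allFin; upTo; filter)
open import Data.Bool.ListAction using (any; all)
open import Data.Product using (_×_; _,_; proj₁; proj₂)
open import Relation.Nullary using (does)
open import Relation.Binary.PropositionalEquality using (_≡_)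
open import Function using (id; _∘_)

-- A monomial is an exponent table; only entries (i , j) with i < j are
-- ever used (w_ij = w_ji is identified with the entry (min , max)).
Mono : ℕ → Set
Mono n = Fin n → Fin n → ℕ

-- A polynomial is a finite formal sum of terms  c · monomial.
-- Two polynomials are equal iff all coefficients agree (see _≈ₚ_).
Poly : ℕ → Set
Poly n = List (ℚ × Mono n)

monoEq : ∀ {n} → Mono n → Mono n → Bool
monoEq {n} m m' = all (λ i → all (λ j → m i j ≡ᵇ m' i j) (allFin n)) (allFin n)

monoMul : ∀ {n} → Mono n → Mono n → Mono n
monoMul m m' i j = m i j + m' i j

monoOne : ∀ {n} → Mono n
monoOne _ _ = 0

totalDeg : ∀ {n} → Mono n → ℕ
totalDeg {n} m = foldr _+_ 0 (concatMap (λ i → map (λ j → m i j) (allFin n)) (allFin n))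

coeff : ∀ {n} → Poly n → Mono n → ℚ
coeff [] m = 0ℚ
coeff ((c , m') ∷ p) m = (if monoEq m' m then c else 0ℚ) +ℚ coeff p m

_≈ₚ_ : ∀ {n} → Poly n → Poly n → Set
p ≈ₚ q = ∀ m → coeff p m ≡ coeff q m

0ₚ : ∀ {n} → Poly n
0ₚ = []

1ₚ : ∀ {n} → Poly n
1ₚ = (1ℚ , monoOne) ∷ []

constₚ : ∀ {n} → ℚ → Poly n
constₚ c = (c , monoOne) ∷ []

_+ₚ_ : ∀ {n} → Poly n → Poly n → Poly n
p +ₚ q = p ++ q

scaleₚ : ∀ {n} → ℚ → Poly n → Poly n
scaleₚ c = map (λ t → (c *ℚ proj₁ t , proj₂ t))

-ₚ_ : ∀ {n} → Poly n → Poly n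
-ₚ p = scaleₚ (-ℚ 1ℚ) p

_*ₚ_ : ∀ {n} → Poly n → Poly n → Poly n
p *ₚ q = concatMap (λ s → map (λ t → (proj₁ s *ℚ proj₁ t , monoMul (proj₂ s) (proj₂ t))) q) p

sumₚ : ∀ {n} → List (Poly n) → Poly n
sumₚ = foldr _+ₚ_ 0ₚ

prodₚ : ∀ {n} → List (Poly n) → Poly n
prodₚ = foldr _*ₚ_ 1ₚ

homog : ∀ {n} → ℕ → Poly n → Poly n
homog d p = filter (λ t → totalDeg (proj₂ t) Data.Nat.≟ d) p

-- the variable w_ij  (= w_ji), for i ≠ j
w : ∀ {n} → Fin n → Fin n → Poly n
w {n} i j = (1ℚ , e) ∷ []
  where
  lo hi : Fin n
  lo = if toℕ i <ᵇ toℕ j then i else j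
  hi = if toℕ i <ᵇ toℕ j then j else i
  e : Mono n
  e a b = if does (a ≟ lo) ∧ does (b ≟ hi) then 1 else 0

transpositions : (n : ℕ) → List (Fin n × Fin n)
transpositions n =
  concatMap (λ i → map (λ j → (i , j)) (filter (λ j → toℕ i Data.Nat.<? toℕ j) (allFin n))) (allFin n)

swap : ∀ {n} → Fin n × Fin n → Fin n → Fin n
swap t = transpose (proj₁ t) (proj₂ t)

-- the product  τ_m ⋯ τ_1  of the list  τ_1 , … , τ_m  (τ_1 acts first)
prodPerm : ∀ {n} → List (Fin n × Fin n) → Fin n → Fin n
prodPerm [] = id
prodPerm (t ∷ ts) = prodPerm ts ∘ swap t

iter : ∀ {A : Set} → ℕ → (A → A) → A → A
iter zero f x = x
iter (suc k) f x = f (iter k f x)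

distinct : ∀ {n} → List (Fin n) → Bool
distinct [] = true
distinct (x ∷ xs) = not (any (λ y → does (x ≟ y)) xs) ∧ distinct xs

isNCycle : ∀ {n} → (Fin n → Fin n) → Bool
isNCycle {n} σ = any (λ x → distinct (map (λ k → iter k σ x) (upTo n))) (allFin n)

listsOfLength : ∀ {A : Set} → ℕ → List A → List (List A)
listsOfLength zero xs = [] ∷ []
listsOfLength (suc m) xs = concatMap (λ x → map (x ∷_) (listsOfLength m xs)) xs

weight : ∀ {n} → List (Fin n × Fin n) → Poly n
weight ts = prodPerm′ ts
  where
  prodPerm′ : ∀ {n} → List (Fin n × Fin n) → Poly n
  prodPerm′ [] = 1ₚ
  prodPerm′ (t ∷ ts) = w (proj₁ t) (proj₂ t) *ₚ prodPerm′ ts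

Hurwitz : (g n : ℕ) → Poly n
Hurwitz g n =
  sumₚ (map weight (filter (λ ts → isNCycle (prodPerm ts) Data.Bool.≟ true)
                           (listsOfLength (n + 2 * g ∸ 1) (transpositions n))))

sublists : ∀ {A : Set} → List A → List (List A)
sublists [] = [] ∷ []
sublists (x ∷ xs) = let r = sublists xs in map (x ∷_) r ++ r

picks : ∀ {A : Set} → List A → List (A × List A)
picks [] = []
picks (x ∷ xs) = (x , xs) ∷ map (λ p → (proj₁ p , x ∷ proj₂ p)) (picks xs)

reachable : ∀ {n} → List (Fin n × Fin n) → ℕ → Fin n → Fin n → Bool
reachable E zero u v = does (u ≟ v)
reachable E (suc k) u v =
  reachable E k u v ∨
  any (λ e → (reachable E k u (proj₁ e) ∧ does (proj₂ e ≟ v))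
           ∨ (reachable E k u (proj₂ e) ∧ does (proj₁ e ≟ v))) E

connected : ∀ {n} → List (Fin n × Fin n) → Bool
connected {n} E = all (λ u → all (λ v → reachable E n u v) (allFin n)) (allFin n)

-- no edge of E lies on a cycle: removing any edge separates its endpoints
acyclic : ∀ {n} → List (Fin n × Fin n) → Bool
acyclic {n} E = all (λ p → not (reachable (proj₂ p) n (proj₁ (proj₁ p)) (proj₂ (proj₁ p)))) (picks E)

isSpanningTree : ∀ {n} → List (Fin n × Fin n) → Bool
isSpanningTree E = connected E ∧ acyclic E

TreePoly : (n : ℕ) → Poly n
TreePoly n =
  sumₚ (map weight (filter (λ E → isSpanningTree E Data.Bool.≟ true) (sublists (transpositions n))))

Mat : ℕ → ℕ → Set
Mat n m = Fin m → Fin m → Poly n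

sumFin : ∀ {n} m → (Fin m → Poly n) → Poly n
sumFin m f = sumₚ (map f (allFin m))

_⊗_ : ∀ {n m} → Mat n m → Mat n m → Mat n m
_⊗_ {m = m} M N i j = sumFin m (λ k → M i k *ₚ N k j)

idMat : ∀ {n m} → Mat n m
idMat i j = if does (i ≟ j) then 1ₚ else 0ₚ

_^ₘ_ : ∀ {n m} → Mat n m → ℕ → Mat n m
M ^ₘ zero = idMat
M ^ₘ suc k = M ⊗ (M ^ₘ k)

det : ∀ {n} m → Mat n m → Poly n
det zero M = 1ₚ
det (suc m) M =
  sumFin (suc m) (λ j → scaleₚ (sgn (toℕ j)) (M zero j *ₚ det m (λ a b → M (suc a) (punchIn j b))))
  where
  sgn : ℕ → ℚ
  sgn zero = 1ℚ
  sgn (suc zero) = -ℚ 1ℚ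
  sgn (suc (suc k)) = sgn k

Amat : (n : ℕ) → Mat n n
Amat n i j =
  if does (i ≟ j)
  then sumₚ (map (λ k → w i k) (filter (λ k → Data.Bool.not (does (i ≟ k)) Data.Bool.≟ true) (allFin n)))
  else -ₚ (w i j)

-- Taylor coefficient of φ(t) = sinh(t/2)/(t/2) = Σ_k t^(2k) / (4^k (2k+1)!)
phiCoeff : ℕ → ℚ
phiCoeff k = (+ 1 / (4 ^ k * (2 * k + 1) !)) {{m*n≢0 (4 ^ k) ((2 * k + 1) !) {{m^n≢0 4 k}} {{(2 * k + 1) !≢0}}}}

-- φ(A) truncated after t^(2g): Σ_{k ≤ g} phiCoeff k · A^(2k).
-- Entries of A^(2k) are homogeneous of degree 2k in w, so the terms with
-- k > g do not contribute to the degree-2g part of det φ(A).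
phiTrunc : ∀ {n m} → ℕ → Mat n m → Mat n m
phiTrunc g M i j = sumₚ (map (λ k → scaleₚ (phiCoeff k) ((M ^ₘ (2 * k)) i j)) (upTo (suc g)))

Rpoly : (g n : ℕ) → Poly n
Rpoly g n = homog (2 * g) (det n (phiTrunc g (Amat n)))

{-# OPTIONS --safe #-}

-- With u = e_i − e_j the transposition (i j) is the matrix 1 − uuᵀ, and A = Σ w_ij uuᵀ.
-- For a matrix M put F_M(t) = det(e^{tA/2}) det(1 − M e^{−tA}).  A determinant is affine
-- along rank-one directions, so F_M′ = Σ_τ w(τ) F_{Mτ}, and the N-th derivative of F_M at 0
-- is Σ w(τ₁)⋯w(τ_N) det(1 − M τ₁⋯τ_N) over all sequences of N transpositions.  If M is the
-- identity with its first row erased, then det(1 − Mσ) is the first principal cofactor of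
-- 1 − σ, which is 1 for an n-cycle σ and 0 for every other permutation; so F_M is the
-- exponential generating function of the Hurwitz polynomials.  On the other hand
-- e^{tA/2} (1 − e^{−tA}) = tA φ(tA), and as A kills the all-ones vector while φ(tA) and
-- e^{tA/2} fix it, F_M = t^{n−1} c det φ(tA), where c is the first principal cofactor of A.
-- By the matrix-tree theorem (deletion and contraction) c = T_n.  Series in t are written
-- in the basis t^k / k!, and the degree in w is traded for the degree in t by w ↦ t w.
module Submission where

-- All steps before the final instantiation take place over an arbitrary commutative ring, so
-- nothing can be divided or cancelled, and the identities are arranged accordingly. Half of A is a
-- matrix H with H + H = A, and φ(tA) is any matrix Φ with row sums one and e^(tH) - e^(-tH) = tAΦ.
-- Cofactors are compared by their multiplicativity for a right factor fixing the all-ones vector,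
-- used once in each direction. Singularity enters as det M · x = 0 for Mx = 0, read at a coordinate
-- where x is 1. In the basis t^k / k! the exponential of tM is the sequence of powers of M and
-- needs no inverse factorials. The factor e^(tA/2) has two roles. The logarithmic derivative of its
-- determinant is tr A / 2 = Σ w(τ), because each e_i - e_j has square length 2, and this cancels
-- the terms -det(1 - M e^(-tA)) left by the rank-one differences. It also turns 1 - e^(-tA) into 2
-- sinh(tA/2). Erasing a row of M, rather than passing to a minor, keeps all matrices square and is
-- stable under right multiplication by transpositions, so the recursion for derivatives stays
-- within one family.

open import Level using (0ℓ)
open import Algebra.Bundles using (CommutativeRing)
open import Data.Nat as ℕ using (ℕ; zero; suc; _≤_; z≤n; s≤s; _<_; _∸_; _<?_; _≡ᵇ_; _!; NonZero; _<ᵇ_)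
open import Data.Fin as Fin using (Fin; zero; suc; punchIn; inject₁; _≟_; toℕ; fromℕ<; punchOut)
open import Data.Bool using (Bool; true; false; T; _∧_; not; if_then_else_)
open import Data.Bool.Properties using (T-∧; T-∨; T-≡; T?)
open import Data.Product using (_,_; _×_; proj₁; proj₂; ∃; ∃₂)
open import Data.Sum using (_⊎_; inj₁; inj₂; [_,_]′)
open import Data.Empty using (⊥; ⊥-elim)
open import Data.Unit using (⊤; tt)
open import Function using (_∘_; Equivalence; id)
open import Relation.Nullary using (yes; no; contradiction; ¬_; does; Dec)
open import Relation.Nullary.Decidable using (_→-dec_; ¬?; _⊎-dec_; dec-true; dec-false)
open import Relation.Binary.Definitions using (tri<; tri≈; tri>)
open import Data.Rational as ℚ using (ℚ; 0ℚ; 1ℚ; ½; toℚᵘ)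

-- A ring solver with integer coefficients for any commutative ring.

module IntegerRingSolver where

  open import Algebra.Solver.Ring.AlmostCommutativeRing using (AlmostCommutativeRing; _-Raw-AlmostCommutative⟶_; fromCommutativeRing)
  import Algebra.Solver.Ring
  open import Data.Integer using (ℤ; +_; -[1+_])
  open import Data.Maybe using (Maybe; just; nothing)
  open import Relation.Binary.PropositionalEquality as ≡ using (_≡_)
  import Data.Integer as ℤ
  import Data.Integer.Properties as ℤₚ

  module IntegerCoefficients (R : CommutativeRing 0ℓ 0ℓ) where

    open CommutativeRing R
    open import Algebra.Properties.Ring ring
    open import Algebra.Properties.Semiring.Mult.TCOptimised semiring renaming (_×_ to _×′_)
    open import Relation.Binary.Reasoning.Setoid setoid

    -- With the type-checking-optimised multiple, `1 ×′ 1#` reduces to `1#`, so the solver constants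
    -- `:0` and `:1` denote `0#` and `1#` definitionally.
    ⟦_⟧ℤ : ℤ → Carrier
    ⟦ + n ⟧ℤ      = n ×′ 1#
    ⟦ -[1+ n ] ⟧ℤ = - (suc n ×′ 1#)

    neg-homo : ∀ i → ⟦ ℤ.- i ⟧ℤ ≈ - ⟦ i ⟧ℤ
    neg-homo (+ zero)   = sym -0#≈0#
    neg-homo (+ suc n)  = refl
    neg-homo -[1+ n ]   = sym (-‿involutive _)

    ⊖-homo : ∀ m n → ⟦ m ℤ.⊖ n ⟧ℤ ≈ m ×′ 1# - n ×′ 1#
    ⊖-homo m       zero    = sym (trans (+-congˡ -0#≈0#) (+-identityʳ _))
    ⊖-homo zero    (suc n) = sym (+-identityˡ _)
    ⊖-homo (suc m) (suc n) = begin
      ⟦ suc m ℤ.⊖ suc n ⟧ℤ             ≡⟨ ≡.cong ⟦_⟧ℤ (ℤₚ.[1+m]⊖[1+n]≡m⊖n m n) ⟩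
      ⟦ m ℤ.⊖ n ⟧ℤ                     ≈⟨ ⊖-homo m n ⟩
      m ×′ 1# - n ×′ 1#                  ≈⟨ +-congʳ (sym (+-identityˡ _)) ⟩
      0# + m ×′ 1# - n ×′ 1#             ≈⟨ +-congʳ (+-congʳ (sym (-‿inverseʳ 1#))) ⟩
      1# - 1# + m ×′ 1# - n ×′ 1#        ≈⟨ +-congʳ (+-assoc _ _ _) ⟩
      1# + (- 1# + m ×′ 1#) - n ×′ 1#    ≈⟨ +-congʳ (+-congˡ (+-comm _ _)) ⟩
      1# + (m ×′ 1# - 1#) - n ×′ 1#      ≈⟨ +-congʳ (sym (+-assoc _ _ _)) ⟩
      1# + m ×′ 1# - 1# - n ×′ 1#        ≈⟨ +-assoc _ _ _ ⟩
      1# + m ×′ 1# + (- 1# - n ×′ 1#)    ≈⟨ +-congˡ (-‿+-comm 1# (n ×′ 1#)) ⟩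
      1# + m ×′ 1# - (1# + n ×′ 1#)      ≈⟨ sym (+-cong (1+× m 1#) (-‿cong (1+× n 1#))) ⟩
      suc m ×′ 1# - suc n ×′ 1#          ∎

    +-homo : ∀ i j → ⟦ i ℤ.+ j ⟧ℤ ≈ ⟦ i ⟧ℤ + ⟦ j ⟧ℤ
    +-homo (+ m)    (+ n)    = ×-homo-+ 1# m n
    +-homo (+ m)    -[1+ n ] = ⊖-homo m (suc n)
    +-homo -[1+ m ] (+ n)    = trans (⊖-homo n (suc m)) (+-comm _ _)
    +-homo -[1+ m ] -[1+ n ] = begin
      - (suc (suc (m ℕ.+ n)) ×′ 1#)      ≈⟨ -‿cong (trans (1+× (suc m ℕ.+ n) 1#) (+-congˡ (×-homo-+ 1# (suc m) n))) ⟩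
      - (1# + (suc m ×′ 1# + n ×′ 1#))    ≈⟨ -‿cong (trans (sym (+-assoc _ _ _)) (trans (+-congʳ (+-comm _ _)) (trans (+-assoc _ _ _) (+-congˡ (sym (1+× n 1#)))))) ⟩
      - (suc m ×′ 1# + suc n ×′ 1#)       ≈⟨ sym (-‿+-comm _ _) ⟩
      - (suc m ×′ 1#) - suc n ×′ 1#       ∎

    pos-homo : ∀ m n → ⟦ + m ℤ.* + n ⟧ℤ ≈ ⟦ + m ⟧ℤ * ⟦ + n ⟧ℤ
    pos-homo m n = trans (reflexive (≡.cong ⟦_⟧ℤ (≡.sym (ℤₚ.pos-* m n)))) (×1-homo-* m n)

    pos-homoʳ : ∀ m j → ⟦ + m ℤ.* j ⟧ℤ ≈ ⟦ + m ⟧ℤ * ⟦ j ⟧ℤ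
    pos-homoʳ m (+ n)    = pos-homo m n
    pos-homoʳ m -[1+ n ] = begin
      ⟦ + m ℤ.* -[1+ n ] ⟧ℤ           ≡⟨ ≡.cong ⟦_⟧ℤ (≡.sym (ℤₚ.neg-distribʳ-* (+ m) (+ suc n))) ⟩
      ⟦ ℤ.- (+ m ℤ.* + suc n) ⟧ℤ      ≈⟨ neg-homo (+ m ℤ.* + suc n) ⟩
      - ⟦ + m ℤ.* + suc n ⟧ℤ          ≈⟨ -‿cong (pos-homo m (suc n)) ⟩
      - (m ×′ 1# * (suc n ×′ 1#))       ≈⟨ -‿distribʳ-* _ _ ⟩
      m ×′ 1# * - (suc n ×′ 1#)         ∎

    *-homo : ∀ i j → ⟦ i ℤ.* j ⟧ℤ ≈ ⟦ i ⟧ℤ * ⟦ j ⟧ℤ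
    *-homo (+ m)    j = pos-homoʳ m j
    *-homo -[1+ m ] j = begin
      ⟦ -[1+ m ] ℤ.* j ⟧ℤ             ≡⟨ ≡.cong ⟦_⟧ℤ (≡.sym (ℤₚ.neg-distribˡ-* (+ suc m) j)) ⟩
      ⟦ ℤ.- (+ suc m ℤ.* j) ⟧ℤ        ≈⟨ neg-homo (+ suc m ℤ.* j) ⟩
      - ⟦ + suc m ℤ.* j ⟧ℤ            ≈⟨ -‿cong (pos-homoʳ (suc m) j) ⟩
      - (suc m ×′ 1# * ⟦ j ⟧ℤ)         ≈⟨ -‿distribˡ-* _ _ ⟩
      - (suc m ×′ 1#) * ⟦ j ⟧ℤ         ∎

    acr : AlmostCommutativeRing 0ℓ 0ℓ
    acr = fromCommutativeRing R

    morphism : ℤ.+-*-rawRing -Raw-AlmostCommutative⟶ acr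
    morphism = record
      { ⟦_⟧ = ⟦_⟧ℤ ; +-homo = +-homo ; *-homo = *-homo ; -‿homo = neg-homo
      ; 0-homo = refl ; 1-homo = refl }

    _coeff≟_ : ∀ i j → Maybe (⟦ i ⟧ℤ ≈ ⟦ j ⟧ℤ)
    i coeff≟ j with i ℤ.≟ j
    ... | yes ≡.refl = just refl
    ... | no _       = nothing

  module RingSolver (R : CommutativeRing 0ℓ 0ℓ) where
    open IntegerCoefficients R
    open Algebra.Solver.Ring ℤ.+-*-rawRing acr morphism _coeff≟_ public
      using (Polynomial; solve; _:=_; _:+_; _:*_; _:-_; :-_; con)

    :0 :1 : ∀ {n} → Polynomial n
    :0 = con (+ 0)
    :1 = con (+ 1)

open IntegerRingSolver

-- Determinants over a commutative ring, through alternating forms.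

module Determinants where

  open import Data.Fin.Properties using (0≢1+n; suc-injective)
  open import Data.Vec.Functional using (_∷_)
  open import Relation.Binary.PropositionalEquality as ≡ using (_≡_; _≢_)

  private variable
    m n : ℕ
    A B : Set

  upd : (Fin m → A) → Fin m → A → Fin m → A
  upd v zero    x zero    = x
  upd v zero    x (suc k) = v (suc k)
  upd v (suc i) x zero    = v zero
  upd v (suc i) x (suc k) = upd (v ∘ suc) i x k

  upd-same : ∀ (v : Fin m → A) i x → upd v i x i ≡ x
  upd-same v zero    x = ≡.refl
  upd-same v (suc i) x = upd-same (v ∘ suc) i x

  upd-other : ∀ (v : Fin m → A) i x {k} → k ≢ i → upd v i x k ≡ v k
  upd-other v zero    x {zero}  k≢i = contradiction ≡.refl k≢i
  upd-other v zero    x {suc k} k≢i = ≡.refl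
  upd-other v (suc i) x {zero}  k≢i = ≡.refl
  upd-other v (suc i) x {suc k} k≢i = upd-other (v ∘ suc) i x (k≢i ∘ ≡.cong suc)

  upd-id : ∀ (v : Fin m → A) i k → upd v i (v i) k ≡ v k
  upd-id v zero    zero    = ≡.refl
  upd-id v zero    (suc k) = ≡.refl
  upd-id v (suc i) zero    = ≡.refl
  upd-id v (suc i) (suc k) = upd-id (v ∘ suc) i k

  upd-map : ∀ (f : A → B) (v : Fin m → A) i x k → f (upd v i x k) ≡ upd (f ∘ v) i (f x) k
  upd-map f v zero    x zero    = ≡.refl
  upd-map f v zero    x (suc k) = ≡.refl
  upd-map f v (suc i) x zero    = ≡.refl
  upd-map f v (suc i) x (suc k) = upd-map f (v ∘ suc) i x k

  -- The simplicial identities. Deleting two distinct columns in succession is possible in two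
  -- orders, indexed by (`inject₁ j`, `k`) and (`suc k`, `j`) with j ≤ k; the three lemmas say that
  -- both orders delete the same columns.
  punchIn-swap₁ : ∀ (j k : Fin (suc m)) → j Fin.≤ k → punchIn (inject₁ j) k ≡ suc k
  punchIn-swap₁ zero    k       _          = ≡.refl
  punchIn-swap₁ {suc m} (suc j) (suc k) (ℕ.s≤s j≤k) = ≡.cong suc (punchIn-swap₁ j k j≤k)

  punchIn-swap₂ : ∀ (j k : Fin (suc m)) → j Fin.≤ k → punchIn (suc k) j ≡ inject₁ j
  punchIn-swap₂ zero    k       _          = ≡.refl
  punchIn-swap₂ {suc m} (suc j) (suc k) (ℕ.s≤s j≤k) = ≡.cong suc (punchIn-swap₂ j k j≤k)

  punchIn-swap₃ : ∀ (j k : Fin (suc m)) → j Fin.≤ k → ∀ b →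
    punchIn (inject₁ j) (punchIn k b) ≡ punchIn (suc k) (punchIn j b)
  punchIn-swap₃ zero    k       _          b       = ≡.refl
  punchIn-swap₃ (suc j) (suc k) (ℕ.s≤s j≤k) zero    = ≡.refl
  punchIn-swap₃ (suc j) (suc k) (ℕ.s≤s j≤k) (suc b) = ≡.cong suc (punchIn-swap₃ j k j≤k b)

  module Determinant (R : CommutativeRing 0ℓ 0ℓ) where

    open CommutativeRing R hiding (zero)
    import Algebra.Properties.Semiring.Sum semiring as Sum
    open import Algebra.Properties.Ring ring
    open import Relation.Binary.Reasoning.Setoid setoid
    open RingSolver R

    Vect : ℕ → Set
    Vect n = Fin n → Carrier

    Matrix : ℕ → ℕ → Set
    Matrix m n = Fin m → Vect n

    infix 4 _≋_
    _≋_ : Matrix m n → Matrix m n → Set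
    M ≋ N = ∀ i j → M i j ≈ N i j

    ≡⇒≋ : {M N : Matrix m n} → (∀ i → M i ≡ N i) → M ≋ N
    ≡⇒≋ M≡N i j = reflexive (≡.cong (λ r → r j) (M≡N i))

    δ : Fin n → Fin n → Carrier
    δ zero    zero    = 1#
    δ zero    (suc _) = 0#
    δ (suc _) zero    = 0#
    δ (suc i) (suc j) = δ i j

    δ-refl : ∀ (i : Fin n) → δ i i ≡ 1#
    δ-refl zero    = ≡.refl
    δ-refl (suc i) = δ-refl i

    δ-≢ : ∀ {i j : Fin n} → i ≢ j → δ i j ≡ 0#
    δ-≢ {i = zero}  {zero}  i≢j = contradiction ≡.refl i≢j
    δ-≢ {i = zero}  {suc _} i≢j = ≡.refl
    δ-≢ {i = suc _} {zero}  i≢j = ≡.refl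
    δ-≢ {i = suc _} {suc _} i≢j = δ-≢ (i≢j ∘ ≡.cong suc)

    δ-sym : ∀ (i j : Fin n) → δ i j ≡ δ j i
    δ-sym zero    zero    = ≡.refl
    δ-sym zero    (suc _) = ≡.refl
    δ-sym (suc _) zero    = ≡.refl
    δ-sym (suc i) (suc j) = δ-sym i j

    opaque
      sum : Vect n → Carrier
      sum = Sum.sum

      sum-[] : {f : Vect 0} → sum f ≈ 0#
      sum-[] = refl

      sum-∷ : (f : Vect (suc n)) → sum f ≈ f zero + sum (f ∘ suc)
      sum-∷ f = refl

      sum-cong : ∀ {f g : Vect n} → (∀ i → f i ≈ g i) → sum f ≈ sum g
      sum-cong = Sum.sum-cong-≋

      sum-zero : ∀ {f : Vect n} → (∀ i → f i ≈ 0#) → sum f ≈ 0#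
      sum-zero {n} f≈0 = trans (Sum.sum-cong-≋ f≈0) (Sum.sum-replicate-zero n)

      ∑-distrib-+ : (f g : Vect n) → sum (λ i → f i + g i) ≈ sum f + sum g
      ∑-distrib-+ = Sum.∑-distrib-+

      ∑-comm : (f : Fin m → Vect n) → sum (λ i → sum (f i)) ≈ sum (λ j → sum (λ i → f i j))
      ∑-comm = Sum.∑-comm

      *-distribˡ-sum : ∀ c (f : Vect n) → c * sum f ≈ sum (λ i → c * f i)
      *-distribˡ-sum = Sum.*-distribˡ-sum

      *-distribʳ-sum : ∀ c (f : Vect n) → sum f * c ≈ sum (λ i → f i * c)
      *-distribʳ-sum = Sum.*-distribʳ-sum

    sum-lin : ∀ c (f g : Vect n) → sum (λ i → f i + c * g i) ≈ sum f + c * sum g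
    sum-lin c f g = trans (∑-distrib-+ f _) (+-congˡ (sym (*-distribˡ-sum c g)))

    sum-δˡ : ∀ (i : Fin n) (f : Vect n) → sum (λ k → δ i k * f k) ≈ f i
    sum-δˡ zero    f = trans (sum-∷ _) (trans (+-cong (*-identityˡ _) (sum-zero (λ k → zeroˡ (f (suc k))))) (+-identityʳ _))
    sum-δˡ (suc i) f = trans (sum-∷ _) (trans (+-cong (zeroˡ _) (sum-δˡ i (f ∘ suc))) (+-identityˡ _))

    sum-δʳ : ∀ (i : Fin n) (f : Vect n) → sum (λ k → f k * δ k i) ≈ f i
    sum-δʳ i f = trans (sum-cong (λ k → trans (*-comm _ _) (*-congʳ (reflexive (δ-sym k i))))) (sum-δˡ i f)

    infixl 7 _⊠_
    _⊠_ : ∀ {l} → Matrix l m → Matrix m n → Matrix l n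
    (M ⊠ N) i j = sum (λ k → M i k * N k j)

    ⊠-cong : ∀ {l} {M M' : Matrix l m} {N N' : Matrix m n} → M ≋ M' → N ≋ N' → M ⊠ N ≋ M' ⊠ N'
    ⊠-cong p q i j = sum-cong (λ k → *-cong (p i k) (q k j))

    ⊠-identityˡ : ∀ (M : Matrix m n) → δ ⊠ M ≋ M
    ⊠-identityˡ M i j = sum-δˡ i (λ k → M k j)

    ⊠-identityʳ : ∀ (M : Matrix m n) → M ⊠ δ ≋ M
    ⊠-identityʳ M i j = sum-δʳ j (M i)

    ⊠-assoc : ∀ {k l} (L : Matrix k l) (M : Matrix l m) (N : Matrix m n) → (L ⊠ M) ⊠ N ≋ L ⊠ (M ⊠ N)
    ⊠-assoc L M N i j = begin
      sum (λ b → sum (λ a → L i a * M a b) * N b j)    ≈⟨ sum-cong (λ b → *-distribʳ-sum (N b j) (λ a → L i a * M a b)) ⟩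
      sum (λ b → sum (λ a → L i a * M a b * N b j))    ≈⟨ ∑-comm (λ b a → L i a * M a b * N b j) ⟩
      sum (λ a → sum (λ b → L i a * M a b * N b j))    ≈⟨ sum-cong (λ a → sum-cong (λ b → *-assoc _ _ _)) ⟩
      sum (λ a → sum (λ b → L i a * (M a b * N b j)))  ≈⟨ sum-cong (λ a → sym (*-distribˡ-sum (L i a) (λ b → M a b * N b j))) ⟩
      sum (λ a → L i a * sum (λ b → M a b * N b j))    ∎

    -- Alternating multilinear forms replace sums over permutations: multiplicativity of the
    -- determinant will follow from uniqueness. Rows and columns are counted separately, because
    -- fixing a row lowers only the number of rows. `lin` merges additivity and homogeneity into one
    -- law.
    record AltForm (m n : ℕ) : Set where
      field
        fun  : Matrix m n → Carrier
        cong : ∀ {M N} → M ≋ N → fun M ≈ fun N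
        lin  : ∀ M i c x y → fun (upd M i (λ j → x j + c * y j)) ≈ fun (upd M i x) + c * fun (upd M i y)
        alt  : ∀ M {i k} → i ≢ k → (∀ j → M i j ≈ M k j) → fun M ≈ 0#

    open AltForm

    upd-cong : ∀ (M : Matrix m n) i {x y : Vect n} → (∀ j → x j ≈ y j) → upd M i x ≋ upd M i y
    upd-cong M i {x} {y} x≈y k j with k ≟ i
    ... | yes ≡.refl rewrite upd-same M k x | upd-same M k y = x≈y j
    ... | no k≢i     rewrite upd-other M i x k≢i | upd-other M i y k≢i = refl

    module _ (G : AltForm m n) where

      -- The law `lin` at 0 = 0 + (-1) · 0 gives G(0) = G(0) - G(0).
      lin-zero : ∀ M i {x} → (∀ j → x j ≈ 0#) → fun G (upd M i x) ≈ 0#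
      lin-zero M i {x} x≈0 = begin
        fun G (upd M i x)                                        ≈⟨ cong G (upd-cong M i x≈0) ⟩
        fun G (upd M i z)                                        ≈⟨ cong G (upd-cong M i (λ _ → solve 0 (:0 := :0 :+ :- :1 :* :0) refl)) ⟩
        fun G (upd M i (λ j → 0# + - 1# * 0#))                   ≈⟨ lin G M i (- 1#) z z ⟩
        fun G (upd M i z) + - 1# * fun G (upd M i z)             ≈⟨ solve 1 (λ x → x :+ :- :1 :* x := :0) refl _ ⟩
        0#                                                       ∎
        where
          z = λ (_ : Fin n) → 0#

      lin-sum : ∀ {l} M i (c : Vect l) (v : Matrix l n) →
        fun G (upd M i (λ j → sum (λ k → c k * v k j))) ≈ sum (λ k → c k * fun G (upd M i (v k)))
      lin-sum {zero}  M i c v = trans (lin-zero M i (λ _ → sum-[])) (sym sum-[])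
      lin-sum {suc l} M i c v = begin
        fun G (upd M i (λ j → sum (λ k → c k * v k j)))
          ≈⟨ cong G (upd-cong M i (λ _ → sum-∷ _)) ⟩
        fun G (upd M i (λ j → c zero * v zero j + sum (λ k → c (suc k) * v (suc k) j)))
          ≈⟨ cong G (upd-cong M i (λ _ → +-comm _ _)) ⟩
        fun G (upd M i (λ j → sum (λ k → c (suc k) * v (suc k) j) + c zero * v zero j))
          ≈⟨ lin G M i (c zero) _ (v zero) ⟩
        fun G (upd M i (λ j → sum (λ k → c (suc k) * v (suc k) j))) + c zero * fun G (upd M i (v zero))
          ≈⟨ +-congʳ (lin-sum M i (c ∘ suc) (v ∘ suc)) ⟩
        sum (λ k → c (suc k) * fun G (upd M i (v (suc k)))) + c zero * fun G (upd M i (v zero))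
          ≈⟨ trans (+-comm _ _) (sym (sum-∷ _)) ⟩
        sum (λ k → c k * fun G (upd M i (v k))) ∎

    consForm : AltForm (suc m) n → Vect n → AltForm m n
    fun (consForm G x) M = fun G (x ∷ M)
    cong (consForm G x) p = cong G λ { zero j → refl ; (suc i) j → p i j }
    lin (consForm G x) M i c y z =
      trans (cong G (≡⇒≋ (shift _))) (trans (lin G (x ∷ M) (suc i) c y z) (+-cong (back y) (*-congˡ (back z))))
      where
      shift : ∀ y k → (x ∷ upd M i y) k ≡ upd (x ∷ M) (suc i) y k
      shift y zero    = ≡.refl
      shift y (suc k) = ≡.refl
      back : ∀ y → fun G (upd (x ∷ M) (suc i) y) ≈ fun G (x ∷ upd M i y)
      back y = cong G (≡⇒≋ (λ k → ≡.sym (shift y k)))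
    alt (consForm G x) M i≢k p = alt G (x ∷ M) (i≢k ∘ suc-injective) p

    η∷ : (M : Matrix (suc m) n) → (M zero ∷ M ∘ suc) ≋ M
    η∷ M zero    j = refl
    η∷ M (suc i) j = refl

    upd-zero≋ : (M : Matrix (suc m) n) (x : Vect n) → upd M zero x ≋ (x ∷ M ∘ suc)
    upd-zero≋ M x zero    j = refl
    upd-zero≋ M x (suc i) j = refl

    ∷-cong : ∀ {x y : Vect n} {M N : Matrix m n} → (∀ j → x j ≈ y j) → M ≋ N → (x ∷ M) ≋ (y ∷ N)
    ∷-cong p q zero    j = p j
    ∷-cong p q (suc i) j = q i j

    lin₀ : ∀ (G : AltForm (suc m) n) c x y M → fun G ((λ j → x j + c * y j) ∷ M) ≈ fun G (x ∷ M) + c * fun G (y ∷ M)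
    lin₀ G c x y M = trans (sym (at _)) (trans (lin G (x ∷ M) zero c x y) (+-cong (at x) (*-congˡ (at y))))
      where
      at : ∀ z → fun G (upd (x ∷ M) zero z) ≈ fun G (z ∷ M)
      at z = cong G (upd-zero≋ (x ∷ M) z)

    -- Row by row, linearity splits off a term with x itself as a row, which the hypothesis kills;
    -- the remaining term is the same claim for the form with that row fixed.
    absorb : ∀ (G : AltForm m n) (x : Vect n) → (∀ M i → (∀ j → M i j ≈ x j) → fun G M ≈ 0#) →
      ∀ (c : Vect m) M → fun G (λ i j → M i j + c i * x j) ≈ fun G M
    absorb {zero}  G x van c M = cong G (λ ())
    absorb {suc m} G x van c M = begin
      fun G (λ i j → M i j + c i * x j)
        ≈⟨ cong G (λ { zero j → refl ; (suc i) j → refl }) ⟩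
      fun G ((λ j → M zero j + c zero * x j) ∷ rest)
        ≈⟨ lin₀ G (c zero) (M zero) x rest ⟩
      fun G (M zero ∷ rest) + c zero * fun G (x ∷ rest)
        ≈⟨ +-cong (absorb (consForm G (M zero)) x (λ N i p → van (M zero ∷ N) (suc i) p) (c ∘ suc) (M ∘ suc))
                  (trans (*-congˡ (van (x ∷ rest) zero (λ _ → refl))) (zeroʳ _)) ⟩
      fun G (M zero ∷ M ∘ suc) + 0#
        ≈⟨ +-identityʳ _ ⟩
      fun G (M zero ∷ M ∘ suc)
        ≈⟨ cong G (η∷ M) ⟩
      fun G M ∎
      where rest = λ i j → M (suc i) j + c (suc i) * x j

    absorb-head : ∀ (G : AltForm (suc m) n) x (c : Vect m) M →
      fun G (x ∷ (λ i j → M i j + c i * x j)) ≈ fun G (x ∷ M)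
    absorb-head G x c M =
      absorb (consForm G x) x (λ N i p → alt G (x ∷ N) {zero} {suc i} 0≢1+n (λ j → sym (p j))) c M

    -- Terms with v in two rows vanish, so only the terms of degree at most one in u survive. Once
    -- the first row is v, `absorb-head` removes the multiples of v from all other rows.
    rankOne : ∀ (G : AltForm m n) M (u : Vect m) (v : Vect n) →
      fun G (λ i j → M i j + u i * v j) ≈ fun G M + sum (λ i → u i * fun G (upd M i v))
    rankOne {zero}  G M u v = trans (cong G (λ ())) (sym (trans (+-congˡ sum-[]) (+-identityʳ _)))
    rankOne {suc m} G M u v = begin
      fun G (λ i j → M i j + u i * v j)
        ≈⟨ cong G (λ { zero j → refl ; (suc i) j → refl }) ⟩
      fun G ((λ j → M zero j + u zero * v j) ∷ rest)
        ≈⟨ lin₀ G (u zero) (M zero) v rest ⟩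
      fun G (M zero ∷ rest) + u zero * fun G (v ∷ rest)
        ≈⟨ +-cong (rankOne (consForm G (M zero)) (M ∘ suc) (u ∘ suc) v)
                  (*-congˡ (trans (absorb-head G v (u ∘ suc) (M ∘ suc)) (cong G (λ i j → sym (upd-zero≋ M v i j))))) ⟩
      fun G (M zero ∷ M ∘ suc) + sum (λ i → u (suc i) * fun G (M zero ∷ upd (M ∘ suc) i v)) + u zero * fun G (upd M zero v)
        ≈⟨ +-congʳ (+-cong (cong G (η∷ M)) (sum-cong (λ i → *-congˡ (cong G (λ { zero j → refl ; (suc k) j → refl }))))) ⟩
      fun G M + sum (λ i → u (suc i) * fun G (upd M (suc i) v)) + u zero * fun G (upd M zero v)
        ≈⟨ solve 3 (λ a b c → a :+ b :+ c := a :+ (c :+ b)) refl _ _ _ ⟩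
      fun G M + (u zero * fun G (upd M zero v) + sum (λ i → u (suc i) * fun G (upd M (suc i) v)))
        ≈⟨ +-congˡ (sym (sum-∷ _)) ⟩
      fun G M + sum (λ i → u i * fun G (upd M i v)) ∎
      where rest = λ i j → M (suc i) j + u (suc i) * v j

    -- Polarisation: expand the vanishing value with x + y in both rows.
    swap₀₁ : ∀ (G : AltForm (suc (suc m)) n) x y M → fun G (x ∷ y ∷ M) ≈ - fun G (y ∷ x ∷ M)
    swap₀₁ G x y M = begin
      fun G (x ∷ y ∷ M)
        ≈⟨ solve 2 (λ a b → a := :0 :+ :1 :* a :+ :1 :* (b :+ :1 :* :0) :- b) refl _ (fun G (y ∷ x ∷ M)) ⟩
      0# + 1# * fun G (x ∷ y ∷ M) + 1# * (fun G (y ∷ x ∷ M) + 1# * 0#) - fun G (y ∷ x ∷ M)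
        ≈⟨ +-congʳ (+-cong (+-congʳ (sym (same x))) (*-congˡ (+-congˡ (*-congˡ (sym (same y)))))) ⟩
      fun G (x ∷ x ∷ M) + 1# * fun G (x ∷ y ∷ M) + 1# * (fun G (y ∷ x ∷ M) + 1# * fun G (y ∷ y ∷ M)) - fun G (y ∷ x ∷ M)
        ≈⟨ +-congʳ (+-cong (sym (lin₁ x)) (*-congˡ (sym (lin₁ y)))) ⟩
      fun G (x ∷ s ∷ M) + 1# * fun G (y ∷ s ∷ M) - fun G (y ∷ x ∷ M)
        ≈⟨ +-congʳ (sym (lin₀ G 1# x y (s ∷ M))) ⟩
      fun G (s ∷ s ∷ M) - fun G (y ∷ x ∷ M)
        ≈⟨ trans (+-congʳ (same s)) (+-identityˡ _) ⟩
      - fun G (y ∷ x ∷ M) ∎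
      where
      s = λ j → x j + 1# * y j
      same : ∀ z → fun G (z ∷ z ∷ M) ≈ 0#
      same z = alt G (z ∷ z ∷ M) {zero} {suc zero} (λ ()) (λ _ → refl)
      lin₁ : ∀ z → fun G (z ∷ s ∷ M) ≈ fun G (z ∷ x ∷ M) + 1# * fun G (z ∷ y ∷ M)
      lin₁ z = lin₀ (consForm G z) 1# x y M

    sgn : Fin n → Carrier
    sgn zero    = 1#
    sgn (suc k) = - sgn k

    sgn² : ∀ (k : Fin n) → sgn k * sgn k ≈ 1#
    sgn² zero    = *-identityˡ 1#
    sgn² (suc k) = trans (solve 1 (λ x → :- x :* :- x := x :* x) refl (sgn k)) (sgn² k)

    -- Row k reaches the front by k exchanges of neighbours, each costing a sign.
    toFront : ∀ (G : AltForm (suc m) n) v k → fun G (v k ∷ v ∘ punchIn k) ≈ sgn k * fun G v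
    toFront G v zero = trans (cong G (η∷ v)) (sym (*-identityˡ _))
    toFront {suc m} G v (suc k) = begin
      fun G (v (suc k) ∷ v ∘ punchIn (suc k))
        ≈⟨ cong G (λ { zero j → refl ; (suc zero) j → refl ; (suc (suc i)) j → refl }) ⟩
      fun G (v (suc k) ∷ v zero ∷ v ∘ suc ∘ punchIn k)
        ≈⟨ swap₀₁ G _ _ _ ⟩
      - fun G (v zero ∷ v (suc k) ∷ v ∘ suc ∘ punchIn k)
        ≈⟨ -‿cong (toFront (consForm G (v zero)) (v ∘ suc) k) ⟩
      - (sgn k * fun G (v zero ∷ v ∘ suc))
        ≈⟨ -‿cong (*-congˡ (cong G (η∷ v))) ⟩
      - (sgn k * fun G v)
        ≈⟨ -‿distribˡ-* _ _ ⟩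
      - sgn k * fun G v ∎

    minor : Matrix m (suc n) → Fin (suc n) → Matrix m n
    minor M j a b = M a (punchIn j b)

    pullback : ∀ {l} (f : Vect n → Vect l) →
      (∀ {x y} → (∀ j → x j ≈ y j) → ∀ j → f x j ≈ f y j) →
      (∀ c x y j → f (λ k → x k + c * y k) j ≈ f x j + c * f y j) →
      AltForm m l → AltForm m n
    fun (pullback f f-cong f-lin G) M = fun G (f ∘ M)
    cong (pullback f f-cong f-lin G) p = cong G (λ i → f-cong (p i))
    lin (pullback f f-cong f-lin G) M i c x y =
      trans (trans (cong G (≡⇒≋ (upd-map f M i _))) (cong G (upd-cong (f ∘ M) i (f-lin c x y))))
        (trans (lin G (f ∘ M) i c (f x) (f y))
               (+-cong (cong G (≡⇒≋ (≡.sym ∘ upd-map f M i x))) (*-congˡ (cong G (≡⇒≋ (≡.sym ∘ upd-map f M i y))))))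
    alt (pullback f f-cong f-lin G) M i≢k p = alt G (f ∘ M) i≢k (f-cong p)

    sumForm : ∀ {l} → Vect l → (Fin l → AltForm m n) → AltForm m n
    fun (sumForm c G) M = sum (λ k → c k * fun (G k) M)
    cong (sumForm c G) p = sum-cong (λ k → *-congˡ (cong (G k) p))
    lin (sumForm c G) M i a x y = trans (sum-cong (λ k → trans (*-congˡ (lin (G k) M i a x y))
      (solve 4 (λ c p a q → c :* (p :+ a :* q) := c :* p :+ a :* (c :* q)) refl (c k) _ a _))) (sum-lin a _ _)
    alt (sumForm c G) M i≢k p = sum-zero (λ k → trans (*-congˡ (alt (G k) M i≢k p)) (zeroʳ _))

    -- This is the cancellation in a double expansion along two equal rows. The terms with j zero
    -- cancel those with k zero, and what remains has the same signs and the same symmetry one size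
    -- smaller.
    alternatingSum : ∀ m (H : Fin (suc (suc m)) → Fin (suc m) → Carrier) →
      (∀ j k → j Fin.≤ k → H (inject₁ j) k ≈ H (suc k) j) →
      sum (λ j → sgn j * sum (λ k → sgn k * H j k)) ≈ 0#
    alternatingSum m H H-sym = begin
      sum (λ j → sgn j * sum (λ k → sgn k * H j k))
        ≈⟨ trans (sum-∷ _) (+-congˡ (sum-cong (λ j → *-congˡ (sum-∷ (λ k → sgn k * H (suc j) k))))) ⟩
      1# * sum (λ k → sgn k * H zero k) + sum (λ j → - sgn j * (1# * H (suc j) zero + sum (λ k → - sgn k * H (suc j) (suc k))))
        ≈⟨ +-cong (*-identityˡ _) (sum-cong (λ j → trans (distribˡ _ _ _) (+-congˡ (*-congˡ (sum-cong λ k → sym (-‿distribˡ-* _ _)))))) ⟩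
      sum (λ k → sgn k * H zero k) + sum (λ j → - sgn j * (1# * H (suc j) zero) + - sgn j * sum (λ k → - (sgn k * H (suc j) (suc k))))
        ≈⟨ +-congˡ (∑-distrib-+ _ _) ⟩
      sum (λ k → sgn k * H zero k) + (sum (λ j → - sgn j * (1# * H (suc j) zero)) + sum (λ j → - sgn j * sum (λ k → - (sgn k * H (suc j) (suc k)))))
        ≈⟨ +-congˡ (+-congˡ (trans (sum-cong (λ j → inner j)) (rest m H H-sym))) ⟩
      sum (λ k → sgn k * H zero k) + (sum (λ j → - sgn j * (1# * H (suc j) zero)) + 0#)
        ≈⟨ trans (+-congˡ (+-identityʳ _)) (sym (∑-distrib-+ _ _)) ⟩
      sum (λ k → sgn k * H zero k + - sgn k * (1# * H (suc k) zero))
        ≈⟨ sum-zero (λ k → trans (+-congʳ (*-congˡ (H-sym zero k ℕ.z≤n)))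
             (solve 2 (λ s h → s :* h :+ :- s :* (:1 :* h) := :0) refl (sgn k) (H (suc k) zero))) ⟩
      0# ∎
      where
      inner : ∀ j → - sgn j * sum (λ k → - (sgn k * H (suc j) (suc k))) ≈ sgn j * sum (λ k → sgn k * H (suc j) (suc k))
      inner j = begin
        - sgn j * sum (λ k → - (sgn k * H (suc j) (suc k)))
          ≈⟨ *-congˡ (trans (sum-cong (λ k → sym (-1*x≈-x _))) (sym (*-distribˡ-sum (- 1#) (λ k → sgn k * H (suc j) (suc k))))) ⟩
        - sgn j * (- 1# * sum (λ k → sgn k * H (suc j) (suc k)))
          ≈⟨ solve 2 (λ s x → :- s :* (:- :1 :* x) := s :* x) refl (sgn j) _ ⟩
        sgn j * sum (λ k → sgn k * H (suc j) (suc k)) ∎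
      rest : ∀ m (H : Fin (suc (suc m)) → Fin (suc m) → Carrier) →
        (∀ j k → j Fin.≤ k → H (inject₁ j) k ≈ H (suc k) j) →
        sum (λ j → sgn j * sum (λ k → sgn k * H (suc j) (suc k))) ≈ 0#
      rest zero    H p = sum-zero (λ j → trans (*-congˡ sum-[]) (zeroʳ (sgn j)))
      rest (suc m) H p = alternatingSum m (λ j k → H (suc j) (suc k)) (λ j k j≤k → p (suc j) (suc k) (ℕ.s≤s j≤k))

    expand : AltForm m m → Matrix (suc m) (suc m) → Carrier
    expand D M = sum (λ j → sgn j * (M zero j * fun D (minor (M ∘ suc) j)))

    -- The first-row expansion with its first row frozen: as a form in the other rows it inherits
    -- linearity and alternation from the minors, so only alternation involving the first row has to
    -- be proved.
    expandForm : AltForm m m → Vect (suc m) → AltForm m (suc m)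
    expandForm {m} D x = sumForm (λ j → sgn j * x j) minorForm
      where
      minorForm : Fin (suc m) → AltForm m (suc m)
      minorForm j = pullback (λ x → x ∘ punchIn j) (λ p b → p (punchIn j b)) (λ _ _ _ _ → refl) D

    expand≈ : ∀ (D : AltForm m m) M → expand D M ≈ fun (expandForm D (M zero)) (M ∘ suc)
    expand≈ D M = sum-cong (λ j → sym (*-assoc (sgn j) (M zero j) _))

    stepForm : (D : AltForm m m) → (∀ M k → (∀ j → M zero j ≈ M (suc k) j) → expand D M ≈ 0#) → AltForm (suc m) (suc m)
    fun (stepForm D first) = expand D
    cong (stepForm D first) p = sum-cong (λ j → *-congˡ {sgn j} (*-cong (p zero j) (cong D (λ a b → p (suc a) (punchIn j b)))))
    lin (stepForm D first) M zero c x y = trans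
      (sum-cong (λ j → solve 5 (λ s a c b d → s :* ((a :+ c :* b) :* d) := s :* (a :* d) :+ c :* (s :* (b :* d))) refl
        (sgn j) (x j) c (y j) (fun D (minor (M ∘ suc) j))))
      (sum-lin c (λ j → sgn j * (x j * fun D (minor (M ∘ suc) j))) (λ j → sgn j * (y j * fun D (minor (M ∘ suc) j))))
    lin (stepForm D first) M (suc i) c x y =
      trans (expand≈ D (upd M (suc i) (λ j → x j + c * y j)))
        (trans (lin (expandForm D (M zero)) (M ∘ suc) i c x y)
          (+-cong (sym (expand≈ D (upd M (suc i) x))) (*-congˡ (sym (expand≈ D (upd M (suc i) y))))))
    alt (stepForm D first) M {zero}  {zero}  i≢k p = contradiction ≡.refl i≢k
    alt (stepForm D first) M {zero}  {suc k} i≢k p = first M k p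
    alt (stepForm D first) M {suc i} {zero}  i≢k p = first M i (λ j → sym (p j))
    alt (stepForm D first) M {suc i} {suc k} i≢k p =
      trans (expand≈ D M) (alt (expandForm D (M zero)) (M ∘ suc) (i≢k ∘ ≡.cong suc) p)

    -- Expanding along both equal rows gives a double sum whose terms are symmetric under the two
    -- orders of deleting a pair of columns.
    alt₀₁ : ∀ (D : AltForm m m) (first : _) (M : Matrix (suc (suc m)) (suc (suc m))) →
      (∀ j → M zero j ≈ M (suc zero) j) → expand (stepForm D first) M ≈ 0#
    alt₀₁ {m} D first M p = trans
      (sum-cong (λ j → *-congˡ {sgn j} (trans (*-distribˡ-sum (M zero j) (λ k → sgn k * (M (suc zero) (punchIn j k) * E j k)))
        (sum-cong (λ k → solve 4 (λ x s y d → x :* (s :* (y :* d)) := s :* (x :* y :* d)) refl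
          (M zero j) (sgn k) (M (suc zero) (punchIn j k)) (E j k))))))
      (alternatingSum m H H-sym)
      where
      E H : Fin (suc (suc m)) → Fin (suc m) → Carrier
      E j k = fun D (λ a b → M (suc (suc a)) (punchIn j (punchIn k b)))
      H j k = M zero j * M (suc zero) (punchIn j k) * E j k
      H-sym : ∀ j k → j Fin.≤ k → H (inject₁ j) k ≈ H (suc k) j
      H-sym j k j≤k = *-cong
        (trans (*-cong (p (inject₁ j)) (reflexive (≡.cong (M (suc zero)) (punchIn-swap₁ j k j≤k))))
          (trans (*-comm _ _)
            (*-cong (sym (p (suc k))) (reflexive (≡.cong (M (suc zero)) (≡.sym (punchIn-swap₂ j k j≤k)))))))
        (cong D (λ a b → reflexive (≡.cong (M (suc (suc a))) (punchIn-swap₃ j k j≤k b))))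

    -- The row equal to row zero is moved up to position one, where `alt₀₁` applies. The sign is
    -- inserted twice so that one copy pays for this move.
    alt₀ : ∀ (D : AltForm m m) (first : _) (M : Matrix (suc (suc m)) (suc (suc m))) k →
      (∀ j → M zero j ≈ M (suc k) j) → expand (stepForm D first) M ≈ 0#
    alt₀ D first M k p = begin
      d                    ≈⟨ sym (*-identityˡ d) ⟩
      1# * d               ≈⟨ *-congʳ (sym (sgn² k)) ⟩
      sgn k * sgn k * d    ≈⟨ *-assoc _ _ _ ⟩
      sgn k * (sgn k * d)  ≈⟨ *-congˡ (*-congˡ (expand≈ D' M)) ⟩
      sgn k * (sgn k * fun G (M ∘ suc))
        ≈⟨ *-congˡ (sym (toFront G (M ∘ suc) k)) ⟩
      sgn k * fun G (M (suc k) ∷ M ∘ suc ∘ punchIn k)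
        ≈⟨ *-congˡ (sym (expand≈ D' N)) ⟩
      sgn k * expand D' N
        ≈⟨ *-congˡ (alt₀₁ D first N p) ⟩
      sgn k * 0#           ≈⟨ zeroʳ _ ⟩
      0#                   ∎
      where
      D' = stepForm D first
      d = expand D' M
      G = expandForm D' (M zero)
      N = M zero ∷ M (suc k) ∷ M ∘ suc ∘ punchIn k

    opaque
      mutual
        -- The form in each size needs alternation of its first row, and that in turn is derived
        -- from the form one size smaller. In size one there is no second row, so the recursion
        -- starts without a proof.
        detForm : ∀ m → AltForm m m
        detForm zero = record
          { fun = λ _ → 1# ; cong = λ _ → refl ; lin = λ _ () ; alt = λ { M {()} } }
        detForm (suc m) = stepForm (detForm m) (detForm-alt₀ m)

        detForm-alt₀ : ∀ m (M : Matrix (suc m) (suc m)) k → (∀ j → M zero j ≈ M (suc k) j) → expand (detForm m) M ≈ 0#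
        detForm-alt₀ (suc m) = alt₀ (detForm m) (detForm-alt₀ m)

    det : Matrix m m → Carrier
    det {m} = fun (detForm m)

    opaque
      unfolding detForm

      det-zero : ∀ (M : Matrix 0 0) → det M ≈ 1#
      det-zero M = refl

      det-suc : ∀ (M : Matrix (suc m) (suc m)) → det M ≈ sum (λ j → sgn j * (M zero j * det (minor (M ∘ suc) j)))
      det-suc M = refl

    det-cong : {M N : Matrix m m} → M ≋ N → det M ≈ det N
    det-cong {m} = cong (detForm m)

    det-δ : ∀ m → det {m} δ ≈ 1#
    det-δ zero    = det-zero δ
    det-δ (suc m) = begin
      det {suc m} δ
        ≈⟨ trans (det-suc δ) (sum-∷ _) ⟩
      1# * (1# * det {m} δ) + sum (λ j → - sgn j * (0# * det (minor (δ ∘ suc) (suc j))))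
        ≈⟨ +-cong (*-congˡ (*-congˡ (det-δ m))) (sum-zero (λ j → trans (*-congˡ (zeroˡ _)) (zeroʳ (- sgn j)))) ⟩
      1# * (1# * 1#) + 0#
        ≈⟨ solve 0 (:1 :* (:1 :* :1) :+ :0 := :1) refl ⟩
      1# ∎

    insert0 : Fin (suc n) → Vect n → Vect (suc n)
    insert0 zero            r zero    = 0#
    insert0 zero            r (suc b) = r b
    insert0 {suc n} (suc j) r zero    = r zero
    insert0 {suc n} (suc j) r (suc b) = insert0 j (r ∘ suc) b

    insert0-cong : ∀ (j : Fin (suc n)) {x y : Vect n} → (∀ b → x b ≈ y b) → ∀ b → insert0 j x b ≈ insert0 j y b
    insert0-cong zero            p zero    = refl
    insert0-cong zero            p (suc b) = p b
    insert0-cong {suc n} (suc j) p zero    = p zero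
    insert0-cong {suc n} (suc j) p (suc b) = insert0-cong j (p ∘ suc) b

    insert0-lin : ∀ (j : Fin (suc n)) c x y b → insert0 j (λ k → x k + c * y k) b ≈ insert0 j x b + c * insert0 j y b
    insert0-lin zero            c x y zero    = sym (trans (+-identityˡ _) (zeroʳ c))
    insert0-lin zero            c x y (suc b) = refl
    insert0-lin {suc n} (suc j) c x y zero    = refl
    insert0-lin {suc n} (suc j) c x y (suc b) = insert0-lin j c (x ∘ suc) (y ∘ suc) b

    -- Deleting coordinate j and putting 0 back amounts to subtracting v_j e_j, which an alternating
    -- form does not notice when e_j is already one of the rows.
    insert0-punchIn : ∀ (j : Fin (suc n)) v b → insert0 j (v ∘ punchIn j) b ≈ v b + - v j * δ j b
    insert0-punchIn zero            v zero    = solve 1 (λ x → :0 := x :+ :- x :* :1) refl (v zero)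
    insert0-punchIn zero            v (suc b) = solve 2 (λ x y → x := x :+ :- y :* :0) refl (v (suc b)) (v zero)
    insert0-punchIn {suc n} (suc j) v zero    = solve 2 (λ x y → x := x :+ :- y :* :0) refl (v zero) (v (suc j))
    insert0-punchIn {suc n} (suc j) v (suc b) = insert0-punchIn j (v ∘ suc) b

    insert0-δ : ∀ (j : Fin (suc n)) a b → insert0 j (δ a) b ≈ δ (punchIn j a) b
    insert0-δ zero            a       zero    = refl
    insert0-δ zero            a       (suc b) = refl
    insert0-δ {suc n} (suc j) zero    zero    = refl
    insert0-δ {suc n} (suc j) zero    (suc b) = trans (insert0-cong j (λ _ → refl) b) (insert0-0 j b)
      where
      insert0-0 : ∀ {n} (j : Fin (suc n)) b → insert0 j (λ _ → 0#) b ≈ 0#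
      insert0-0 zero            zero    = refl
      insert0-0 zero            (suc b) = refl
      insert0-0 {suc n} (suc j) zero    = refl
      insert0-0 {suc n} (suc j) (suc b) = insert0-0 j b
    insert0-δ {suc n} (suc j) (suc a) zero    = refl
    insert0-δ {suc n} (suc j) (suc a) (suc b) = insert0-δ j a b

    -- The first row is expanded in unit vectors. With e_j in front, column j of the other rows can
    -- be cleared, so the value depends only on the minor and induction applies; bringing e_j back
    -- into its place in the identity produces the sign.
    det-unique : ∀ m (G : AltForm m m) M → fun G M ≈ det M * fun G δ
    det-unique zero    G M = trans (cong G (λ ())) (sym (trans (*-congʳ (det-zero M)) (*-identityˡ _)))
    det-unique (suc m) G M = begin
      fun G M
        ≈⟨ cong G (λ { zero j → sym (sum-δʳ j (M zero)) ; (suc i) j → refl }) ⟩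
      fun G (upd M zero (λ b → sum (λ j → M zero j * δ j b)))
        ≈⟨ lin-sum G M zero (M zero) δ ⟩
      sum (λ j → M zero j * fun G (upd M zero (δ j)))
        ≈⟨ sum-cong (λ j → trans (*-congˡ {M zero j} (term j))
            (solve 4 (λ x d s g → x :* (d :* (s :* g)) := s :* (x :* d) :* g) refl (M zero j) (det (minor (M ∘ suc) j)) (sgn j) (fun G δ))) ⟩
      sum (λ j → sgn j * (M zero j * det (minor (M ∘ suc) j)) * fun G δ)
        ≈⟨ sym (*-distribʳ-sum (fun G δ) (λ j → sgn j * (M zero j * det (minor (M ∘ suc) j)))) ⟩
      sum (λ j → sgn j * (M zero j * det (minor (M ∘ suc) j))) * fun G δ
        ≈⟨ *-congʳ (sym (det-suc M)) ⟩
      det M * fun G δ ∎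
      where
      G' : Fin (suc m) → AltForm m m
      G' j = pullback (insert0 j) (insert0-cong j) (insert0-lin j) (consForm G (δ j))
      term : ∀ j → fun G (upd M zero (δ j)) ≈ det (minor (M ∘ suc) j) * (sgn j * fun G δ)
      term j = begin
        fun G (upd M zero (δ j))
          ≈⟨ cong G (upd-zero≋ M (δ j)) ⟩
        fun G (δ j ∷ M ∘ suc)
          ≈⟨ sym (absorb-head G (δ j) (λ i → - M (suc i) j) (M ∘ suc)) ⟩
        fun G (δ j ∷ (λ i b → M (suc i) b + - M (suc i) j * δ j b))
          ≈⟨ cong G (∷-cong (λ _ → refl) (λ i b → sym (insert0-punchIn j (M (suc i)) b))) ⟩
        fun (G' j) (minor (M ∘ suc) j)
          ≈⟨ det-unique m (G' j) (minor (M ∘ suc) j) ⟩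
        det (minor (M ∘ suc) j) * fun (G' j) δ
          ≈⟨ *-congˡ (trans (cong G (∷-cong (λ _ → refl) (insert0-δ j))) (toFront G δ j)) ⟩
        det (minor (M ∘ suc) j) * (sgn j * fun G δ) ∎

    det-⊠ : ∀ (M N : Matrix m m) → det (M ⊠ N) ≈ det M * det N
    det-⊠ {m} M N = trans (det-unique m G M) (*-congˡ (det-cong (⊠-identityˡ N)))
      where
      G : AltForm m m
      G = pullback (λ x j → sum (λ k → x k * N k j)) (λ p j → sum-cong (λ k → *-congʳ (p k)))
        (λ c x y j → trans (sum-cong (λ k → solve 4 (λ x c y n → (x :+ c :* y) :* n := x :* n :+ c :* (y :* n)) refl (x k) c (y k) (N k j)))
                           (sum-lin c (λ k → x k * N k j) (λ k → y k * N k j)))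
        (detForm m)

    det-rankOne : ∀ (M : Matrix m m) u v → det (λ i j → M i j + u i * v j) ≈ det M + sum (λ i → u i * det (upd M i v))
    det-rankOne {m} = rankOne (detForm m)

    det-row-of : ∀ (M : Matrix m m) i k → k ≢ i → det (upd M i (M k)) ≈ 0#
    det-row-of {m} M i k k≢i = alt (detForm m) (upd M i (M k)) k≢i
      (λ j → reflexive (≡.trans (≡.cong (λ r → r j) (upd-other M i (M k) k≢i)) (≡.sym (≡.cong (λ r → r j) (upd-same M i (M k))))))

    det-upd-row : ∀ (M : Matrix m m) i k → det (upd M i (M k)) ≈ δ i k * det M
    det-upd-row M i k with i ≟ k
    ... | yes ≡.refl = trans (det-cong (≡⇒≋ (upd-id M i))) (sym (trans (*-congʳ (reflexive (δ-refl i))) (*-identityˡ _)))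
    ... | no i≢k     = trans (det-row-of M i k (i≢k ∘ ≡.sym)) (sym (trans (*-congʳ (reflexive (δ-≢ i≢k))) (zeroˡ _)))

    -- A term k ≠ i repeats row k, so only the coefficient of row i itself is left.
    det-upd-combination : ∀ (M : Matrix m m) i c → det (upd M i (λ j → sum (λ k → c k * M k j))) ≈ c i * det M
    det-upd-combination {m} M i c = begin
      det (upd M i (λ j → sum (λ k → c k * M k j)))  ≈⟨ lin-sum (detForm m) M i c M ⟩
      sum (λ k → c k * det (upd M i (M k)))          ≈⟨ sum-cong (λ k → *-congˡ {c k} (det-upd-row M i k)) ⟩
      sum (λ k → c k * (δ i k * det M))              ≈⟨ sum-cong (λ k → solve 3 (λ c x d → c :* (x :* d) := x :* (c :* d)) refl (c k) (δ i k) (det M)) ⟩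
      sum (λ k → δ i k * (c k * det M))              ≈⟨ sum-δˡ i (λ k → c k * det M) ⟩
      c i * det M                                    ∎

    det-δ+rankOne : ∀ (u v : Vect m) → det (λ i j → δ i j + u i * v j) ≈ 1# + sum (λ i → u i * v i)
    det-δ+rankOne {m} u v = trans (det-rankOne δ u v) (+-cong (det-δ m) (sum-cong (λ i → *-congˡ {u i} (row i))))
      where
      row : ∀ i → det (upd δ i v) ≈ v i
      row i = trans (det-cong (upd-cong δ i (λ j → sym (sum-δʳ j v))))
        (trans (det-upd-combination δ i v) (trans (*-congˡ (det-δ m)) (*-identityʳ _)))

    -- The matrix on the left is M (1 + u vᵀ).
    det-add-column : ∀ (M : Matrix m m) u v →
      det (λ i j → M i j + sum (λ k → M i k * u k) * v j) ≈ det M * (1# + sum (λ i → u i * v i))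
    det-add-column M u v = begin
      det (λ i j → M i j + sum (λ k → M i k * u k) * v j)
        ≈⟨ det-cong (λ i j → sym (trans
             (sum-cong (λ k → solve 4 (λ x d u v → x :* (d :+ u :* v) := x :* d :+ v :* (x :* u)) refl (M i k) (δ k j) (u k) (v j)))
             (trans (sum-lin (v j) (λ k → M i k * δ k j) (λ k → M i k * u k)) (+-cong (sum-δʳ j (M i)) (*-comm _ _))))) ⟩
      det (M ⊠ (λ i j → δ i j + u i * v j))
        ≈⟨ det-⊠ M (λ i j → δ i j + u i * v j) ⟩
      det M * det (λ i j → δ i j + u i * v j)
        ≈⟨ *-congˡ (det-δ+rankOne u v) ⟩
      det M * (1# + sum (λ i → u i * v i)) ∎

    -- A substitute for the adjugate, valid in every commutative ring: M (1 + x e_kᵀ) has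
    -- determinant det M · (1 + x_k), but it equals M because Mx = 0.
    det-kernel : ∀ (M : Matrix m m) x → (∀ i → sum (λ k → M i k * x k) ≈ 0#) → ∀ k → det M * x k ≈ 0#
    det-kernel M x Mx≈0 k = begin
      det M * x k
        ≈⟨ solve 2 (λ d x → d :* x := d :* (:1 :+ x) :- d) refl (det M) (x k) ⟩
      det M * (1# + x k) - det M
        ≈⟨ +-congʳ (*-congˡ (+-congˡ (sym (sum-δʳ k x)))) ⟩
      det M * (1# + sum (λ i → x i * δ i k)) - det M
        ≈⟨ +-congʳ (trans (*-congˡ (+-congˡ (sum-cong (λ i → *-congˡ (reflexive (δ-sym i k)))))) (sym (det-add-column M x (δ k)))) ⟩
      det (λ i j → M i j + sum (λ l → M i l * x l) * δ k j) - det M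
        ≈⟨ +-congʳ (det-cong (λ i j → trans (+-congˡ (trans (*-congʳ (Mx≈0 i)) (zeroˡ _))) (+-identityʳ _))) ⟩
      det M - det M
        ≈⟨ -‿inverseʳ _ ⟩
      0# ∎

open Determinants

-- Ring homomorphisms and formal power series in the basis t^k / k!.

module HurwitzSeriesRings where

  open import Algebra.Structures using (IsCommutativeRing)
  open import Algebra.Morphism.Structures using (module RingMorphisms)
  open import Data.Nat.Properties using (m≤n⇒m≤1+n; ≤-trans)
  import Relation.Binary.PropositionalEquality as ≡

  private variable
    m n : ℕ

  record Hom (R S : CommutativeRing 0ℓ 0ℓ) : Set where
    private
      module R = CommutativeRing R
      module S = CommutativeRing S
    field
      ⟦_⟧    : R.Carrier → S.Carrier
      ⟦⟧-cong : ∀ {x y} → x R.≈ y → ⟦ x ⟧ S.≈ ⟦ y ⟧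
      +-homo : ∀ x y → ⟦ x R.+ y ⟧ S.≈ ⟦ x ⟧ S.+ ⟦ y ⟧
      *-homo : ∀ x y → ⟦ x R.* y ⟧ S.≈ ⟦ x ⟧ S.* ⟦ y ⟧
      1-homo : ⟦ R.1# ⟧ S.≈ S.1#

    0-homo : ⟦ R.0# ⟧ S.≈ S.0#
    0-homo = begin
      ⟦ R.0# ⟧                          ≈⟨ solve 1 (λ x → x := x :+ x :- x) S.refl ⟦ R.0# ⟧ ⟩
      ⟦ R.0# ⟧ S.+ ⟦ R.0# ⟧ S.- ⟦ R.0# ⟧  ≈⟨ S.+-congʳ (S.trans (S.sym (+-homo R.0# R.0#)) (⟦⟧-cong (R.+-identityʳ R.0#))) ⟩
      ⟦ R.0# ⟧ S.- ⟦ R.0# ⟧              ≈⟨ S.-‿inverseʳ _ ⟩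
      S.0#                              ∎
      where
      open import Relation.Binary.Reasoning.Setoid S.setoid
      open RingSolver S

    neg-homo : ∀ x → ⟦ R.- x ⟧ S.≈ S.- ⟦ x ⟧
    neg-homo x = begin
      ⟦ R.- x ⟧                           ≈⟨ solve 2 (λ x y → y := y :+ x :- x) S.refl ⟦ x ⟧ ⟦ R.- x ⟧ ⟩
      ⟦ R.- x ⟧ S.+ ⟦ x ⟧ S.- ⟦ x ⟧        ≈⟨ S.+-congʳ (S.trans (S.sym (+-homo (R.- x) x)) (S.trans (⟦⟧-cong (R.-‿inverseˡ x)) 0-homo)) ⟩
      S.0# S.- ⟦ x ⟧                      ≈⟨ S.+-identityˡ _ ⟩
      S.- ⟦ x ⟧                           ∎
      where
      open import Relation.Binary.Reasoning.Setoid S.setoid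
      open RingSolver S

  module HomProperties {R S : CommutativeRing 0ℓ 0ℓ} (φ : Hom R S) where
    open Hom φ
    private
      module DR = Determinant R
    open CommutativeRing S hiding (zero)
    open Determinant S

    sum-homo : ∀ (f : DR.Vect n) → ⟦ DR.sum f ⟧ ≈ sum (λ i → ⟦ f i ⟧)
    sum-homo {zero}  f = trans (⟦⟧-cong DR.sum-[]) (trans 0-homo (sym sum-[]))
    sum-homo {suc n} f = trans (⟦⟧-cong (DR.sum-∷ f))
      (trans (+-homo _ _) (trans (+-congˡ (sum-homo (f ∘ suc))) (sym (sum-∷ _))))

    δ-homo : ∀ (i j : Fin n) → ⟦ DR.δ i j ⟧ ≈ δ i j
    δ-homo zero    zero    = 1-homo
    δ-homo zero    (suc j) = 0-homo
    δ-homo (suc i) zero    = 0-homo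
    δ-homo (suc i) (suc j) = δ-homo i j

    sgn-homo : ∀ (k : Fin n) → ⟦ DR.sgn k ⟧ ≈ sgn k
    sgn-homo zero    = 1-homo
    sgn-homo (suc k) = trans (neg-homo _) (-‿cong (sgn-homo k))

    ⊠-homo : ∀ {l} (M : DR.Matrix l m) (N : DR.Matrix m n) i j →
      ⟦ (M DR.⊠ N) i j ⟧ ≈ ((λ i j → ⟦ M i j ⟧) ⊠ (λ i j → ⟦ N i j ⟧)) i j
    ⊠-homo M N i j = trans (sum-homo _) (sum-cong (λ k → *-homo _ _))

    det-homo : ∀ (M : DR.Matrix m m) → ⟦ DR.det M ⟧ ≈ det (λ i j → ⟦ M i j ⟧)
    det-homo {zero}  M = trans (⟦⟧-cong (DR.det-zero M)) (trans 1-homo (sym (det-zero _)))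
    det-homo {suc m} M = trans (⟦⟧-cong (DR.det-suc M)) (trans (sum-homo _) (trans
      (sum-cong (λ j → trans (*-homo _ _)
        (*-cong (sgn-homo j) (trans (*-homo _ _) (*-congˡ (det-homo (DR.minor (M ∘ suc) j)))))))
      (sym (det-suc _))))

  module HurwitzProduct (R : CommutativeRing 0ℓ 0ℓ) where
    open CommutativeRing R hiding (zero)
    open RingSolver R

    Series : Set
    Series = ℕ → Carrier

    ∂ : Series → Series
    ∂ f k = f (suc k)

    const : Carrier → Series
    const c zero    = c
    const c (suc _) = 0#

    infixl 6 _⊕_
    infixl 7 _⊛_
    _⊕_ : Series → Series → Series
    (f ⊕ g) k = f k + g k

    ⊝_ : Series → Series
    (⊝ f) k = - f k

    -- The coefficients are those of t^k / k!, so that differentiation is the shift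
    -- and Leibniz' rule defines the product.
    _⊛_ : Series → Series → Series
    (f ⊛ g) zero    = f zero * g zero
    (f ⊛ g) (suc k) = (∂ f ⊛ g) k + (f ⊛ ∂ g) k

    -- A coefficient of a product depends only on coefficients of at most the same index; this is
    -- what makes equality up to a bound compatible with multiplication.
    ⊛-cong-≤ : ∀ {f f' g g'} k → (∀ j → j ≤ k → f j ≈ f' j) → (∀ j → j ≤ k → g j ≈ g' j) → (f ⊛ g) k ≈ (f' ⊛ g') k
    ⊛-cong-≤ zero    p q = *-cong (p zero z≤n) (q zero z≤n)
    ⊛-cong-≤ (suc k) p q = +-cong
      (⊛-cong-≤ k (λ j j≤k → p (suc j) (s≤s j≤k)) (λ j j≤k → q j (m≤n⇒m≤1+n j≤k)))
      (⊛-cong-≤ k (λ j j≤k → p j (m≤n⇒m≤1+n j≤k)) (λ j j≤k → q (suc j) (s≤s j≤k)))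

    ⊛-comm : ∀ f g k → (f ⊛ g) k ≈ (g ⊛ f) k
    ⊛-comm f g zero    = *-comm _ _
    ⊛-comm f g (suc k) = trans (+-cong (⊛-comm (∂ f) g k) (⊛-comm f (∂ g) k)) (+-comm _ _)

    ⊛-distribˡ : ∀ f g h k → (f ⊛ (g ⊕ h)) k ≈ (f ⊛ g ⊕ f ⊛ h) k
    ⊛-distribˡ f g h zero    = distribˡ _ _ _
    ⊛-distribˡ f g h (suc k) = trans (+-cong (⊛-distribˡ (∂ f) g h k) (⊛-distribˡ f (∂ g) (∂ h) k))
      (solve 4 (λ a b c d → a :+ b :+ (c :+ d) := a :+ c :+ (b :+ d)) refl _ _ _ _)

    ⊛-distribʳ : ∀ f g h k → ((g ⊕ h) ⊛ f) k ≈ (g ⊛ f ⊕ h ⊛ f) k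
    ⊛-distribʳ f g h k = trans (⊛-comm (g ⊕ h) f k) (trans (⊛-distribˡ f g h k) (+-cong (⊛-comm f g k) (⊛-comm f h k)))

    0⊛ : ∀ f k → ((λ _ → 0#) ⊛ f) k ≈ 0#
    0⊛ f zero    = zeroˡ _
    0⊛ f (suc k) = trans (+-cong (0⊛ f k) (0⊛ (∂ f) k)) (+-identityʳ _)

    const-⊛ : ∀ c f k → (const c ⊛ f) k ≈ c * f k
    const-⊛ c f zero    = refl
    const-⊛ c f (suc k) = trans (+-cong (0⊛ f k) (const-⊛ c (∂ f) k)) (+-identityˡ _)

    ⊛-assoc : ∀ f g h k → ((f ⊛ g) ⊛ h) k ≈ (f ⊛ (g ⊛ h)) k
    ⊛-assoc f g h zero    = *-assoc _ _ _
    ⊛-assoc f g h (suc k) = trans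
      (+-congʳ (⊛-distribʳ h (∂ f ⊛ g) (f ⊛ ∂ g) k))
      (trans (+-cong (+-cong (⊛-assoc (∂ f) g h k) (⊛-assoc f (∂ g) h k)) (⊛-assoc f g (∂ h) k))
      (trans (+-assoc _ _ _) (+-congˡ (sym (⊛-distribˡ f (∂ g ⊛ h) (g ⊛ ∂ h) k)))))

    -- Equality is only required at the indices in P; taking P bounded gives the truncated series.
    module _ (P : ℕ → Set) (P-down : ∀ {j k} → j ≤ k → P k → P j) where
      _≈ₛ_ : Series → Series → Set
      f ≈ₛ g = ∀ k → P k → f k ≈ g k

      hurwitzIsRing : IsCommutativeRing _≈ₛ_ _⊕_ _⊛_ ⊝_ (λ _ → 0#) (const 1#)
      hurwitzIsRing = record
        { isRing = record
          { +-isAbelianGroup = record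
            { isGroup = record
              { isMonoid = record
                { isSemigroup = record
                  { isMagma = record
                    { isEquivalence = record
                      { refl = λ _ _ → refl ; sym = λ p k Pk → sym (p k Pk) ; trans = λ p q k Pk → trans (p k Pk) (q k Pk) }
                    ; ∙-cong = λ p q k Pk → +-cong (p k Pk) (q k Pk) }
                  ; assoc = λ _ _ _ _ _ → +-assoc _ _ _ }
                ; identity = (λ _ _ _ → +-identityˡ _) , (λ _ _ _ → +-identityʳ _) }
              ; inverse = (λ _ _ _ → -‿inverseˡ _) , (λ _ _ _ → -‿inverseʳ _)
              ; ⁻¹-cong = λ p k Pk → -‿cong (p k Pk) }
            ; comm = λ _ _ _ _ → +-comm _ _ }
          ; *-cong = λ p q k Pk → ⊛-cong-≤ k (λ j j≤k → p j (P-down j≤k Pk)) (λ j j≤k → q j (P-down j≤k Pk))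
          ; *-assoc = λ f g h k _ → ⊛-assoc f g h k
          ; *-identity = (λ f k _ → one f k) , (λ f k _ → trans (⊛-comm f (const 1#) k) (one f k))
          ; distrib = (λ f g h k _ → ⊛-distribˡ f g h k) , (λ f g h k _ → ⊛-distribʳ f g h k) }
        ; *-comm = λ f g k _ → ⊛-comm f g k }
        where
        one : ∀ f k → (const 1# ⊛ f) k ≈ f k
        one f k = trans (const-⊛ 1# f k) (*-identityˡ _)

      hurwitzRing : CommutativeRing 0ℓ 0ℓ
      hurwitzRing = record { isCommutativeRing = hurwitzIsRing }

  hurwitz : CommutativeRing 0ℓ 0ℓ → CommutativeRing 0ℓ 0ℓ
  hurwitz R = HurwitzProduct.hurwitzRing R (λ _ → ⊤) (λ _ _ → tt)

  -- Same carrier and operations as `hurwitz`, with a coarser equality, so the quotient map is the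
  -- identity on elements. Here determinants can be compared when their entries agree only up to
  -- t^N.
  hurwitz≤ : CommutativeRing 0ℓ 0ℓ → ℕ → CommutativeRing 0ℓ 0ℓ
  hurwitz≤ R N = HurwitzProduct.hurwitzRing R (_≤ N) ≤-trans

  truncHom : ∀ R N → Hom (hurwitz R) (hurwitz≤ R N)
  truncHom R N = record
    { ⟦_⟧ = λ f → f ; ⟦⟧-cong = λ p k _ → p k tt
    ; +-homo = λ _ _ _ _ → refl ; *-homo = λ _ _ _ _ → refl ; 1-homo = λ _ _ → refl }
    where open CommutativeRing R

  constHom : ∀ R → Hom R (hurwitz R)
  constHom R = record
    { ⟦_⟧ = const
    ; ⟦⟧-cong = λ { p zero _ → p ; p (suc k) _ → refl }
    ; +-homo = λ { x y zero _ → refl ; x y (suc k) _ → sym (+-identityʳ _) }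
    ; *-homo = λ { x y zero _ → refl ; x y (suc k) _ → sym (trans (const-⊛ x (const y) (suc k)) (zeroʳ x)) }
    ; 1-homo = λ _ _ → refl }
    where
    open CommutativeRing R hiding (zero)
    open HurwitzProduct R

  module HurwitzSeries (R : CommutativeRing 0ℓ 0ℓ) where
    open HurwitzProduct R using (Series; ∂; const; const-⊛; 0⊛) public
    private
      module R = CommutativeRing R
      module DR = Determinant R
    open CommutativeRing (hurwitz R) hiding (zero)
    open Determinant (hurwitz R)
    open import Relation.Binary.Reasoning.Setoid setoid

    t : Carrier
    t zero    = R.0#
    t (suc k) = const R.1# k

    sum-coeff : ∀ (f : Vect n) k → sum f k R.≈ DR.sum (λ i → f i k)
    sum-coeff {zero}  f k = R.trans (sum-[] k tt) (R.sym DR.sum-[])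
    sum-coeff {suc n} f k = R.trans (sum-∷ f k tt) (R.trans (R.+-congˡ (sum-coeff (f ∘ suc) k)) (R.sym (DR.sum-∷ _)))

    ∂-cong : ∀ {f g} → f ≈ g → ∂ f ≈ ∂ g
    ∂-cong p k _ = p (suc k) tt

    ∂-sum : ∀ (f : Vect n) → ∂ (sum f) ≈ sum (λ i → ∂ (f i))
    ∂-sum f k _ = R.trans (sum-coeff f (suc k)) (R.sym (sum-coeff (λ i → ∂ (f i)) k))

    ∂-sgn : ∀ (j : Fin n) → ∂ (sgn j) ≈ 0#
    ∂-sgn zero    k _ = R.refl
    ∂-sgn (suc j) k _ = R.trans (R.-‿cong (∂-sgn j k tt)) -0#≈0#
      where open import Algebra.Properties.Ring R.ring

    ∂-δ : ∀ (i j : Fin n) → ∂ (δ i j) ≈ 0#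
    ∂-δ zero    zero    k _ = R.refl
    ∂-δ zero    (suc j) k _ = R.refl
    ∂-δ (suc i) zero    k _ = R.refl
    ∂-δ (suc i) (suc j) = ∂-δ i j

    ∂-⊠ : ∀ {l} (M : Matrix l m) (N : Matrix m n) i j →
      ∂ ((M ⊠ N) i j) ≈ ((λ i j → ∂ (M i j)) ⊠ N) i j + (M ⊠ (λ i j → ∂ (N i j))) i j
    ∂-⊠ M N i j = trans (∂-sum (λ k → M i k * N k j)) (∑-distrib-+ (λ k → ∂ (M i k) * N k j) (λ k → M i k * ∂ (N k j)))

    -- Differentiating the first-row expansion hits either the first row or a minor; by induction
    -- the minors account for the remaining rows. The signs are constants.
    ∂-det : ∀ (M : Matrix m m) → ∂ (det M) ≈ sum (λ i → det (upd M i (λ j → ∂ (M i j))))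
    ∂-det {zero}  M = trans (∂-cong (det-zero M)) (sym sum-[])
    ∂-det {suc m} M = begin
      ∂ (det M)
        ≈⟨ trans (∂-cong (det-suc M)) (∂-sum (λ j → sgn j * (M zero j * D j))) ⟩
      sum (λ j → ∂ (sgn j) * (M zero j * D j) + sgn j * (∂ (M zero j) * D j + M zero j * ∂ (D j)))
        ≈⟨ sum-cong (λ j → trans (+-congʳ (trans (*-congʳ (∂-sgn j)) (zeroˡ (M zero j * D j)))) (trans (+-identityˡ _) (trans (distribˡ (sgn j) _ _)
             (+-congˡ (*-congˡ {sgn j} (*-congˡ {M zero j} (∂-det (minor (M ∘ suc) j)))))))) ⟩
      sum (λ j → sgn j * (∂ (M zero j) * D j) + sgn j * (M zero j * sum (λ i → D' i j)))
        ≈⟨ ∑-distrib-+ (λ j → sgn j * (∂ (M zero j) * D j)) (λ j → sgn j * (M zero j * sum (λ i → D' i j))) ⟩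
      sum (λ j → sgn j * (∂ (M zero j) * D j)) + sum (λ j → sgn j * (M zero j * sum (λ i → D' i j)))
        ≈⟨ +-congˡ (sum-cong (λ j → trans (*-congˡ {sgn j} (*-distribˡ-sum (M zero j) (λ i → D' i j))) (*-distribˡ-sum (sgn j) (λ i → M zero j * D' i j)))) ⟩
      sum (λ j → sgn j * (∂ (M zero j) * D j)) + sum (λ j → sum (λ i → sgn j * (M zero j * D' i j)))
        ≈⟨ +-congˡ (∑-comm (λ j i → sgn j * (M zero j * D' i j))) ⟩
      sum (λ j → sgn j * (∂ (M zero j) * D j)) + sum (λ i → sum (λ j → sgn j * (M zero j * D' i j)))
        ≈⟨ +-cong (sym (det-suc (upd M zero (λ j → ∂ (M zero j))))) (sum-cong (λ i → trans
             (sum-cong (λ j → *-congˡ {sgn j} (*-congˡ {M zero j} (det-cong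
               (≡⇒≋ (λ a → ≡.sym (upd-map (λ x → x ∘ punchIn j) (M ∘ suc) i (λ b → ∂ (M (suc i) b)) a)))))))
             (sym (det-suc (upd M (suc i) (λ j → ∂ (M (suc i) j))))))) ⟩
      det (upd M zero (λ j → ∂ (M zero j))) + sum (λ i → det (upd M (suc i) (λ j → ∂ (M (suc i) j))))
        ≈⟨ sym (sum-∷ (λ i → det (upd M i (λ j → ∂ (M i j))))) ⟩
      sum (λ i → det (upd M i (λ j → ∂ (M i j)))) ∎
      where
      D : Vect (suc m)
      D j = det (minor (M ∘ suc) j)
      D' : Fin m → Vect (suc m)
      D' i j = det (upd (minor (M ∘ suc) j) i (λ b → ∂ (minor (M ∘ suc) j i b)))

open HurwitzSeriesRings

-- Cofactors, matrix exponentials and the generating function of transposition walks.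

module MatrixExponentials where

  open import Data.Vec.Functional using (_∷_)

  private variable
    m n : ℕ

  module ReducedDeterminant (R : CommutativeRing 0ℓ 0ℓ) where
    open CommutativeRing R hiding (zero)
    open Determinant R
    open RingSolver R
    open import Relation.Binary.Reasoning.Setoid setoid

    -- The first principal cofactor, written without shrinking the matrix.
    det′ : Matrix (suc m) (suc m) → Carrier
    det′ X = det (δ zero ∷ X ∘ suc)

    det′-cong : {X Y : Matrix (suc m) (suc m)} → X ≋ Y → det′ X ≈ det′ Y
    det′-cong p = det-cong (∷-cong (λ _ → refl) (λ i j → p (suc i) j))

    -- Replacing the row e₀ of the first factor by the row e₀ψ changes it by a row
    -- with sum zero, and all other rows of Xψ have sum zero as well.
    det′-⊠ : ∀ (X ψ : Matrix (suc m) (suc m)) → (∀ i → sum (X i) ≈ 0#) → (∀ i → sum (ψ i) ≈ 1#) →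
      det′ X * det ψ ≈ det′ (X ⊠ ψ)
    det′-⊠ {m} X ψ X1≈0 ψ1≈1 = begin
      det′ X * det ψ
        ≈⟨ sym (det-⊠ (δ zero ∷ X ∘ suc) ψ) ⟩
      det ((δ zero ∷ X ∘ suc) ⊠ ψ)
        ≈⟨ det-cong (λ { zero j → trans (sum-δˡ zero (λ k → ψ k j)) (solve 2 (λ x y → x := y :+ :1 :* (x :- y)) refl (ψ zero j) (δ zero j))
                       ; (suc i) j → refl }) ⟩
      det ((λ j → δ zero j + 1# * z j) ∷ Y)
        ≈⟨ lin₀ (detForm (suc m)) 1# (δ zero) z Y ⟩
      det′ (X ⊠ ψ) + 1# * det (z ∷ Y)
        ≈⟨ trans (+-congˡ (trans (*-congˡ (trans (sym (*-identityʳ _)) (det-kernel (z ∷ Y) (λ _ → 1#) kernel zero))) (zeroʳ _))) (+-identityʳ _) ⟩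
      det′ (X ⊠ ψ) ∎
      where
      z = λ j → ψ zero j - δ zero j
      Y = (X ⊠ ψ) ∘ suc
      kernel : ∀ i → sum (λ k → (z ∷ Y) i k * 1#) ≈ 0#
      kernel zero = begin
        sum (λ k → z k * 1#)
          ≈⟨ sum-cong (λ k → solve 2 (λ x y → (x :- y) :* :1 := x :+ :- :1 :* (y :* :1)) refl (ψ zero k) (δ zero k)) ⟩
        sum (λ k → ψ zero k + - 1# * (δ zero k * 1#))
          ≈⟨ sum-lin (- 1#) (ψ zero) (λ k → δ zero k * 1#) ⟩
        sum (ψ zero) + - 1# * sum (λ k → δ zero k * 1#)
          ≈⟨ +-cong (ψ1≈1 zero) (*-congˡ (sum-δˡ zero (λ _ → 1#))) ⟩
        1# + - 1# * 1#
          ≈⟨ solve 0 (:1 :+ :- :1 :* :1 := :0) refl ⟩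
        0# ∎
      kernel (suc i) = begin
        sum (λ k → sum (λ l → X (suc i) l * ψ l k) * 1#)
          ≈⟨ sum-cong (λ k → *-identityʳ _) ⟩
        sum (λ k → sum (λ l → X (suc i) l * ψ l k))
          ≈⟨ ∑-comm (λ k l → X (suc i) l * ψ l k) ⟩
        sum (λ l → sum (λ k → X (suc i) l * ψ l k))
          ≈⟨ sum-cong (λ l → trans (sym (*-distribˡ-sum (X (suc i) l) (ψ l))) (trans (*-congˡ (ψ1≈1 l)) (*-identityʳ _))) ⟩
        sum (X (suc i))
          ≈⟨ X1≈0 (suc i) ⟩
        0# ∎

    infixr 8 _↑_
    _↑_ : Carrier → ℕ → Carrier
    c ↑ zero  = 1#
    c ↑ suc k = c * c ↑ k

    scaleRows : ∀ (G : AltForm m n) c M → AltForm.fun G (λ i j → c * M i j) ≈ c ↑ m * AltForm.fun G M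
    scaleRows {zero}  G c M = trans (AltForm.cong G (λ ())) (sym (*-identityˡ _))
    scaleRows {suc m} G c M = begin
      fun (λ i j → c * M i j)
        -- The law `lin₀` only handles rows of the shape x + c y, so the row c y is written as 0 y +
        -- c y.
        ≈⟨ AltForm.cong G (λ { zero j → sym (trans (+-congʳ (zeroˡ (M zero j))) (+-identityˡ _)) ; (suc i) j → refl }) ⟩
      fun ((λ j → 0# * M zero j + c * M zero j) ∷ rest)
        ≈⟨ lin₀ G c (λ j → 0# * M zero j) (M zero) rest ⟩
      fun ((λ j → 0# * M zero j) ∷ rest) + c * fun (M zero ∷ rest)
        ≈⟨ +-cong (trans (AltForm.cong G (λ i j → sym (upd-zero≋ (M zero ∷ rest) (λ j → 0# * M zero j) i j)))
                         (lin-zero G (M zero ∷ rest) zero (λ j → zeroˡ _)))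
                  (*-congˡ (scaleRows (consForm G (M zero)) c (M ∘ suc))) ⟩
      0# + c * (c ↑ m * fun (M zero ∷ M ∘ suc))
        ≈⟨ trans (+-identityˡ _) (trans (sym (*-assoc _ _ _)) (*-congˡ (AltForm.cong G (η∷ M)))) ⟩
      c * c ↑ m * fun M ∎
      where
      fun = AltForm.fun G
      rest = λ i j → c * M (suc i) j

    -- The exponent is m and not m + 1, as the unit row is not scaled. This is the origin of
    -- t^(n-1).
    det′-scale : ∀ c (X : Matrix (suc m) (suc m)) → det′ (λ i j → c * X i j) ≈ c ↑ m * det′ X
    det′-scale {m} c X = scaleRows (consForm (detForm (suc m)) (δ zero)) c (X ∘ suc)

  module MatrixExponential (R : CommutativeRing 0ℓ 0ℓ) where
    private
      module R = CommutativeRing R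
      module DR = Determinant R
    open HurwitzSeries R
    open CommutativeRing (hurwitz R) hiding (zero)
    open Determinant (hurwitz R)
    open import Relation.Binary.Reasoning.Setoid setoid

    module cH = Hom (constHom R)
    module cHP = HomProperties (constHom R)

    constM : DR.Matrix m n → Matrix m n
    constM M i j = const (M i j)

    constM-⊠ : ∀ {l} (M : DR.Matrix l m) (N : DR.Matrix m n) → constM (M DR.⊠ N) ≋ constM M ⊠ constM N
    constM-⊠ = cHP.⊠-homo

    constM-cong : {M N : DR.Matrix m n} → M DR.≋ N → constM M ≋ constM N
    constM-cong p i j = cH.⟦⟧-cong (p i j)

    pow : DR.Matrix n n → ℕ → DR.Matrix n n
    pow M zero    = DR.δ
    pow M (suc k) = M DR.⊠ pow M k

    -- This is e^(tM): relative to t^k / k! its coefficients are the plain powers of M.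
    exp : DR.Matrix n n → Matrix n n
    exp M i j k = pow M k i j

    ev₀ : Hom (hurwitz R) R
    ev₀ = record { ⟦_⟧ = λ f → f zero ; ⟦⟧-cong = λ p → p zero tt
      ; +-homo = λ _ _ → R.refl ; *-homo = λ _ _ → R.refl ; 1-homo = R.refl }

    constM⊠-coeff : ∀ {l} (M : DR.Matrix l m) (X : Matrix m n) i j k →
      (constM M ⊠ X) i j k R.≈ (M DR.⊠ (λ i j → X i j k)) i j
    constM⊠-coeff M X i j k = R.trans (sum-coeff (λ l → const (M i l) * X l j) k) (DR.sum-cong (λ l → const-⊛ (M i l) (X l j) k))

    ⊠constM-coeff : ∀ {l} (X : Matrix l m) (M : DR.Matrix m n) i j k →
      (X ⊠ constM M) i j k R.≈ ((λ i j → X i j k) DR.⊠ M) i j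
    ⊠constM-coeff X M i j k = R.trans (sum-coeff (λ l → X i l * const (M l j)) k)
      (DR.sum-cong (λ l → R.trans (*-comm (X i l) (const (M l j)) k tt) (R.trans (const-⊛ (M l j) (X i l) k) (R.*-comm _ _))))

    ∂-exp : ∀ (M : DR.Matrix n n) i j → ∂ (exp M i j) ≈ (constM M ⊠ exp M) i j
    ∂-exp M i j k _ = R.sym (constM⊠-coeff M (exp M) i j k)

    -- The equation X′ = MX determines each coefficient from the preceding one.
    exp-unique : ∀ (M : DR.Matrix n n) (X : Matrix n n) → (∀ i j → X i j zero R.≈ DR.δ i j) →
      (∀ i j → ∂ (X i j) ≈ (constM M ⊠ X) i j) → X ≋ exp M
    exp-unique M X X₀ X′ i j zero    _ = X₀ i j
    exp-unique M X X₀ X′ i j (suc k) _ = R.trans (X′ i j k tt) (R.trans (constM⊠-coeff M X i j k)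
      (DR.⊠-cong {M = M} (λ _ _ → R.refl) (λ i j → exp-unique M X X₀ X′ i j k tt) i j))

    pow-commute : ∀ (N M : DR.Matrix n n) → N DR.⊠ M DR.≋ M DR.⊠ N → ∀ k → N DR.⊠ pow M k DR.≋ pow M k DR.⊠ N
    pow-commute N M c zero    i j = R.trans (DR.⊠-identityʳ N i j) (R.sym (DR.⊠-identityˡ N i j))
    pow-commute N M c (suc k) i j =
      R.trans (R.sym (DR.⊠-assoc N M (pow M k) i j))
      (R.trans (DR.⊠-cong {N = pow M k} c (λ _ _ → R.refl) i j)
      (R.trans (DR.⊠-assoc M N (pow M k) i j)
      (R.trans (DR.⊠-cong {M = M} (λ _ _ → R.refl) (pow-commute N M c k) i j)
               (R.sym (DR.⊠-assoc M (pow M k) N i j)))))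

    exp-commute : ∀ (N M : DR.Matrix n n) → N DR.⊠ M DR.≋ M DR.⊠ N → constM N ⊠ exp M ≋ exp M ⊠ constM N
    exp-commute N M c i j k _ = R.trans (constM⊠-coeff N (exp M) i j k)
      (R.trans (pow-commute N M c k i j) (R.sym (⊠constM-coeff (exp M) N i j k)))

    exp-sum : ∀ (M : DR.Matrix n n) → (∀ i → DR.sum (M i) R.≈ R.0#) → ∀ i → sum (exp M i) ≈ 1#
    exp-sum M M1≈0 i k _ = R.trans (sum-coeff (exp M i) k) (rows k i)
      where
      rows : ∀ k i → DR.sum (pow M k i) R.≈ const R.1# k
      rows zero    i = R.trans (DR.sum-cong (λ j → R.sym (R.*-identityʳ _))) (DR.sum-δˡ i (λ _ → R.1#))
      rows (suc k) i = R.trans (DR.∑-comm (λ j l → M i l R.* pow M k l j))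
        (R.trans (DR.sum-cong (λ l → R.trans (R.sym (DR.*-distribˡ-sum (M i l) (pow M k l))) (R.*-congˡ (rows k l)))) (vanish k))
        where
        vanish : ∀ k → DR.sum (λ l → M i l R.* const R.1# k) R.≈ R.0#
        vanish zero    = R.trans (DR.sum-cong (λ l → R.*-identityʳ _)) (M1≈0 i)
        vanish (suc k) = DR.sum-zero (λ l → R.zeroʳ _)

    -- Liouville's formula: the derivative of row i is a combination of all rows, and only its own
    -- coefficient M_ii contributes.
    ∂-det-exp : ∀ (M : DR.Matrix n n) → ∂ (det (exp M)) ≈ const (DR.sum (λ i → M i i)) * det (exp M)
    ∂-det-exp M = begin
      ∂ (det (exp M))
        ≈⟨ ∂-det (exp M) ⟩
      sum (λ i → det (upd (exp M) i (λ j → ∂ (exp M i j))))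
        ≈⟨ sum-cong (λ i → trans (det-cong (upd-cong (exp M) i (∂-exp M i))) (det-upd-combination (exp M) i (constM M i))) ⟩
      sum (λ i → const (M i i) * det (exp M))
        ≈⟨ sym (*-distribʳ-sum (det (exp M)) (λ i → const (M i i))) ⟩
      sum (λ i → const (M i i)) * det (exp M)
        ≈⟨ *-congʳ (sym (cHP.sum-homo (λ i → M i i))) ⟩
      const (DR.sum (λ i → M i i)) * det (exp M) ∎

  module TranspositionWalk (R : CommutativeRing 0ℓ 0ℓ) {l n : ℕ}
    (w : Fin l → CommutativeRing.Carrier R) (u : Fin l → Fin n → CommutativeRing.Carrier R) where
    private
      module R = CommutativeRing R
      module DR = Determinant R
      module RS = RingSolver R

    laplacian : DR.Matrix n n
    laplacian i j = DR.sum (λ τ → w τ R.* (u τ i R.* u τ j))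

    reflection : Fin l → DR.Matrix n n
    reflection τ i j = DR.δ i j R.- u τ i R.* u τ j

    walk : ℕ → DR.Matrix n n → R.Carrier
    walk zero    M = DR.det (λ i j → DR.δ i j R.- M i j)
    walk (suc N) M = DR.sum (λ τ → w τ R.* walk N (M DR.⊠ reflection τ))

    module Generating (H : DR.Matrix n n) (2H≋A : ∀ i j → H i j R.+ H i j R.≈ laplacian i j)
      (trH≈w : DR.sum (λ i → H i i) R.≈ DR.sum w) where

      open HurwitzSeries R
      open MatrixExponential R
      open CommutativeRing (hurwitz R) hiding (zero)
      open Determinant (hurwitz R)
      open RingSolver (hurwitz R)
      open import Relation.Binary.Reasoning.Setoid setoid

      2H -2H : DR.Matrix n n
      2H i j = H i j R.+ H i j
      -2H i j = R.- 2H i j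

      Q : Matrix n n
      Q = exp -2H

      B : DR.Matrix n n → Matrix n n
      B M i j = δ i j - (constM M ⊠ Q) i j

      -- Since `Q` is e^(-tA) and `B M` is 1 - M e^(-tA), this is the series F_M.
      generating : DR.Matrix n n → Carrier
      generating M = det (exp H) * det (B M)

      -- The factorisation A = V u, with the roots as rows of u, displays A as a sum of rank-one
      -- matrices, one for each τ.
      V : DR.Matrix n l
      V k τ = u τ k R.* w τ

      uQ : Matrix l n
      uQ = constM u ⊠ Q

      Mu : DR.Matrix n n → DR.Matrix n l
      Mu M i τ = DR.sum (λ k → M i k R.* u τ k)

      M2H : ∀ (M : DR.Matrix n n) → M DR.⊠ 2H DR.≋ (M DR.⊠ V) DR.⊠ u
      M2H M i j = R.trans (DR.⊠-cong {M = M} (λ _ _ → R.refl) (λ k j → R.trans (2H≋A k j) (DR.sum-cong (λ τ →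
          RS.solve 3 (λ w x y → w RS.:* (x RS.:* y) RS.:= x RS.:* w RS.:* y) R.refl (w τ) (u τ k) (u τ j)))) i j)
        (R.sym (DR.⊠-assoc M V u i j))

      MV : ∀ M i τ → (M DR.⊠ V) i τ R.≈ w τ R.* Mu M i τ
      MV M i τ = R.trans (DR.sum-cong (λ k → RS.solve 3 (λ m x w → m RS.:* (x RS.:* w) RS.:= w RS.:* (m RS.:* x)) R.refl (M i k) (u τ k) (w τ)))
        (R.sym (DR.*-distribˡ-sum (w τ) (λ k → M i k R.* u τ k)))

      -- The derivative of 1 - M e^(-tA) is M A e^(-tA), and A = V u writes it as the sum over τ of
      -- the rank-one matrices with column (MV)_τ and row u_τ e^(-tA).
      ∂B : ∀ M i j → ∂ (B M i j) ≈ (constM (M DR.⊠ V) ⊠ uQ) i j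
      ∂B M i j = begin
        ∂ (δ i j) - ∂ ((constM M ⊠ Q) i j)
          ≈⟨ trans (+-congʳ (∂-δ i j)) (+-identityˡ _) ⟩
        - ∂ ((constM M ⊠ Q) i j)
          ≈⟨ -‿cong (λ k _ → R.trans (constM⊠-coeff M Q i j (suc k)) (neg-out k)) ⟩
        - (- (constM M ⊠ (constM 2H ⊠ Q)) i j)
          ≈⟨ solve 1 (λ x → :- (:- x) := x) refl _ ⟩
        (constM M ⊠ (constM 2H ⊠ Q)) i j
          ≈⟨ sym (⊠-assoc (constM M) (constM 2H) Q i j) ⟩
        ((constM M ⊠ constM 2H) ⊠ Q) i j
          ≈⟨ ⊠-cong {N = Q} (λ i j → trans (sym (constM-⊠ M 2H i j)) (trans (constM-cong {M = M DR.⊠ 2H} {N = (M DR.⊠ V) DR.⊠ u} (M2H M) i j) (constM-⊠ (M DR.⊠ V) u i j))) (λ _ _ → refl) i j ⟩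
        ((constM (M DR.⊠ V) ⊠ constM u) ⊠ Q) i j
          ≈⟨ ⊠-assoc (constM (M DR.⊠ V)) (constM u) Q i j ⟩
        (constM (M DR.⊠ V) ⊠ uQ) i j ∎
        where
        neg-out : ∀ k → (M DR.⊠ pow -2H (suc k)) i j R.≈ R.- ((constM M ⊠ (constM 2H ⊠ Q)) i j k)
        neg-out k = R.trans (DR.sum-cong (λ a → R.trans (R.*-congˡ (neg-sum a)) (R.sym (-‿distribʳ-* _ _))))
          (R.trans (sum-neg _) (R.-‿cong (R.sym (R.trans (constM⊠-coeff M (constM 2H ⊠ Q) i j k)
            (DR.⊠-cong {M = M} (λ _ _ → R.refl) (λ a b → constM⊠-coeff 2H Q a b k) i j)))))
          where
          open import Algebra.Properties.Ring R.ring using (-‿distribʳ-*; -‿distribˡ-*; -1*x≈-x)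
          sum-neg : ∀ {m} (f : DR.Vect m) → DR.sum (λ i → R.- f i) R.≈ R.- DR.sum f
          sum-neg f = R.trans (DR.sum-cong (λ i → R.sym (-1*x≈-x _))) (R.trans (R.sym (DR.*-distribˡ-sum _ f)) (-1*x≈-x _))
          neg-sum : ∀ a → pow -2H (suc k) a j R.≈ R.- (2H DR.⊠ pow -2H k) a j
          neg-sum a = R.trans (DR.sum-cong (λ b → R.sym (-‿distribˡ-* _ _))) (sum-neg _)

      -- A rank-one change of the matrix along this direction is the same as multiplying M by the
      -- reflection: 1 - MQ + M u uᵀ Q = 1 - M (1 - u uᵀ) Q.
      B-step : ∀ M τ i j → B M i j + const (Mu M i τ) * uQ τ j ≈ B (M DR.⊠ reflection τ) i j
      B-step M τ i j = begin
        δ i j - (constM M ⊠ Q) i j + c * uQ τ j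
          ≈⟨ solve 4 (λ d x c y → d :- x :+ c :* y := d :- (x :+ :- c :* y)) refl (δ i j) ((constM M ⊠ Q) i j) c (uQ τ j) ⟩
        δ i j - ((constM M ⊠ Q) i j + - c * uQ τ j)
          ≈⟨ +-congˡ (-‿cong (sym (sum-lin (- c) (λ k → const (M i k) * Q k j) (λ k → const (u τ k) * Q k j)))) ⟩
        δ i j - sum (λ k → const (M i k) * Q k j + - c * (const (u τ k) * Q k j))
          ≈⟨ +-congˡ (-‿cong (sum-cong (λ k → trans
               (solve 4 (λ m q c u → m :* q :+ :- c :* (u :* q) := (m :- c :* u) :* q) refl (const (M i k)) (Q k j) c (const (u τ k)))
               (*-congʳ (sym (entry k)))))) ⟩
        δ i j - sum (λ k → const ((M DR.⊠ reflection τ) i k) * Q k j) ∎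
        where
        c = const (Mu M i τ)
        entryR : ∀ k → (M DR.⊠ reflection τ) i k R.≈ M i k R.- Mu M i τ R.* u τ k
        entryR k = R.trans (DR.sum-cong (λ a → RS.solve 4 (λ m d x y → m RS.:* (d RS.:- x RS.:* y) RS.:= m RS.:* d RS.:+ RS.:- y RS.:* (m RS.:* x))
            R.refl (M i a) (DR.δ a k) (u τ a) (u τ k)))
          (R.trans (DR.sum-lin (R.- u τ k) (λ a → M i a R.* DR.δ a k) (λ a → M i a R.* u τ a))
          (R.trans (R.+-congʳ (DR.sum-δʳ k (M i)))
            (RS.solve 3 (λ m u s → m RS.:+ RS.:- u RS.:* s RS.:= m RS.:- s RS.:* u) R.refl (M i k) (u τ k) (Mu M i τ))))
        entry : ∀ k → const ((M DR.⊠ reflection τ) i k) ≈ const (M i k) - c * const (u τ k)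
        entry k = trans (cH.⟦⟧-cong (entryR k)) (trans (cH.+-homo _ _) (+-congˡ (trans (cH.neg-homo _) (-‿cong (cH.*-homo _ _)))))

      -- Along a rank-one direction the determinant is affine, so its derivative is a difference of
      -- two values, and by `B-step` the second value is again of the form det (B M′).
      ∂-det-B : ∀ M → ∂ (det (B M)) ≈ sum (λ τ → const (w τ) * (det (B (M DR.⊠ reflection τ)) - det (B M)))
      ∂-det-B M = begin
        ∂ (det (B M))
          ≈⟨ ∂-det (B M) ⟩
        sum (λ i → det (upd (B M) i (λ j → ∂ (B M i j))))
          ≈⟨ sum-cong (λ i → trans (det-cong (upd-cong (B M) i (∂B M i))) (lin-sum (detForm n) (B M) i (constM (M DR.⊠ V) i) uQ)) ⟩
        sum (λ i → sum (λ τ → const ((M DR.⊠ V) i τ) * det (upd (B M) i (uQ τ))))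
          ≈⟨ ∑-comm (λ i τ → const ((M DR.⊠ V) i τ) * det (upd (B M) i (uQ τ))) ⟩
        sum (λ τ → sum (λ i → const ((M DR.⊠ V) i τ) * det (upd (B M) i (uQ τ))))
          ≈⟨ sum-cong (λ τ → term τ) ⟩
        sum (λ τ → const (w τ) * (det (B (M DR.⊠ reflection τ)) - det (B M))) ∎
        where
        term : ∀ τ → sum (λ i → const ((M DR.⊠ V) i τ) * det (upd (B M) i (uQ τ))) ≈ const (w τ) * (det (B (M DR.⊠ reflection τ)) - det (B M))
        term τ = begin
          sum (λ i → const ((M DR.⊠ V) i τ) * det (upd (B M) i (uQ τ)))
            ≈⟨ sum-cong (λ i → trans (*-congʳ (trans (cH.⟦⟧-cong (MV M i τ)) (cH.*-homo _ _))) (*-assoc (const (w τ)) (const (Mu M i τ)) _)) ⟩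
          sum (λ i → const (w τ) * (const (Mu M i τ) * det (upd (B M) i (uQ τ))))
            ≈⟨ sym (*-distribˡ-sum (const (w τ)) (λ i → const (Mu M i τ) * det (upd (B M) i (uQ τ)))) ⟩
          const (w τ) * S
            ≈⟨ *-congˡ (solve 2 (λ s d → s := d :+ s :- d) refl S (det (B M))) ⟩
          const (w τ) * (det (B M) + S - det (B M))
            ≈⟨ *-congˡ (+-congʳ (trans (sym (det-rankOne (B M) (λ i → const (Mu M i τ)) (uQ τ))) (det-cong (B-step M τ)))) ⟩
          const (w τ) * (det (B (M DR.⊠ reflection τ)) - det (B M)) ∎
          where S = sum (λ i → const (Mu M i τ) * det (upd (B M) i (uQ τ)))

      -- The trace of H contributes Σ w(τ) times `generating M`, which cancels the subtracted
      -- determinant in every difference of `∂-det-B`.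
      ∂-generating : ∀ M → ∂ (generating M) ≈ sum (λ τ → const (w τ) * generating (M DR.⊠ reflection τ))
      ∂-generating M = begin
        ∂ y * z + y * ∂ z
          ≈⟨ +-cong (*-congʳ (trans (∂-det-exp H) (*-congʳ (trans (cH.⟦⟧-cong trH≈w) (cHP.sum-homo w))))) (*-congˡ (∂-det-B M)) ⟩
        sum (λ τ → const (w τ)) * y * z + y * sum (λ τ → const (w τ) * (z' τ - z))
          ≈⟨ +-cong (trans (*-assoc _ _ _) (*-distribʳ-sum (y * z) (λ τ → const (w τ)))) (*-distribˡ-sum y (λ τ → const (w τ) * (z' τ - z))) ⟩
        sum (λ τ → const (w τ) * (y * z)) + sum (λ τ → y * (const (w τ) * (z' τ - z)))
          ≈⟨ sym (∑-distrib-+ (λ τ → const (w τ) * (y * z)) (λ τ → y * (const (w τ) * (z' τ - z)))) ⟩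
        sum (λ τ → const (w τ) * (y * z) + y * (const (w τ) * (z' τ - z)))
          ≈⟨ sum-cong (λ τ → solve 4 (λ w y z z' → w :* (y :* z) :+ y :* (w :* (z' :- z)) := w :* (y :* z')) refl (const (w τ)) y z (z' τ)) ⟩
        sum (λ τ → const (w τ) * (y * z' τ)) ∎
        where
        y = det (exp H)
        z = det (B M)
        z' = λ τ → det (B (M DR.⊠ reflection τ))

      walk-generating : ∀ N M → walk N M R.≈ generating M N
      walk-generating zero M = R.sym (R.trans (R.*-cong
          (R.trans (E.det-homo (exp H)) (DR.det-δ n))
          (R.trans (E.det-homo (B M)) (DR.det-cong (λ i j → R.+-cong (E.δ-homo i j)
            (R.-‿cong (R.trans (constM⊠-coeff M Q i j zero) (DR.⊠-identityʳ M i j)))))))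
        (R.*-identityˡ _))
        where module E = HomProperties ev₀
      walk-generating (suc N) M = R.trans (DR.sum-cong (λ τ → R.*-congˡ (walk-generating N (M DR.⊠ reflection τ))))
        (R.sym (R.trans (∂-generating M N tt) (R.trans (sum-coeff (λ τ → const (w τ) * generating (M DR.⊠ reflection τ)) N)
          (DR.sum-cong (λ τ → const-⊛ (w τ) (generating (M DR.⊠ reflection τ)) N)))))

open MatrixExponentials

-- The walk series as a power of t, a Laplacian cofactor and det φ(tA).

module WalkFormulas where

  open import Data.Vec.Functional using (_∷_)

  private variable
    n : ℕ

  module SinhFactorization (R : CommutativeRing 0ℓ 0ℓ) {m : ℕ}
    (H : Determinant.Matrix R (suc m) (suc m))
    (H1≈0 : ∀ i → CommutativeRing._≈_ R (Determinant.sum R (H i)) (CommutativeRing.0# R)) where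
    private
      module R = CommutativeRing R
      module DR = Determinant R
      module RS = RingSolver R
      module RR = ReducedDeterminant R
    open HurwitzSeries R
    open MatrixExponential R
    open CommutativeRing (hurwitz R) hiding (zero)
    open Determinant (hurwitz R)
    open ReducedDeterminant (hurwitz R)
    open RingSolver (hurwitz R)
    open import Relation.Binary.Reasoning.Setoid setoid

    2H -2H -H : DR.Matrix (suc m) (suc m)
    2H i j = H i j R.+ H i j
    -2H i j = R.- 2H i j
    -H i j = R.- H i j

    2H1≈0 : ∀ i → DR.sum (2H i) R.≈ R.0#
    2H1≈0 i = R.trans (DR.∑-distrib-+ (H i) (H i)) (R.trans (R.+-cong (H1≈0 i) (H1≈0 i)) (R.+-identityˡ _))

    -2H1≈0 : ∀ i → DR.sum (-2H i) R.≈ R.0#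
    -2H1≈0 i = R.trans (DR.sum-cong (λ j → R.sym (-1*x≈-x _))) (R.trans (R.sym (DR.*-distribˡ-sum _ (2H i)))
      (R.trans (R.*-congˡ (2H1≈0 i)) (R.zeroʳ _)))
      where open import Algebra.Properties.Ring R.ring using (-1*x≈-x)

    H-commutes : H DR.⊠ -2H DR.≋ -2H DR.⊠ H
    H-commutes i j = R.trans
      (DR.sum-cong (λ k → RS.solve 2 (λ x y → x RS.:* RS.:- (y RS.:+ y) RS.:= RS.:- RS.:1 RS.:* (RS.:1 RS.:+ RS.:1) RS.:* (x RS.:* y)) R.refl (H i k) (H k j)))
      (R.sym (DR.sum-cong (λ k → RS.solve 2 (λ x y → RS.:- (x RS.:+ x) RS.:* y RS.:= RS.:- RS.:1 RS.:* (RS.:1 RS.:+ RS.:1) RS.:* (x RS.:* y)) R.refl (H i k) (H k j))))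

    -- The product takes the value 1 at t = 0 and, because H commutes with its multiples, satisfies
    -- the differential equation of e^(-tH).
    exp-shift : exp -2H ⊠ exp H ≋ exp -H
    exp-shift = exp-unique -H (exp -2H ⊠ exp H)
      (λ i j → R.trans (E.⊠-homo (exp -2H) (exp H) i j) (DR.⊠-identityˡ DR.δ i j)) step
      where
      module E = HomProperties ev₀
      step : ∀ i j → ∂ ((exp -2H ⊠ exp H) i j) ≈ (constM -H ⊠ (exp -2H ⊠ exp H)) i j
      step i j = begin
        ∂ ((exp -2H ⊠ exp H) i j)
          ≈⟨ ∂-⊠ (exp -2H) (exp H) i j ⟩
        ((λ i j → ∂ (exp -2H i j)) ⊠ exp H) i j + (exp -2H ⊠ (λ i j → ∂ (exp H i j))) i j
          ≈⟨ +-cong (⊠-cong {N = exp H} (∂-exp -2H) (λ _ _ → refl) i j) (⊠-cong {M = exp -2H} (λ _ _ → refl) (∂-exp H) i j) ⟩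
        ((constM -2H ⊠ exp -2H) ⊠ exp H) i j + (exp -2H ⊠ (constM H ⊠ exp H)) i j
          ≈⟨ +-cong (⊠-assoc (constM -2H) (exp -2H) (exp H) i j) (sym (⊠-assoc (exp -2H) (constM H) (exp H) i j)) ⟩
        (constM -2H ⊠ X) i j + ((exp -2H ⊠ constM H) ⊠ exp H) i j
          ≈⟨ +-congˡ (trans (⊠-cong {N = exp H} (λ i j → sym (exp-commute H -2H H-commutes i j)) (λ _ _ → refl) i j) (⊠-assoc (constM H) (exp -2H) (exp H) i j)) ⟩
        (constM -2H ⊠ X) i j + (constM H ⊠ X) i j
          ≈⟨ sym (∑-distrib-+ (λ k → const (-2H i k) * X k j) (λ k → const (H i k) * X k j)) ⟩
        sum (λ k → const (-2H i k) * X k j + const (H i k) * X k j)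
          ≈⟨ sum-cong (λ k → trans (sym (distribʳ (X k j) (const (-2H i k)) (const (H i k)))) (*-congʳ (trans (sym (cH.+-homo _ _))
               (cH.⟦⟧-cong (RS.solve 1 (λ x → RS.:- (x RS.:+ x) RS.:+ x RS.:= RS.:- x) R.refl (H i k)))))) ⟩
        (constM -H ⊠ X) i j ∎
        where X = exp -2H ⊠ exp H

    tA : Matrix (suc m) (suc m)
    tA i j = t * const (2H i j)

    -- The matrix Φ is specified by an equation instead of a formula, since its rational
    -- coefficients do not exist in a general ring. The factor e^(tA/2) is pushed into the cofactor
    -- of 1 - e^(-tA), the product is rewritten as tAΦ, and Φ is pulled out again by the same lemma.
    det′-sinh : ∀ (Φ : Matrix (suc m) (suc m)) → (∀ i → sum (Φ i) ≈ 1#) →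
      (∀ i j → exp H i j - exp -H i j ≈ (tA ⊠ Φ) i j) →
      det (exp H) * det′ (λ i j → δ i j - exp -2H i j) ≈ t ↑ m * const (RR.det′ 2H) * det Φ
    det′-sinh Φ Φ1≈1 sinh = begin
      det (exp H) * det′ X
        ≈⟨ *-comm _ _ ⟩
      det′ X * det (exp H)
        ≈⟨ det′-⊠ X (exp H) X1≈0 (exp-sum H H1≈0) ⟩
      det′ (X ⊠ exp H)
        ≈⟨ det′-cong X⊠E ⟩
      det′ (tA ⊠ Φ)
        ≈⟨ sym (det′-⊠ tA Φ tA1≈0 Φ1≈1) ⟩
      det′ tA * det Φ
        ≈⟨ *-congʳ (trans (det′-scale t (constM 2H)) (*-congˡ (sym (trans (cHP.det-homo (DR.δ zero ∷ 2H ∘ suc))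
             (det-cong (λ { zero j → cHP.δ-homo zero j ; (suc i) j → refl })))))) ⟩
      t ↑ m * const (RR.det′ 2H) * det Φ ∎
      where
      X : Matrix (suc m) (suc m)
      X i j = δ i j - exp -2H i j
      X1≈0 : ∀ i → sum (X i) ≈ 0#
      X1≈0 i = begin
        sum (λ j → δ i j - exp -2H i j)
          ≈⟨ sum-cong (λ j → solve 2 (λ d e → d :- e := d :* :1 :+ :- :1 :* e) refl (δ i j) (exp -2H i j)) ⟩
        sum (λ j → δ i j * 1# + - 1# * exp -2H i j)
          ≈⟨ sum-lin (- 1#) (λ j → δ i j * 1#) (exp -2H i) ⟩
        sum (λ j → δ i j * 1#) + - 1# * sum (exp -2H i)
          ≈⟨ +-cong (sum-δˡ i (λ _ → 1#)) (*-congˡ (exp-sum -2H -2H1≈0 i)) ⟩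
        1# + - 1# * 1#
          ≈⟨ solve 0 (:1 :+ :- :1 :* :1 := :0) refl ⟩
        0# ∎
      tA1≈0 : ∀ i → sum (tA i) ≈ 0#
      tA1≈0 i = trans (sym (*-distribˡ-sum t (constM 2H i)))
        (trans (*-congˡ (trans (sym (cHP.sum-homo (2H i))) (trans (cH.⟦⟧-cong (2H1≈0 i)) cH.0-homo))) (zeroʳ t))
      X⊠E : X ⊠ exp H ≋ tA ⊠ Φ
      X⊠E i j = begin
        sum (λ k → (δ i k - exp -2H i k) * exp H k j)
          ≈⟨ sum-cong (λ k → solve 3 (λ d q e → (d :- q) :* e := d :* e :+ :- :1 :* (q :* e)) refl (δ i k) (exp -2H i k) (exp H k j)) ⟩
        sum (λ k → δ i k * exp H k j + - 1# * (exp -2H i k * exp H k j))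
          ≈⟨ sum-lin (- 1#) (λ k → δ i k * exp H k j) (λ k → exp -2H i k * exp H k j) ⟩
        sum (λ k → δ i k * exp H k j) + - 1# * (exp -2H ⊠ exp H) i j
          ≈⟨ +-cong (sum-δˡ i (λ k → exp H k j)) (trans (*-congˡ (exp-shift i j)) (solve 1 (λ x → :- :1 :* x := :- x) refl _)) ⟩
        exp H i j - exp -H i j
          ≈⟨ sinh i j ⟩
        (tA ⊠ Φ) i j ∎

  module WalkFormula (R : CommutativeRing 0ℓ 0ℓ) {l m : ℕ}
    (w : Fin l → CommutativeRing.Carrier R) (u : Fin l → Fin (suc m) → CommutativeRing.Carrier R)
    (H : Determinant.Matrix R (suc m) (suc m))
    (H1≈0 : ∀ i → CommutativeRing._≈_ R (Determinant.sum R (H i)) (CommutativeRing.0# R))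
    (2H≋A : ∀ i j → CommutativeRing._≈_ R (CommutativeRing._+_ R (H i j) (H i j)) (TranspositionWalk.laplacian R w u i j))
    (trH≈w : CommutativeRing._≈_ R (Determinant.sum R (λ i → H i i)) (Determinant.sum R w)) where

    private
      module R = CommutativeRing R
      module DR = Determinant R
      module RR = ReducedDeterminant R
    open HurwitzSeries R
    open MatrixExponential R
    open CommutativeRing (hurwitz R) hiding (zero)
    open Determinant (hurwitz R)
    open ReducedDeterminant (hurwitz R)
    open TranspositionWalk R w u
    open SinhFactorization R H H1≈0
    open Generating H 2H≋A trH≈w using (generating; B; walk-generating)

    masked : DR.Matrix (suc m) (suc m)
    masked zero    j = R.0#
    masked (suc i) j = DR.δ (suc i) j

    walk-formula : ∀ (Φ : Matrix (suc m) (suc m)) → (∀ i → sum (Φ i) ≈ 1#) →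
      (∀ i j → exp H i j - exp -H i j ≈ (tA ⊠ Φ) i j) →
      ∀ N → walk N masked R.≈ (t ↑ m * const (RR.det′ laplacian) * det Φ) N
    walk-formula Φ Φ1≈1 sinh N = R.trans (walk-generating N masked) (main N tt)
      where
      open import Relation.Binary.Reasoning.Setoid setoid
      open RingSolver (hurwitz R)
      rows : B masked ≋ (δ zero ∷ (λ i j → δ (suc i) j - exp -2H (suc i) j))
      rows zero    j = trans (+-congˡ (trans (-‿cong (sum-zero (λ k → trans (*-congʳ {exp -2H k j} cH.0-homo) (zeroˡ (exp -2H k j))))) (solve 0 (:- :0 := :0) refl))) (+-identityʳ _)
      rows (suc i) j = +-congˡ (-‿cong (trans (sum-cong (λ k → *-congʳ {exp -2H k j} (cHP.δ-homo (suc i) k))) (sum-δˡ (suc i) (λ k → exp -2H k j))))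
      main : generating masked ≈ t ↑ m * const (RR.det′ laplacian) * det Φ
      main = begin
        det (exp H) * det (B masked)
          ≈⟨ *-congˡ (det-cong rows) ⟩
        det (exp H) * det′ (λ i j → δ i j - exp -2H i j)
          ≈⟨ det′-sinh Φ Φ1≈1 sinh ⟩
        t ↑ m * const (RR.det′ 2H) * det Φ
          ≈⟨ *-congʳ (*-congˡ (cH.⟦⟧-cong (RR.det′-cong 2H≋A))) ⟩
        t ↑ m * const (RR.det′ laplacian) * det Φ ∎

open WalkFormulas

-- Connectivity, forests and their components.

module SpanningTrees where

  open import Defs
  open import Data.Nat.Properties using (≤-trans; <-irrefl; <-≤-trans)
  open import Data.Bool.ListAction using (any)
  open import Data.Fin.Properties using (all?; ¬∀⟶∃¬)
  open import Data.Fin.Subset using (Subset; ∣_∣; _∈_)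
  open import Data.Fin.Subset.Properties using (p⊂q⇒∣p∣<∣q∣; ∣p∣≤n; ∉⊥)
  open import Data.Vec using (tabulate)
  open import Data.Vec.Properties using (lookup∘tabulate; lookup⇒[]=; []=⇒lookup)
  open import Data.List using (List; []; _∷_; _++_; allFin; reverse)
  open import Data.List.Properties using (reverse-++; reverse-involutive; ++-assoc; unfold-reverse)
  open import Data.List.Relation.Unary.Any using (here; there)
  import Data.List.Relation.Unary.Any as Any
  import Data.List.Relation.Unary.Any.Properties as Any
  import Data.List.Relation.Unary.All as All
  import Data.List.Relation.Unary.All.Properties as All
  import Data.List.Membership.Propositional as List
  open import Data.List.Membership.Propositional.Properties using (∈-allFin; ∈-++⁺ˡ; ∈-++⁺ʳ; ∈-++⁻; ∈-map⁺; ∈-map⁻)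
  open import Relation.Binary.PropositionalEquality

  open Equivalence using (to; from)

  private variable
    n : ℕ
    X : Set

  Edge : ℕ → Set
  Edge n = Fin n × Fin n

  data Conn (E : List (Edge n)) (u : Fin n) : Fin n → Set where
    stay : Conn E u u
    fwd  : ∀ {e} → e List.∈ E → Conn E u (proj₁ e) → Conn E u (proj₂ e)
    bwd  : ∀ {e} → e List.∈ E → Conn E u (proj₂ e) → Conn E u (proj₁ e)

  Conn-mono : ∀ {E F : List (Edge n)} → (∀ {e} → e List.∈ E → e List.∈ F) → ∀ {u v} → Conn E u v → Conn F u v
  Conn-mono sub stay      = stay
  Conn-mono sub (fwd p c) = fwd (sub p) (Conn-mono sub c)
  Conn-mono sub (bwd p c) = bwd (sub p) (Conn-mono sub c)

  Conn-trans : ∀ {E : List (Edge n)} {u v x} → Conn E u v → Conn E v x → Conn E u x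
  Conn-trans c stay      = c
  Conn-trans c (fwd p d) = fwd p (Conn-trans c d)
  Conn-trans c (bwd p d) = bwd p (Conn-trans c d)

  Conn-sym : ∀ {E : List (Edge n)} {u v} → Conn E u v → Conn E v u
  Conn-sym stay      = stay
  Conn-sym (fwd p c) = Conn-trans (bwd p stay) (Conn-sym c)
  Conn-sym (bwd p c) = Conn-trans (fwd p stay) (Conn-sym c)

  Conn-∷ : ∀ {E : List (Edge n)} {e u v} → Conn (e ∷ E) u v →
    Conn E u v ⊎ (Conn E u (proj₁ e) × Conn E (proj₂ e) v) ⊎ (Conn E u (proj₂ e) × Conn E (proj₁ e) v)
  Conn-∷ stay = inj₁ stay
  Conn-∷ (fwd (here refl) c) with Conn-∷ c
  ... | inj₁ p                = inj₂ (inj₁ (p , stay))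
  ... | inj₂ (inj₁ (p , q))   = inj₂ (inj₁ (p , stay))
  ... | inj₂ (inj₂ (p , q))   = inj₁ p
  Conn-∷ (fwd (there m) c) with Conn-∷ c
  ... | inj₁ p                = inj₁ (fwd m p)
  ... | inj₂ (inj₁ (p , q))   = inj₂ (inj₁ (p , fwd m q))
  ... | inj₂ (inj₂ (p , q))   = inj₂ (inj₂ (p , fwd m q))
  Conn-∷ (bwd (here refl) c) with Conn-∷ c
  ... | inj₁ p                = inj₂ (inj₂ (p , stay))
  ... | inj₂ (inj₁ (p , q))   = inj₁ p
  ... | inj₂ (inj₂ (p , q))   = inj₂ (inj₂ (p , stay))
  Conn-∷ (bwd (there m) c) with Conn-∷ c
  ... | inj₁ p                = inj₁ (bwd m p)
  ... | inj₂ (inj₁ (p , q))   = inj₂ (inj₁ (p , bwd m q))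
  ... | inj₂ (inj₂ (p , q))   = inj₂ (inj₂ (p , bwd m q))

  T-does : ∀ {P : Set} {d : Dec P} → T (does d) → P
  T-does {d = yes p} _ = p

  does-T : ∀ {P : Set} {d : Dec P} → P → T (does d)
  does-T {d = yes _} p = _
  does-T {d = no ¬p} p = ¬p p

  any⁺ : ∀ (p : X → Bool) {x xs} → x List.∈ xs → T (p x) → T (any p xs)
  any⁺ p x∈xs px = Any.any⁺ p (Any.map (λ { refl → px }) x∈xs)

  any⁻ : ∀ (p : X → Bool) xs → T (any p xs) → ∃ λ x → x List.∈ xs × T (p x)
  any⁻ p xs t = List.find (Any.any⁻ p xs t)

  reachable-step : ∀ (E : List (Edge n)) k u v → T (reachable E (suc k) u v) →
    T (reachable E k u v) ⊎ ∃ λ e → e List.∈ E ×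
      ((T (reachable E k u (proj₁ e)) × proj₂ e ≡ v) ⊎ (T (reachable E k u (proj₂ e)) × proj₁ e ≡ v))
  reachable-step E k u v t with to T-∨ t
  ... | inj₁ r = inj₁ r
  ... | inj₂ s with any⁻ _ E s
  ... | e , e∈E , p = inj₂ (e , e∈E , [ inj₁ ∘ split , inj₂ ∘ split ]′ (to T-∨ p))
    where
    split : ∀ {b} {x} → T (b ∧ does (x ≟ v)) → T b × x ≡ v
    split {x = x} q = let (r , d) = to T-∧ q in r , T-does {d = x ≟ v} d

  reachable-suc : ∀ (E : List (Edge n)) k u v → T (reachable E k u v) → T (reachable E (suc k) u v)
  reachable-suc E k u v t = from T-∨ (inj₁ t)

  reachable-fwd : ∀ (E : List (Edge n)) k u {e} → e List.∈ E → T (reachable E k u (proj₁ e)) → T (reachable E (suc k) u (proj₂ e))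
  reachable-fwd E k u {e} e∈E t = from T-∨ (inj₂ (any⁺ _ e∈E (from T-∨ (inj₁ (from T-∧ (t , does-T {d = proj₂ e ≟ proj₂ e} refl))))))

  reachable-bwd : ∀ (E : List (Edge n)) k u {e} → e List.∈ E → T (reachable E k u (proj₂ e)) → T (reachable E (suc k) u (proj₁ e))
  reachable-bwd E k u {e} e∈E t = from T-∨ (inj₂ (any⁺ _ e∈E (from T-∨ (inj₂ (from T-∧ (t , does-T {d = proj₁ e ≟ proj₁ e} refl))))))

  reachable⇒Conn : ∀ (E : List (Edge n)) k u v → T (reachable E k u v) → Conn E u v
  reachable⇒Conn E zero    u v t with T-does {d = u ≟ v} t
  ... | refl = stay
  reachable⇒Conn E (suc k) u v t with reachable-step E k u v t
  ... | inj₁ r = reachable⇒Conn E k u v r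
  ... | inj₂ (e , e∈E , inj₁ (r , refl)) = fwd e∈E (reachable⇒Conn E k u _ r)
  ... | inj₂ (e , e∈E , inj₂ (r , refl)) = bwd e∈E (reachable⇒Conn E k u _ r)

  module Completeness {n} (E : List (Edge n)) (u : Fin n) where

    Closed : ℕ → Set
    Closed k = ∀ v → T (reachable E (suc k) u v) → T (reachable E k u v)

    ball : ℕ → Subset n
    ball k = tabulate (reachable E k u)

    ∈-ball⁺ : ∀ {k v} → T (reachable E k u v) → v ∈ ball k
    ∈-ball⁺ {k} {v} t = lookup⇒[]= v (ball k) (trans (lookup∘tabulate (reachable E k u) v) (to T-≡ t))

    ∈-ball⁻ : ∀ {k v} → v ∈ ball k → T (reachable E k u v)
    ∈-ball⁻ {k} {v} p = from T-≡ (trans (sym (lookup∘tabulate (reachable E k u) v)) ([]=⇒lookup p))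

    closed-suc : ∀ k → Closed k → Closed (suc k)
    closed-suc k closed v t with reachable-step E (suc k) u v t
    ... | inj₁ r = r
    ... | inj₂ (e , e∈E , inj₁ (r , refl)) = reachable-fwd E k u e∈E (closed _ r)
    ... | inj₂ (e , e∈E , inj₂ (r , refl)) = reachable-bwd E k u e∈E (closed _ r)

    -- The ball of radius 0 contains u, and every ball that is not closed gains a vertex in the next
    -- step. So radius k either has stopped growing or contains more than k vertices.
    closed-or-large : ∀ k → Closed k ⊎ k < ∣ ball k ∣
    closed-or-large zero = inj₂ (<-≤-trans (s≤s z≤n) (p⊂q⇒∣p∣<∣q∣ {p = Data.Fin.Subset.⊥}
      ((λ x∈⊥ → ⊥-elim (∉⊥ x∈⊥)) , u , ∈-ball⁺ {zero} (does-T {d = u ≟ u} refl) , ∉⊥)) )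
    closed-or-large (suc k) with closed-or-large k | all? (λ v → T? (reachable E (suc k) u v) →-dec T? (reachable E k u v))
    ... | inj₁ closed | _          = inj₁ (closed-suc k closed)
    ... | inj₂ _      | yes closed = inj₁ (closed-suc k closed)
    ... | inj₂ large  | no ¬closed = inj₂ (≤-trans (s≤s large) (p⊂q⇒∣p∣<∣q∣ ((λ {v} v∈ → ∈-ball⁺ {suc k} (reachable-suc E k u v (∈-ball⁻ {k} v∈))) ,
        new)))
      where
      new : ∃ λ v → v ∈ ball (suc k) × ¬ v ∈ ball k
      new with ¬∀⟶∃¬ n _ (λ v → T? (reachable E (suc k) u v) →-dec T? (reachable E k u v)) ¬closed
      ... | v , ¬p with T? (reachable E (suc k) u v) | T? (reachable E k u v)
      ... | yes a | no b = v , ∈-ball⁺ {suc k} a , b ∘ ∈-ball⁻ {k}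
      ... | yes a | yes b = contradiction (λ _ → b) ¬p
      ... | no a  | _ = contradiction (λ t → contradiction t a) ¬p

    -- There are only n vertices, so the bound n in `connected` and `acyclic` is enough to find
    -- every connection.
    closed : Closed n
    closed with closed-or-large n
    ... | inj₁ c = c
    ... | inj₂ l = contradiction (<-≤-trans l (∣p∣≤n (ball n))) (<-irrefl refl)

    reach-self : ∀ k → T (reachable E k u u)
    reach-self zero    = does-T {d = u ≟ u} refl
    reach-self (suc k) = reachable-suc E k u u (reach-self k)

    Conn⇒reachable : ∀ {v} → Conn E u v → T (reachable E n u v)
    Conn⇒reachable stay      = reach-self n
    Conn⇒reachable (fwd p c) = closed _ (reachable-fwd E n u p (Conn⇒reachable c))
    Conn⇒reachable (bwd p c) = closed _ (reachable-bwd E n u p (Conn⇒reachable c))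

  open Completeness using (Conn⇒reachable)

  Connected : List (Edge n) → Set
  Connected {n} E = ∀ (u v : Fin n) → Conn E u v

  Acyclic : List (Edge n) → Set
  Acyclic E = ∀ xs e ys → E ≡ xs ++ e ∷ ys → ¬ Conn (xs ++ ys) (proj₁ e) (proj₂ e)

  connected⁺ : ∀ {E : List (Edge n)} → Connected E → T (connected E)
  connected⁺ {n} {E} c = All.all⁻ _ (All.universal (λ u → All.all⁻ _ (All.universal (λ v → Conn⇒reachable E u (c u v)) (allFin n))) (allFin n))

  connected⁻ : ∀ {E : List (Edge n)} → T (connected E) → Connected E
  connected⁻ {n} {E} t u v = reachable⇒Conn E n u v (All.lookup (All.all⁺ _ (allFin n) (All.lookup (All.all⁺ _ (allFin n) t) (∈-allFin u))) (∈-allFin v))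

  picks⁺ : ∀ xs (e : X) ys → (e , xs ++ ys) List.∈ picks (xs ++ e ∷ ys)
  picks⁺ []       e ys = here refl
  picks⁺ (x ∷ xs) e ys = there (∈-map⁺ _ (picks⁺ xs e ys))

  picks⁻ : ∀ (E : List X) {e rest} → (e , rest) List.∈ picks E → ∃₂ λ xs ys → E ≡ xs ++ e ∷ ys × rest ≡ xs ++ ys
  picks⁻ (x ∷ E) (here refl) = [] , E , refl , refl
  picks⁻ (x ∷ E) (there p) with ∈-map⁻ _ p
  ... | (e , rest) , q , refl with picks⁻ E q
  ... | xs , ys , refl , refl = x ∷ xs , ys , refl , refl

  T-not : ∀ {b} → (T b → ⊥) → T (not b)
  T-not {false} _ = _
  T-not {true}  f = f _

  not-T : ∀ {b} → T (not b) → ¬ T b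
  not-T {true} () _

  acyclic⁺ : ∀ {E : List (Edge n)} → Acyclic E → T (acyclic E)
  acyclic⁺ {n} {E} a = All.all⁻ (λ p → not (reachable (proj₂ p) n (proj₁ (proj₁ p)) (proj₂ (proj₁ p)))) (All.tabulate λ { {e , rest} p → T-not (λ r → bad p (reachable⇒Conn rest n _ _ r)) })
    where
    bad : ∀ {e rest} → (e , rest) List.∈ picks E → ¬ Conn rest (proj₁ e) (proj₂ e)
    bad p c with picks⁻ E p
    ... | xs , ys , eq , refl = a xs _ ys eq c

  acyclic⁻ : ∀ {E : List (Edge n)} → T (acyclic E) → Acyclic E
  acyclic⁻ {E = E} t xs e ys refl c = not-T (All.lookup (All.all⁺ _ (picks E) t) (picks⁺ xs e ys)) (Conn⇒reachable (xs ++ ys) (proj₁ e) c)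

  tree⁺ : ∀ {E : List (Edge n)} → Connected E → Acyclic E → isSpanningTree E ≡ true
  tree⁺ c a = to T-≡ (from T-∧ (connected⁺ c , acyclic⁺ a))

  tree⁻ : ∀ {E : List (Edge n)} → isSpanningTree E ≡ true → Connected E × Acyclic E
  tree⁻ eq = let (c , a) = to T-∧ (from T-≡ eq) in connected⁻ c , acyclic⁻ a

  reverse-split : ∀ (xs : List X) e ys → reverse (xs ++ e ∷ ys) ≡ reverse ys ++ e ∷ reverse xs
  reverse-split xs e ys = begin
    reverse (xs ++ e ∷ ys)                 ≡⟨ reverse-++ xs (e ∷ ys) ⟩
    reverse (e ∷ ys) ++ reverse xs         ≡⟨ cong (_++ reverse xs) (unfold-reverse e ys) ⟩
    (reverse ys ++ e ∷ []) ++ reverse xs   ≡⟨ ++-assoc (reverse ys) (e ∷ []) (reverse xs) ⟩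
    reverse ys ++ e ∷ reverse xs           ∎
    where open ≡-Reasoning

  Conn-reverse : ∀ xs ys {u v : Fin n} → Conn (xs ++ ys) u v → Conn (reverse ys ++ reverse xs) u v
  Conn-reverse xs ys = Conn-mono λ p → subst (_ List.∈_) (reverse-++ xs ys) (Any.reverse⁺ p)

  Conn-reverse₁ : ∀ {E : List (Edge n)} {u v} → Conn E u v → Conn (reverse E) u v
  Conn-reverse₁ = Conn-mono Any.reverse⁺

  -- Needed because chosen edges are accumulated at the front of a list, whereas `sublists` keeps
  -- the original order.
  Acyclic-reverse : ∀ {E : List (Edge n)} → Acyclic E → Acyclic (reverse E)
  Acyclic-reverse {E = E} a xs e ys eq c = a (reverse ys) e (reverse xs)
    (trans (sym (reverse-involutive E)) (trans (cong reverse eq) (reverse-split xs e ys))) (Conn-reverse xs ys c)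

  -- `r` chooses a representative in each component of C. Vertex zero must represent its own
  -- component, as its row is the one removed from the Laplacian.
  record Components {m} (C : List (Edge (suc m))) (r : Fin (suc m) → Fin (suc m)) : Set where
    field
      sound      : ∀ {u v} → Conn C u v → r u ≡ r v
      complete   : ∀ {u v} → r u ≡ r v → Conn C u v
      idempotent : ∀ u → r (r u) ≡ r u
      root       : r zero ≡ zero

  redirect : Fin n → Fin n → Fin n → Fin n
  redirect a b i with i ≟ b
  ... | yes _ = a
  ... | no  _ = i

  redirect-at : ∀ (a b : Fin n) {i} → i ≡ b → redirect a b i ≡ a
  redirect-at a b {i} i≡b with i ≟ b
  ... | yes _ = refl
  ... | no i≢b = contradiction i≡b i≢b

  redirect-off : ∀ (a b : Fin n) {i} → i ≢ b → redirect a b i ≡ i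
  redirect-off a b {i} i≢b with i ≟ b
  ... | yes i≡b = contradiction i≡b i≢b
  ... | no _ = refl

  Components-[] : ∀ {m} → Components {m} [] (λ i → i)
  Components-[] = record { sound = λ { stay → refl } ; complete = λ { refl → stay } ; idempotent = λ _ → refl ; root = refl }

  module Merge {m} {C : List (Edge (suc m))} {r} (comp : Components C r) {e p q}
    (e≡ : e ≡ (p , q) ⊎ e ≡ (q , p)) (rp≢rq : r p ≢ r q) (rq≢0 : r q ≢ zero) where
    open Components comp

    r′ : Fin (suc m) → Fin (suc m)
    r′ i = redirect (r p) (r q) (r i)

    link : Conn (e ∷ C) p q
    link = [ (λ { refl → fwd (here refl) stay }) , (λ { refl → bwd (here refl) stay }) ]′ e≡

    grow : ∀ {u v} → Conn C u v → Conn (e ∷ C) u v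
    grow = Conn-mono there

    r′p : r′ p ≡ r p
    r′p = redirect-off (r p) (r q) rp≢rq

    r′q : r′ q ≡ r p
    r′q = redirect-at (r p) (r q) refl

    merged : Components (e ∷ C) r′
    merged = record { sound = sound′ ; complete = complete′ _ _ ; idempotent = idempotent′
      ; root = trans (redirect-off (r p) (r q) (λ eq → rq≢0 (trans (sym eq) root))) root }
      where
      edge : ∀ {f} → f List.∈ e ∷ C → r′ (proj₁ f) ≡ r′ (proj₂ f)
      edge (here refl) = [ (λ { refl → trans r′p (sym r′q) }) , (λ { refl → trans r′q (sym r′p) }) ]′ e≡
      edge (there f∈C) = cong (redirect (r p) (r q)) (sound (fwd f∈C stay))
      sound′ : ∀ {u v} → Conn (e ∷ C) u v → r′ u ≡ r′ v
      sound′ stay = refl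
      sound′ (fwd f c) = trans (sound′ c) (edge f)
      sound′ (bwd f c) = trans (sound′ c) (sym (edge f))
      complete′ : ∀ u v → r′ u ≡ r′ v → Conn (e ∷ C) u v
      complete′ u v eq with r u ≟ r q | r v ≟ r q
      ... | yes a | yes b = grow (complete (trans a (sym b)))
      ... | yes a | no  b = Conn-trans (grow (complete a)) (Conn-trans (Conn-sym link) (grow (complete eq)))
      ... | no  a | yes b = Conn-trans (grow (complete eq)) (Conn-trans link (grow (complete (sym b))))
      ... | no  a | no  b = grow (complete eq)
      idempotent′ : ∀ u → r′ (r′ u) ≡ r′ u
      idempotent′ u with r u ≟ r q
      ... | yes a = trans (redirect-off (r p) (r q) (λ eq → rp≢rq (trans (sym (idempotent p)) eq))) (idempotent p)
      ... | no a  = trans (redirect-off (r p) (r q) (λ eq → a (trans (sym (idempotent u)) eq))) (idempotent u)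

  -- A cycle through an edge f of C either avoids e, against the acyclicity of C, or crosses e once;
  -- in that case the rest of the cycle, together with f, joins the ends of e inside C.
  Acyclic-∷ : ∀ {C : List (Edge n)} {e} → Acyclic C → ¬ Conn C (proj₁ e) (proj₂ e) → Acyclic (e ∷ C)
  Acyclic-∷ {C = C} {e} a ¬c [] _ ys refl c = ¬c c
  Acyclic-∷ {C = C} {e} a ¬c (_ ∷ xs) f ys refl c with Conn-∷ c
  ... | inj₁ p              = a xs f ys refl p
  ... | inj₂ (inj₁ (p , q)) = ¬c (Conn-trans (Conn-sym (widen p)) (Conn-trans (fwd (∈-++⁺ʳ xs (here refl)) stay) (Conn-sym (widen q))))
    where
    widen : ∀ {u v} → Conn (xs ++ ys) u v → Conn (xs ++ f ∷ ys) u v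
    widen = Conn-mono λ m → [ ∈-++⁺ˡ , (λ k → ∈-++⁺ʳ xs (there k)) ]′ (∈-++⁻ xs m)
  ... | inj₂ (inj₂ (p , q)) = ¬c (Conn-trans (widen q) (Conn-trans (bwd (∈-++⁺ʳ xs (here refl)) stay) (widen p)))
    where
    widen : ∀ {u v} → Conn (xs ++ ys) u v → Conn (xs ++ f ∷ ys) u v
    widen = Conn-mono λ m → [ ∈-++⁺ˡ , (λ k → ∈-++⁺ʳ xs (there k)) ]′ (∈-++⁻ xs m)

open SpanningTrees

-- The weighted matrix-tree theorem by deletion and contraction.

module MatrixTreeTheorem where

  open import Defs hiding (det)
  open import Data.List using (List; []; _∷_; _++_; reverse; _ʳ++_)
  open import Data.List.Membership.Propositional using (_∈_)
  open import Data.List.Relation.Unary.Any using (there)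
  open import Data.Vec.Functional using () renaming (_∷_ to _∷ᵛ_)
  open import Data.Fin.Properties using (¬∀⟶∃¬; all?)
  open import Relation.Binary.PropositionalEquality as ≡ using (_≡_; _≢_)

  private variable
    n m : ℕ

  module Contraction (R : CommutativeRing 0ℓ 0ℓ) where
    open CommutativeRing R hiding (zero)
    open Determinant R
    open RingSolver R
    open import Relation.Binary.Reasoning.Setoid setoid

    -- The congruence by the elementary matrix taking e_b − e_a to e_b.
    shear : Fin n → Fin n → Matrix n n → Matrix n n
    shear a b X i j = X i j + δ a i * X b j + (X i b + δ a i * X b b) * δ a j

    -- Row b is added to row a and then column b to column a; as a ≠ b, neither changes the
    -- determinant.
    det-shear : ∀ {a b : Fin n} → a ≢ b → ∀ X → det (shear a b X) ≈ det X
    det-shear {n} {a} {b} a≢b X = begin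
      det (shear a b X)
        ≈⟨ det-cong (λ i j → +-congˡ (*-congʳ (sym (sum-δʳ b (Y i))))) ⟩
      det (λ i j → Y i j + sum (λ k → Y i k * δ k b) * δ a j)
        ≈⟨ det-add-column Y (λ k → δ k b) (δ a) ⟩
      det Y * (1# + sum (λ i → δ i b * δ a i))
        ≈⟨ *-congˡ (+-congˡ (trans (sum-cong (λ i → *-comm (δ i b) (δ a i))) (trans (sum-δˡ a (λ i → δ i b)) (reflexive (δ-≢ a≢b))))) ⟩
      det Y * (1# + 0#)
        ≈⟨ solve 1 (λ x → x :* (:1 :+ :0) := x) refl (det Y) ⟩
      det Y
        ≈⟨ det-rankOne X (δ a) (X b) ⟩
      det X + sum (λ i → δ a i * det (upd X i (X b)))
        ≈⟨ +-congˡ (trans (sum-δˡ a (λ i → det (upd X i (X b)))) (trans (det-upd-row X a b) (trans (*-congʳ (reflexive (δ-≢ a≢b))) (zeroˡ _)))) ⟩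
      det X + 0#
        ≈⟨ +-identityʳ _ ⟩
      det X ∎
      where
      Y : Matrix n n
      Y i j = X i j + δ a i * X b j

    -- Row b is e_b, and multiples of it are subtracted from the other rows. The coefficient at b is
    -- set to 0 so that row b survives.
    det-clear-column : ∀ (b : Fin n) N → det (upd N b (δ b)) ≈ det (upd (λ i j → N i j - N i b * δ b j) b (δ b))
    det-clear-column {n} b N = begin
      det P
        ≈⟨ sym (+-identityʳ _) ⟩
      det P + 0#
        ≈⟨ +-congˡ (sym (sum-zero term)) ⟩
      det P + sum (λ i → u i * det (upd P i (δ b)))
        ≈⟨ sym (det-rankOne P u (δ b)) ⟩
      det (λ i j → P i j + u i * δ b j)
        ≈⟨ det-cong entry ⟩
      det (upd (λ i j → N i j - N i b * δ b j) b (δ b)) ∎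
      where
      P = upd N b (δ b)
      u : Vect n
      u = upd (λ i → - N i b) b 0#
      term : ∀ i → u i * det (upd P i (δ b)) ≈ 0#
      term i with i ≟ b
      ... | yes ≡.refl = trans (*-congʳ (reflexive (upd-same (λ i → - N i b) b 0#))) (zeroˡ _)
      ... | no i≢b = trans (*-congˡ (trans (det-cong (upd-cong P i (λ j → reflexive (≡.cong (λ r → r j) (≡.sym (upd-same N b (δ b)))))))
        (det-row-of P i b (i≢b ∘ ≡.sym)))) (zeroʳ _)
      entry : ∀ i j → P i j + u i * δ b j ≈ upd (λ i j → N i j - N i b * δ b j) b (δ b) i j
      entry i j with i ≟ b
      ... | yes ≡.refl rewrite upd-same N b (δ b) | upd-same (λ i → - N i b) b 0# | upd-same (λ i j → N i j - N i b * δ b j) b (δ b) =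
        trans (+-congˡ (zeroˡ _)) (+-identityʳ _)
      ... | no i≢b rewrite upd-other N b (δ b) i≢b | upd-other (λ i → - N i b) b 0# i≢b | upd-other (λ i j → N i j - N i b * δ b j) b (δ b) i≢b =
        solve 3 (λ x y d → x :+ :- y :* d := x :- y :* d) refl (N i j) (N i b) (δ b j)

    -- The shear takes e_b - e_a to e_b, so the edge only changes the entry (b , b). The determinant
    -- is affine in this entry: the constant term deletes the edge, the slope has row and column b
    -- cleared and is the contraction of b into a.
    det-contract : ∀ {a b : Fin n} → a ≢ b → ∀ X c →
      det (λ i j → X i j + c * ((δ b i - δ a i) * (δ b j - δ a j)))
        ≈ det X + c * det (upd (λ i j → shear a b X i j - shear a b X i b * δ b j) b (δ b))
    det-contract {n} {a} {b} a≢b X c = begin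
      det Xc
        ≈⟨ sym (det-shear a≢b Xc) ⟩
      det (shear a b Xc)
        ≈⟨ det-cong entry ⟩
      det (λ i j → N i j + c * δ b i * δ b j)
        ≈⟨ det-rankOne N (λ i → c * δ b i) (δ b) ⟩
      det N + sum (λ i → c * δ b i * det (upd N i (δ b)))
        ≈⟨ +-cong (det-shear a≢b X) (trans (sum-cong (λ i → *-assoc c (δ b i) _))
             (trans (sym (*-distribˡ-sum c (λ i → δ b i * det (upd N i (δ b))))) (*-congˡ (sum-δˡ b (λ i → det (upd N i (δ b))))))) ⟩
      det X + c * det (upd N b (δ b))
        ≈⟨ +-congˡ (*-congˡ (det-clear-column b N)) ⟩
      det X + c * det (upd (λ i j → N i j - N i b * δ b j) b (δ b)) ∎
      where
      N = shear a b X
      Xc : Matrix n n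
      Xc i j = X i j + c * ((δ b i - δ a i) * (δ b j - δ a j))
      entry : ∀ i j → shear a b Xc i j ≈ N i j + c * δ b i * δ b j
      entry i j rewrite δ-refl b | δ-≢ a≢b =
        solve 9 (λ xij xbj xib xbb c bi ai bj aj →
          xij :+ c :* ((bi :- ai) :* (bj :- aj)) :+ ai :* (xbj :+ c :* ((:1 :- :0) :* (bj :- aj)))
            :+ (xib :+ c :* ((bi :- ai) :* (:1 :- :0)) :+ ai :* (xbb :+ c :* ((:1 :- :0) :* (:1 :- :0)))) :* aj
          := xij :+ ai :* xbj :+ (xib :+ ai :* xbb) :* aj :+ c :* bi :* bj) refl
          (X i j) (X b j) (X i b) (X b b) c (δ b i) (δ a i) (δ b j) (δ a j)

  module MatrixTree (R : CommutativeRing 0ℓ 0ℓ) {m : ℕ} (w : Edge (suc m) → CommutativeRing.Carrier R) where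
    open CommutativeRing R hiding (zero)
    open Determinant R
    open ReducedDeterminant R
    open Contraction R
    open RingSolver R
    open import Relation.Binary.Reasoning.Setoid setoid

    private
      V : Set
      V = Fin (suc m)

    incidence : (V → V) → Edge (suc m) → Vect (suc m)
    incidence r e i = δ (r (proj₁ e)) i - δ (r (proj₂ e)) i

    gram : (V → V) → List (Edge (suc m)) → Matrix (suc m) (suc m)
    gram r []      i j = 0#
    gram r (e ∷ L) i j = gram r L i j + w e * (incidence r e i * incidence r e j)

    Dead : (V → V) → V → Set
    Dead r i = i ≡ zero ⊎ r i ≢ i

    dead? : ∀ r i → Dec (Dead r i)
    dead? r i = (i ≟ zero) ⊎-dec ¬? (r i ≟ i)

    dead : (V → V) → V → Carrier
    dead r i with dead? r i
    ... | yes _ = 1#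
    ... | no  _ = 0#

    dead-yes : ∀ {r i} → Dead r i → dead r i ≈ 1#
    dead-yes {r} {i} d with dead? r i
    ... | yes _ = refl
    ... | no ¬d = contradiction d ¬d

    dead-no : ∀ {r i} → ¬ Dead r i → dead r i ≈ 0#
    dead-no {r} {i} ¬d with dead? r i
    ... | yes d = contradiction d ¬d
    ... | no _ = refl

    -- The reduced Laplacian of the graph obtained by contracting every label class to
    -- its representative; the vertices that disappear get the row e_i.
    contracted : (V → V) → List (Edge (suc m)) → Matrix (suc m) (suc m)
    contracted r L i j = dead r i * δ i j + gram r L i j

    -- The weighted count of the S ⊆ L for which C together with S is a spanning tree. Its branching
    -- imitates deletion and contraction, and `C ʳ++ []` restores the original order of the edges.
    trees : List (Edge (suc m)) → List (Edge (suc m)) → Carrier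
    trees C []      = if isSpanningTree (C ʳ++ []) then 1# else 0#
    trees C (e ∷ L) = trees C L + w e * trees (e ∷ C) L

    trees-cyclic : ∀ xs e ys L → Conn (xs ++ ys) (proj₁ e) (proj₂ e) → trees (xs ++ e ∷ ys) L ≈ 0#
    trees-cyclic xs e ys [] c with isSpanningTree (reverse (xs ++ e ∷ ys)) in eq
    ... | false = refl
    ... | true  = contradiction (Conn-reverse xs ys c) (proj₂ (tree⁻ eq) (reverse ys) e (reverse xs) (reverse-split xs e ys))
    trees-cyclic xs e ys (f ∷ L) c = trans
      (+-cong (trees-cyclic xs e ys L c) (trans (*-congˡ (trees-cyclic (f ∷ xs) e ys L (Conn-mono there c))) (zeroʳ _)))
      (+-identityʳ _)

    module _ {r : V → V} {C : List (Edge (suc m))} (comp : Components C r) where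
      open Components comp

      -- With no edges left the matrix is diagonal, with 1 at dead vertices and 0 at live ones. If
      -- all labels are zero, C is connected and the matrix is the identity. Otherwise some label r
      -- i is live, its unit vector is in the kernel, and C cannot connect i with zero.
      contracted-[] : Acyclic C → det (contracted r []) ≈ trees C []
      contracted-[] acyc with all? (λ i → r i ≟ zero)
      ... | yes r≡0 = begin
        det (contracted r [])
          ≈⟨ det-cong (λ i j → trans (+-identityʳ _) (trans (*-congʳ (dead-yes (is-dead i))) (*-identityˡ _))) ⟩
        det δ
          ≈⟨ det-δ (suc m) ⟩
        1#
          ≡⟨ ≡.cong (if_then 1# else 0#) (≡.sym (tree⁺ (λ u v → Conn-reverse₁ (complete (≡.trans (r≡0 u) (≡.sym (r≡0 v))))) (Acyclic-reverse acyc))) ⟩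
        (if isSpanningTree (reverse C) then 1# else 0#) ∎
        where
        is-dead : ∀ i → Dead r i
        is-dead zero    = inj₁ ≡.refl
        is-dead (suc i) = inj₂ (λ eq → contradiction (≡.trans (≡.sym (r≡0 (suc i))) eq) (λ ()))
      ... | no ¬r≡0 with ¬∀⟶∃¬ _ _ (λ i → r i ≟ zero) ¬r≡0
      ... | i , ri≢0 with isSpanningTree (reverse C) in eq
      ... | true  = contradiction (≡.trans (sound (Conn-mono unreverse (proj₁ (tree⁻ eq) i zero))) root) ri≢0
        where
        import Data.List.Relation.Unary.Any.Properties as Any
        unreverse : ∀ {e} → e ∈ reverse C → e ∈ C
        unreverse = Any.reverse⁻
      ... | false = trans (sym (*-identityʳ _)) (trans (*-congˡ (reflexive (≡.sym (δ-refl (r i)))))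
        (det-kernel (contracted r []) (δ (r i)) (λ k → trans (sum-cong (λ j → *-comm _ (δ (r i) j))) (trans (sum-δˡ (r i) (contracted r [] k)) (alive k))) (r i)))
        where
        alive : ∀ k → contracted r [] k (r i) ≈ 0#
        alive k with k ≟ r i
        ... | yes ≡.refl = trans (+-identityʳ _) (trans (*-congʳ (dead-no λ { (inj₁ z) → ri≢0 z ; (inj₂ ne) → ne (idempotent i) })) (zeroˡ _))
        ... | no k≢ri    = trans (+-identityʳ _) (trans (*-congˡ (reflexive (δ-≢ k≢ri))) (zeroʳ _))

      module _ {e p q} (e≡ : e ≡ (p , q) ⊎ e ≡ (q , p)) (rp≢rq : r p ≢ r q) (rq≢0 : r q ≢ zero) where
        open Merge comp e≡ rp≢rq rq≢0

        private
          a = r p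
          b = r q

        -- Relabelling b as a is the linear map x ↦ x + x_b (e_a - e_b) on incidence vectors. This
        -- is what turns relabelling into a shear of the Gram matrix followed by clearing b.
        δ-redirect : ∀ v i → δ (r′ v) i ≈ δ (r v) i + δ (r v) b * (δ a i - δ b i)
        δ-redirect v i with r v ≟ b
        ... | yes rv≡b rewrite rv≡b | δ-refl b = solve 2 (λ x y → y := x :+ :1 :* (y :- x)) refl (δ b i) (δ a i)
        ... | no  rv≢b rewrite δ-≢ rv≢b = solve 3 (λ x y z → x := x :+ :0 :* (y :- z)) refl (δ (r v) i) (δ a i) (δ b i)

        incidence-redirect : ∀ f i → incidence r′ f i ≈ incidence r f i + incidence r f b * (δ a i - δ b i)
        incidence-redirect f i = trans (+-cong (δ-redirect (proj₁ f) i) (-‿cong (δ-redirect (proj₂ f) i)))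
          (solve 6 (λ x y z u v w → x :+ y :* (v :- w) :- (z :+ u :* (v :- w)) := x :- z :+ (y :- u) :* (v :- w)) refl
            (δ (r (proj₁ f)) i) (δ (r (proj₁ f)) b) (δ (r (proj₂ f)) i) (δ (r (proj₂ f)) b) (δ a i) (δ b i))

        clear : Matrix (suc m) (suc m) → Matrix (suc m) (suc m)
        clear X i j = shear a b X i j - shear a b X i b * δ b j

        gram-clear : ∀ L i j → i ≢ b → gram r′ L i j ≈ clear (gram r L) i j
        gram-clear [] i j i≢b =
          solve 4 (λ x y z w → :0 := :0 :+ x :* :0 :+ (:0 :+ x :* :0) :* y :- (:0 :+ x :* :0 :+ (:0 :+ x :* :0) :* z) :* w) refl (δ a i) (δ a j) (δ a b) (δ b j)
        gram-clear (f ∷ L) i j i≢b = trans (+-cong (gram-clear L i j i≢b) (*-congˡ (*-cong (incidence-redirect f i) (incidence-redirect f j)))) combine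
          where
          g = gram r L
          combine : clear (gram r L) i j + w f * ((incidence r f i + incidence r f b * (δ a i - δ b i)) * (incidence r f j + incidence r f b * (δ a j - δ b j)))
            ≈ clear (gram r (f ∷ L)) i j
          combine rewrite δ-≢ rp≢rq | δ-≢ (i≢b ∘ ≡.sym) =
            solve 11 (λ gij gbj gib gbb c xi xj xb ai aj bj →
              gij :+ ai :* gbj :+ (gib :+ ai :* gbb) :* aj :- (gib :+ ai :* gbb :+ (gib :+ ai :* gbb) :* :0) :* bj
                :+ c :* ((xi :+ xb :* (ai :- :0)) :* (xj :+ xb :* (aj :- bj)))
              := (gij :+ c :* (xi :* xj)) :+ ai :* (gbj :+ c :* (xb :* xj)) :+ ((gib :+ c :* (xi :* xb)) :+ ai :* (gbb :+ c :* (xb :* xb))) :* aj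
                :- ((gib :+ c :* (xi :* xb)) :+ ai :* (gbb :+ c :* (xb :* xb)) :+ ((gib :+ c :* (xi :* xb)) :+ ai :* (gbb :+ c :* (xb :* xb))) :* :0) :* bj)
              refl (g i j) (g b j) (g i b) (g b b) (w f) (incidence r f i) (incidence r f j) (incidence r f b) (δ a i) (δ a j) (δ b j)

        incidence-dead : ∀ f → incidence r′ f b ≈ 0#
        incidence-dead f = trans (incidence-redirect f b) (vanish)
          where
          vanish : incidence r f b + incidence r f b * (δ a b - δ b b) ≈ 0#
          vanish rewrite δ-≢ rp≢rq | δ-refl b = solve 1 (λ x → x :+ x :* (:0 :- :1) := :0) refl (incidence r f b)

        gram-dead : ∀ L j → gram r′ L b j ≈ 0#
        gram-dead []      j = refl
        gram-dead (f ∷ L) j = trans (+-cong (gram-dead L j) (trans (*-congˡ (trans (*-congʳ (incidence-dead f)) (zeroˡ _))) (zeroʳ _))) (+-identityʳ _)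

        dead-b : dead r b ≈ 0#
        dead-b = dead-no λ { (inj₁ z) → rq≢0 z ; (inj₂ ne) → ne (idempotent q) }

        dead′-b : dead r′ b ≈ 1#
        dead′-b = dead-yes (inj₂ λ eq → rp≢rq (≡.trans (≡.sym (redirect-at a b (idempotent q))) eq))

        -- Only b stops being a representative. A vertex that newly represented itself would have to
        -- be a with r a = b, but a already represents itself.
        dead′ : ∀ i → i ≢ b → dead r′ i ≈ dead r i
        dead′ i i≢b with i ≟ zero | r i ≟ i | r′ i ≟ i
        ... | yes _ | _ | _ = refl
        ... | no _ | yes _ | yes _ = refl
        ... | no _ | no _ | no _ = refl
        ... | no _ | yes ri≡i | no ne = contradiction (≡.trans (redirect-off a b (λ eq → i≢b (≡.trans (≡.sym ri≡i) eq))) ri≡i) ne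
        ... | no _ | no ri≢i | yes eq with r i ≟ b
        ...   | yes _ = contradiction (≡.trans (≡.cong r (≡.sym eq)) (≡.trans (idempotent p) eq)) ri≢i
        ...   | no  _ = contradiction eq ri≢i

        contracted-clear : ∀ L → contracted r′ L ≋ upd (clear (contracted r L)) b (δ b)
        contracted-clear L i j with i ≟ b
        ... | yes ≡.refl rewrite upd-same (clear (contracted r L)) b (δ b) =
          trans (+-cong (*-congʳ dead′-b) (gram-dead L j)) (trans (+-identityʳ _) (*-identityˡ _))
        ... | no i≢b rewrite upd-other (clear (contracted r L)) b (δ b) i≢b =
          trans (+-cong (*-congʳ (dead′ i i≢b)) (gram-clear L i j i≢b)) (trans combine (sym clear-contracted))
          where
          g = gram r L
          d = dead r i
          combine : d * δ i j + clear g i j ≈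
            d * δ i j + g i j + δ a i * (0# + g b j) + (0# + g i b + δ a i * (0# + g b b)) * δ a j
              - (0# + g i b + δ a i * (0# + g b b) + (0# + g i b + δ a i * (0# + g b b)) * δ a b) * δ b j
          combine = solve 9 (λ d gij gbj gib gbb ai aj ab bj →
            d :+ (gij :+ ai :* gbj :+ (gib :+ ai :* gbb) :* aj :- (gib :+ ai :* gbb :+ (gib :+ ai :* gbb) :* ab) :* bj)
            := d :+ gij :+ ai :* (:0 :+ gbj) :+ (:0 :+ gib :+ ai :* (:0 :+ gbb)) :* aj
              :- (:0 :+ gib :+ ai :* (:0 :+ gbb) :+ (:0 :+ gib :+ ai :* (:0 :+ gbb)) :* ab) :* bj)
            refl (d * δ i j) (g i j) (g b j) (g i b) (g b b) (δ a i) (δ a j) (δ a b) (δ b j)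
          row-b : ∀ k → contracted r L b k ≈ 0# + g b k
          row-b k = +-congʳ (trans (*-congʳ dead-b) (zeroˡ _))
          col-b : contracted r L i b ≈ 0# + g i b
          col-b = +-congʳ (trans (*-congˡ (reflexive (δ-≢ i≢b))) (zeroʳ _))
          sh : ∀ {k x} → contracted r L i k ≈ x → shear a b (contracted r L) i k ≈
            x + δ a i * (0# + g b k) + (0# + g i b + δ a i * (0# + g b b)) * δ a k
          sh {k} p = +-cong (+-cong p (*-congˡ (row-b k))) (*-congʳ (+-cong col-b (*-congˡ (row-b b))))
          clear-contracted : clear (contracted r L) i j ≈
            d * δ i j + g i j + δ a i * (0# + g b j) + (0# + g i b + δ a i * (0# + g b b)) * δ a j
              - (0# + g i b + δ a i * (0# + g b b) + (0# + g i b + δ a i * (0# + g b b)) * δ a b) * δ b j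
          clear-contracted = +-cong (sh refl) (-‿cong (*-congʳ (sh col-b)))

        det-contracted-∷ : ∀ L → det (contracted r (e ∷ L)) ≈ det (contracted r L) + w e * det (contracted r′ L)
        det-contracted-∷ L = begin
          det (contracted r (e ∷ L))
            ≈⟨ det-cong (λ i j → trans (sym (+-assoc _ _ _)) (+-congˡ (*-congˡ (orient e≡ i j)))) ⟩
          det (λ i j → contracted r L i j + w e * ((δ b i - δ a i) * (δ b j - δ a j)))
            ≈⟨ det-contract rp≢rq (contracted r L) (w e) ⟩
          det (contracted r L) + w e * det (upd (clear (contracted r L)) b (δ b))
            ≈⟨ +-congˡ (*-congˡ (sym (det-cong (contracted-clear L)))) ⟩
          det (contracted r L) + w e * det (contracted r′ L) ∎
          where
          orient : ∀ {e} → e ≡ (p , q) ⊎ e ≡ (q , p) → ∀ i j → incidence r e i * incidence r e j ≈ (δ b i - δ a i) * (δ b j - δ a j)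
          orient (inj₁ ≡.refl) i j = solve 4 (λ x y z w → (x :- y) :* (z :- w) := (y :- x) :* (w :- z)) refl (δ a i) (δ b i) (δ a j) (δ b j)
          orient (inj₂ ≡.refl) i j = refl

    -- Induction on the undecided edges. An edge inside a class is a loop: it adds nothing to the
    -- matrix, and choosing it closes a cycle. Any other edge satisfies the same recursion on both
    -- sides.
    det-contracted : ∀ L C r → Components C r → Acyclic C → det (contracted r L) ≈ trees C L
    det-contracted []      C r comp acyc = contracted-[] comp acyc
    det-contracted (e ∷ L) C r comp acyc with r (proj₁ e) ≟ r (proj₂ e)
    ... | yes same = begin
      det (contracted r (e ∷ L))
        ≈⟨ det-cong (λ i j → +-congˡ (trans (+-congˡ (loop i j)) (+-identityʳ _))) ⟩
      det (contracted r L)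
        ≈⟨ det-contracted L C r comp acyc ⟩
      trees C L
        ≈⟨ sym (trans (+-congˡ (trans (*-congˡ (trees-cyclic [] e C L (Components.complete comp same))) (zeroʳ _))) (+-identityʳ _)) ⟩
      trees C L + w e * trees (e ∷ C) L ∎
      where
      loop : ∀ i j → w e * (incidence r e i * incidence r e j) ≈ 0#
      loop i j rewrite same = solve 3 (λ c x y → c :* ((x :- x) :* (y :- y)) := :0) refl (w e) (δ (r (proj₂ e)) i) (δ (r (proj₂ e)) j)
    ... | no diff with r (proj₂ e) ≟ zero
    ... | no q≢0 = trans (det-contracted-∷ comp (inj₁ ≡.refl) diff q≢0 L)
        (+-cong (det-contracted L C r comp acyc) (*-congˡ (det-contracted L (e ∷ C) _ (Merge.merged comp (inj₁ ≡.refl) diff q≢0) acyc′)))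
      where
      acyc′ : Acyclic (e ∷ C)
      acyc′ = Acyclic-∷ acyc (diff ∘ Components.sound comp)
    -- The second endpoint lies in the class of zero, so the edge is used in the opposite
    -- orientation and the first endpoint is absorbed.
    ... | yes q≡0 = trans (det-contracted-∷ comp (inj₂ ≡.refl) (diff ∘ ≡.sym) p≢0 L)
        (+-cong (det-contracted L C r comp acyc) (*-congˡ (det-contracted L (e ∷ C) _ (Merge.merged comp (inj₂ ≡.refl) (diff ∘ ≡.sym) p≢0) acyc′)))
      where
      acyc′ : Acyclic (e ∷ C)
      acyc′ = Acyclic-∷ acyc (diff ∘ Components.sound comp)
      p≢0 : r (proj₁ e) ≢ zero
      p≢0 p≡0 = diff (≡.trans p≡0 (≡.sym q≡0))

    gram-sum : ∀ L i → sum (gram (λ v → v) L i) ≈ 0#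
    gram-sum []      i = sum-zero (λ _ → refl)
    gram-sum (e ∷ L) i = begin
      sum (λ j → gram (λ v → v) L i j + w e * (x i * x j))
        ≈⟨ sum-cong (λ j → +-congˡ (solve 4 (λ c y p q → c :* (y :* (p :- q)) := c :* y :* (p :* :1 :+ :- :1 :* (q :* :1))) refl (w e) (x i) (δ (proj₁ e) j) (δ (proj₂ e) j))) ⟩
      sum (λ j → gram (λ v → v) L i j + w e * x i * (δ (proj₁ e) j * 1# + - 1# * (δ (proj₂ e) j * 1#)))
        ≈⟨ sum-lin (w e * x i) (gram (λ v → v) L i) _ ⟩
      sum (gram (λ v → v) L i) + w e * x i * sum (λ j → δ (proj₁ e) j * 1# + - 1# * (δ (proj₂ e) j * 1#))
        ≈⟨ +-cong (gram-sum L i) (*-congˡ (trans (sum-lin (- 1#) (λ j → δ (proj₁ e) j * 1#) (λ j → δ (proj₂ e) j * 1#))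
             (+-cong (sum-δˡ (proj₁ e) (λ _ → 1#)) (*-congˡ (sum-δˡ (proj₂ e) (λ _ → 1#)))))) ⟩
      0# + w e * x i * (1# + - 1# * 1#)
        ≈⟨ solve 1 (λ y → :0 :+ y :* (:1 :+ :- :1 :* :1) := :0) refl (w e * x i) ⟩
      0# ∎
      where x = incidence (λ v → v) e

    -- The first row e₀ may be replaced by e₀ plus the first row of A, because A annihilates the
    -- all-ones vector and has determinant zero. The result is `contracted` for the partition into
    -- single vertices.
    matrix-tree : ∀ L → det′ (gram (λ v → v) L) ≈ trees [] L
    matrix-tree L = begin
      det (δ zero ∷ᵛ A ∘ suc)
        ≈⟨ sym (trans (+-congˡ (trans (*-congˡ (trans (sym (*-identityʳ _)) (det-kernel (A zero ∷ᵛ A ∘ suc) (λ _ → 1#) kernel zero))) (zeroʳ _))) (+-identityʳ _)) ⟩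
      det (δ zero ∷ᵛ A ∘ suc) + 1# * det (A zero ∷ᵛ A ∘ suc)
        ≈⟨ sym (lin₀ (detForm (suc m)) 1# (δ zero) (A zero) (A ∘ suc)) ⟩
      det ((λ j → δ zero j + 1# * A zero j) ∷ᵛ A ∘ suc)
        ≈⟨ det-cong rows ⟩
      det (contracted (λ v → v) L)
        ≈⟨ det-contracted L [] (λ v → v) Components-[] acyclic-[] ⟩
      trees [] L ∎
      where
      A = gram (λ v → v) L
      kernel : ∀ i → sum (λ k → (A zero ∷ᵛ A ∘ suc) i k * 1#) ≈ 0#
      kernel zero    = trans (sum-cong (λ k → *-identityʳ _)) (gram-sum L zero)
      kernel (suc i) = trans (sum-cong (λ k → *-identityʳ _)) (gram-sum L (suc i))
      rows : ((λ j → δ zero j + 1# * A zero j) ∷ᵛ A ∘ suc) ≋ contracted (λ v → v) L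
      rows zero    j = +-cong (sym (trans (*-congʳ (dead-yes {λ v → v} {zero} (inj₁ ≡.refl))) (*-identityˡ _))) (*-identityˡ _)
      rows (suc i) j = sym (trans (+-congʳ (trans (*-congʳ (dead-no {λ v → v} {suc i} λ { (inj₁ ()) ; (inj₂ ne) → ne ≡.refl })) (zeroˡ _))) (+-identityˡ _))
      acyclic-[] : Acyclic []
      acyclic-[] []       e ys () c
      acyclic-[] (_ ∷ xs) e ys () c

open MatrixTreeTheorem

-- The first cofactor of 1 - σ as the indicator of an n-cycle.

module CycleMatrices where

  open import Defs hiding (det)
  open import Data.Nat.Properties as ℕ using (≤-refl; <-trans; ≤-<-trans; <-irrefl; m<n⇒0<n∸m; m∸n≤m; m∸n+n≡m; <⇒≤; +-comm; n<1+n; ≮⇒≥; <-cmp)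
  open import Data.Fin.Properties using (toℕ<n; toℕ-injective; toℕ-fromℕ<; any?; ¬∀⟶∃¬; punchOut-injective; <⇒notInjective)
  open import Data.Fin.Permutation.Components using (transpose; transpose-inverse)
  open import Data.List using (List; []; _∷_; map; allFin; upTo; applyUpTo)
  open import Data.List.Properties using (map-upTo)
  open import Data.Bool.ListAction using (any)
  open import Data.List.Membership.Propositional.Properties using (∈-allFin; ∈-applyUpTo⁺; ∈-applyUpTo⁻)
  open import Data.Vec.Functional using () renaming (_∷_ to _∷ᵛ_)
  open import Relation.Binary.PropositionalEquality as ≡ using (_≡_; _≢_)

  open Equivalence using (to; from)

  private variable
    n m : ℕ
    X : Set

  Inj : (X → X) → Set
  Inj f = ∀ {x y} → f x ≡ f y → x ≡ y

  -- A missed value could be punched out of the codomain, which would leave an injection into a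
  -- smaller set.
  injective⇒surjective : ∀ {f : Fin n → Fin n} → Inj f → ∀ y → ∃ λ x → f x ≡ y
  injective⇒surjective {suc n} {f} inj y with any? (λ x → f x ≟ y)
  ... | yes p = p
  ... | no ¬p = contradiction
    (λ {a} {b} eq → inj {a} {b} (punchOut-injective (miss a) (miss b) eq))
    (<⇒notInjective {f = λ x → punchOut (miss x)} (n<1+n n))
    where
    miss : ∀ x → y ≢ f x
    miss x eq = ¬p (x , ≡.sym eq)

  iter-+ : ∀ a b (f : X → X) x → iter (a ℕ.+ b) f x ≡ iter a f (iter b f x)
  iter-+ zero    b f x = ≡.refl
  iter-+ (suc a) b f x = ≡.cong f (iter-+ a b f x)

  iter-comm : ∀ a b (f : X → X) x → iter a f (iter b f x) ≡ iter b f (iter a f x)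
  iter-comm a b f x = ≡.trans (≡.sym (iter-+ a b f x)) (≡.trans (≡.cong (λ k → iter k f x) (+-comm a b)) (iter-+ b a f x))

  iter-inj : ∀ {f : X → X} → Inj f → ∀ k → Inj (iter k f)
  iter-inj inj zero    eq = eq
  iter-inj inj (suc k) eq = iter-inj inj k (inj eq)

  iter-cancel : ∀ {f : X → X} → Inj f → ∀ {a b} x → a ≤ b → iter a f x ≡ iter b f x → iter (b ∸ a) f x ≡ x
  iter-cancel {f = f} inj {a} {b} x a≤b eq = iter-inj inj a (≡.trans (≡.sym (iter-+ a (b ∸ a) f x))
    (≡.trans (≡.cong (λ k → iter k f x) (≡.trans (+-comm a (b ∸ a)) (m∸n+n≡m a≤b))) (≡.sym eq)))

  NoRepeat : (ℕ → X) → ℕ → Set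
  NoRepeat f k = ∀ {a b} → a < b → b < k → f a ≢ f b

  distinct⁺ : ∀ (f : ℕ → Fin n) k → NoRepeat f k → T (distinct (applyUpTo f k))
  distinct⁺ f zero    p = _
  distinct⁺ f (suc k) p = from T-∧ (T-not repeat , distinct⁺ (f ∘ suc) k (λ a<b b<k → p (s≤s a<b) (s≤s b<k)))
    where
    repeat : T (any (λ y → does (f 0 ≟ y)) (applyUpTo (f ∘ suc) k)) → ⊥
    repeat t with any⁻ (λ y → does (f 0 ≟ y)) (applyUpTo (f ∘ suc) k) t
    ... | y , y∈ , d with ∈-applyUpTo⁻ (f ∘ suc) y∈
    ... | i , i<k , ≡.refl = p (s≤s z≤n) (s≤s i<k) (T-does {d = f 0 ≟ f (suc i)} d)

  distinct⁻ : ∀ (f : ℕ → Fin n) k → T (distinct (applyUpTo f k)) → NoRepeat f k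
  distinct⁻ f (suc k) t {zero}  {suc b} _ (s≤s b<k) eq =
    not-T (proj₁ (to T-∧ t)) (any⁺ (λ y → does (f 0 ≟ y)) (∈-applyUpTo⁺ (f ∘ suc) b<k) (does-T {d = f 0 ≟ f (suc b)} eq))
  distinct⁻ f (suc k) t {suc a} {suc b} (s≤s a<b) (s≤s b<k) eq = distinct⁻ (f ∘ suc) k (proj₂ (to (T-∧ {not _}) t)) a<b b<k eq

  isNCycle⁺ : ∀ (σ : Fin n → Fin n) x → NoRepeat (λ k → iter k σ x) n → isNCycle σ ≡ true
  isNCycle⁺ {n} σ x p = to T-≡ (any⁺ (λ x → distinct (map (λ k → iter k σ x) (upTo n))) (∈-allFin x)
    (≡.subst (T ∘ distinct) (≡.sym (map-upTo (λ k → iter k σ x) n)) (distinct⁺ (λ k → iter k σ x) n p)))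

  isNCycle⁻ : ∀ (σ : Fin n → Fin n) → isNCycle σ ≡ true → ∃ λ x → NoRepeat (λ k → iter k σ x) n
  isNCycle⁻ {n} σ eq with any⁻ (λ x → distinct (map (λ k → iter k σ x) (upTo n))) (allFin n) (from T-≡ eq)
  ... | x , _ , t = x , distinct⁻ (λ k → iter k σ x) n (≡.subst (T ∘ distinct) (map-upTo (λ k → iter k σ x) n) t)

  NoRepeat-inj : ∀ {f : ℕ → X} {k} → NoRepeat f k → ∀ {a b} → a < k → b < k → f a ≡ f b → a ≡ b
  NoRepeat-inj p {a} {b} a<k b<k eq with <-cmp a b
  ... | tri< a<b _ _ = contradiction eq (p a<b b<k)
  ... | tri≈ _ a≡b _ = a≡b
  ... | tri> _ _ b<a = contradiction (≡.sym eq) (p b<a a<k)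

  swap-inj : ∀ (t : Fin n × Fin n) → Inj (swap t)
  swap-inj (i , j) {x} {y} eq = ≡.trans (≡.sym (back x)) (≡.trans (≡.cong (transpose j i) eq) (back y))
    where
    back : ∀ x → transpose j i (transpose i j x) ≡ x
    back x = transpose-inverse j i

  module Orbit (σ : Fin (suc m) → Fin (suc m)) (σ-inj : Inj σ) where

    orbit : ℕ → Fin (suc m)
    orbit k = iter k σ zero

    -- In the first case pos i is the k < n with σ^(k+1) 0 = i, so that 0 comes last.
    data Shape : Set where
      cyclic : isNCycle σ ≡ true → (pos : Fin (suc m) → ℕ) → (∀ {i j} → pos i ≡ pos j → i ≡ j) → (∀ i → pos i < suc m) →
        (∀ i → i ≢ zero → pos i < pos (σ i)) → Shape
      periodic : isNCycle σ ≡ false → ∀ p → 0 < p → p < suc m → orbit p ≡ zero → Shape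

    module Cyclic (nr : NoRepeat orbit (suc m)) where
      -- The first n iterates exhaust all vertices, so σ^n(0) is among them. If it were σ^(k+1)(0),
      -- cancelling σ would produce a repetition among the first n.
      returns : orbit (suc m) ≡ zero
      returns with injective⇒surjective {f = λ k → orbit (toℕ k)} (λ {a} {b} eq → toℕ-injective (NoRepeat-inj nr (toℕ<n a) (toℕ<n b) eq)) (orbit (suc m))
      ... | zero , eq = ≡.sym eq
      ... | suc k , eq = contradiction (σ-inj eq) (nr (toℕ<n k) (n<1+n m))

      orbit⁺ : Fin (suc m) → Fin (suc m)
      orbit⁺ k = orbit (suc (toℕ k))

      orbit⁺-inj : Inj orbit⁺
      orbit⁺-inj {a} {b} eq = toℕ-injective (NoRepeat-inj nr (toℕ<n a) (toℕ<n b) (σ-inj eq))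

      preimage : ∀ i → ∃ λ k → orbit⁺ k ≡ i
      preimage = injective⇒surjective orbit⁺-inj

      pos : Fin (suc m) → ℕ
      pos i = toℕ (proj₁ (preimage i))

      pos-orbit : ∀ i → orbit (suc (pos i)) ≡ i
      pos-orbit i = proj₂ (preimage i)

      -- A vertex in last position is σ^n(0), which is zero; from every other position σ moves on to
      -- the next.
      pos-σ : ∀ i → i ≢ zero → pos i < pos (σ i)
      pos-σ i i≢0 with suc (pos i) <? suc m
      ... | yes lt = ≡.subst (pos i <_) (NoRepeat-inj nr lt (toℕ<n (proj₁ (preimage (σ i))))
            (σ-inj (≡.trans (≡.cong σ (pos-orbit i)) (≡.sym (pos-orbit (σ i)))))) (n<1+n (pos i))
      ... | no ≮ = contradiction (≡.trans (≡.sym (pos-orbit i)) (≡.trans (≡.cong orbit last) returns)) i≢0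
        where
        last : suc (pos i) ≡ suc m
        last = ℕ.≤-antisym (toℕ<n (proj₁ (preimage i))) (≮⇒≥ ≮)

      shape : Shape
      shape = cyclic (isNCycle⁺ σ zero nr) pos (λ {i} {j} eq → ≡.trans (≡.sym (pos-orbit i)) (≡.trans (≡.cong (λ k → orbit (suc k)) eq) (pos-orbit j)))
        (λ i → toℕ<n (proj₁ (preimage i))) pos-σ

    -- `isNCycle` allows any starting point x. Zero is σ^k(x) for some k, so the iterates of zero
    -- are the images of those of x under the injective map σ^k.
    NoRepeat-zero : ∀ {x} → NoRepeat (λ k → iter k σ x) (suc m) → NoRepeat orbit (suc m)
    NoRepeat-zero {x} nr {a} {b} a<b b<n eq
      with injective⇒surjective {f = λ k → iter (toℕ k) σ x} (λ {a} {b} eq → toℕ-injective (NoRepeat-inj nr (toℕ<n a) (toℕ<n b) eq)) zero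
    ... | k , eq₀ = nr a<b b<n (iter-inj σ-inj (toℕ k) (≡.trans (move a) (≡.trans eq (≡.sym (move b)))))
      where
      move : ∀ c → iter (toℕ k) σ (iter c σ x) ≡ orbit c
      move c = ≡.trans (iter-comm (toℕ k) c σ x) (≡.cong (iter c σ) eq₀)

    shape : Shape
    shape with isNCycle σ in eq
    ... | true  = Cyclic.shape (NoRepeat-zero (proj₂ (isNCycle⁻ σ eq)))
    ... | false with any? (λ p → any? (λ q → (toℕ p <? toℕ q) ×-dec (orbit (toℕ p) ≟ orbit (toℕ q))))
      where open import Relation.Nullary.Decidable using (_×-dec_)
    ... | yes (p , q , p<q , same) = periodic eq (toℕ q ∸ toℕ p) (m<n⇒0<n∸m p<q)
          (≤-<-trans (m∸n≤m (toℕ q) (toℕ p)) (toℕ<n q)) (iter-cancel σ-inj zero (<⇒≤ p<q) same)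
    ... | no none = contradiction (≡.trans (≡.sym eq) (isNCycle⁺ σ zero nr)) (λ ())
      where
      nr : NoRepeat orbit (suc m)
      nr {a} {b} a<b b<n same = none (fromℕ< (<-trans a<b b<n) , fromℕ< b<n ,
        ≡.subst₂ _<_ (≡.sym (toℕ-fromℕ< (<-trans a<b b<n))) (≡.sym (toℕ-fromℕ< b<n)) a<b ,
        ≡.subst₂ (λ x y → orbit x ≡ orbit y) (≡.sym (toℕ-fromℕ< (<-trans a<b b<n))) (≡.sym (toℕ-fromℕ< b<n)) same)

  module CycleDeterminant (R : CommutativeRing 0ℓ 0ℓ) where
    open CommutativeRing R hiding (zero)
    open Determinant R
    open RingSolver R
    open import Relation.Binary.Reasoning.Setoid setoid

    -- The rows of 1 + N are switched on in the order of `pos`. When row i is switched on, its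
    -- entries of N lie in columns whose rows are still unit vectors, so the new row is a
    -- combination of present rows in which row i itself has coefficient 1.
    det-unitriangular : ∀ (N : Matrix n n) (pos : Fin n → ℕ) {K} → (∀ i → pos i < K) → (∀ {i j} → pos i ≡ pos j → i ≡ j) →
      (∀ i j → ¬ pos i < pos j → N i j ≈ 0#) → det (λ i j → δ i j + N i j) ≈ 1#
    det-unitriangular {n} N pos {K} pos<K pos-inj N≈0 = trans (det-cong (full K pos<K)) (partial-det K)
      where
      partial : ℕ → Matrix n n
      partial k i j with pos i <? k
      ... | yes _ = δ i j + N i j
      ... | no  _ = δ i j

      partial-yes : ∀ k {i} → pos i < k → ∀ j → partial k i j ≈ δ i j + N i j
      partial-yes k {i} lt j with pos i <? k
      ... | yes _ = refl
      ... | no ≮ = contradiction lt ≮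

      partial-no : ∀ k {i} → ¬ pos i < k → ∀ j → partial k i j ≈ δ i j
      partial-no k {i} ≮ j with pos i <? k
      ... | yes lt = contradiction lt ≮
      ... | no _ = refl

      full : ∀ k → (∀ i → pos i < k) → (λ i j → δ i j + N i j) ≋ partial k
      full k p i j = sym (partial-yes k (p i) j)

      widen : ∀ k i → pos i ≢ k → ∀ j → partial (suc k) i j ≈ partial k i j
      widen k i ≢k j with pos i <? k
      ... | yes lt = partial-yes (suc k) (ℕ.m≤n⇒m≤1+n lt) j
      ... | no ≮ = partial-no (suc k) (λ { (s≤s le) → ≮ (ℕ.≤∧≢⇒< le ≢k) }) j

      partial-det : ∀ k → det (partial k) ≈ 1#
      partial-det zero    = trans (det-cong (λ i j → partial-no zero {i} (λ ()) j)) (det-δ n)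
      partial-det (suc k) with any? (λ i → pos i ℕ.≟ k)
      ... | no none = trans (det-cong (λ i j → widen k i (λ eq → none (i , eq)) j)) (partial-det k)
      ... | yes (i , eq) = begin
        det (partial (suc k))
          ≈⟨ det-cong rows ⟩
        det (upd (partial k) i (λ j → sum (λ l → c l * partial k l j)))
          ≈⟨ det-upd-combination (partial k) i c ⟩
        c i * det (partial k)
          ≈⟨ *-cong (trans (+-cong (reflexive (δ-refl i)) (N≈0 i i (<-irrefl ≡.refl))) (+-identityʳ _)) (partial-det k) ⟩
        1# * 1#
          ≈⟨ *-identityˡ _ ⟩
        1# ∎
        where
        c : Vect n
        c l = δ i l + N i l
        -- Rows already switched on come before i, so their coefficient in row i is 0 and they may
        -- be replaced by unit vectors.
        term : ∀ l j → c l * partial k l j ≈ c l * δ l j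
        term l j with pos l <? k
        ... | no _ = refl
        ... | yes lt = trans (*-congʳ cl) (trans (zeroˡ _) (sym (trans (*-congʳ cl) (zeroˡ _))))
          where
          cl : c l ≈ 0#
          cl = trans (+-cong (reflexive (δ-≢ {i = i} {j = l} (λ { ≡.refl → <-irrefl eq lt }))) (N≈0 i l (λ lt′ → <-irrefl ≡.refl (<-trans (≡.subst (pos l <_) (≡.sym eq) lt) lt′)))) (+-identityʳ _)
        rows : partial (suc k) ≋ upd (partial k) i (λ j → sum (λ l → c l * partial k l j))
        rows h j with h ≟ i
        ... | yes ≡.refl rewrite upd-same (partial k) i (λ j → sum (λ l → c l * partial k l j)) =
          trans (partial-yes (suc k) (≡.subst (_< suc k) (≡.sym eq) ≤-refl) j) (sym (trans (sum-cong (λ l → term l j)) (sum-δʳ j c)))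
        ... | no h≢i rewrite upd-other (partial k) i (λ j → sum (λ l → c l * partial k l j)) h≢i =
          widen k h (λ eq′ → h≢i (pos-inj (≡.trans eq′ (≡.sym eq)))) j

    cycleMatrix : (Fin (suc m) → Fin (suc m)) → Matrix (suc m) (suc m)
    cycleMatrix σ zero    j = δ zero j
    cycleMatrix σ (suc i) j = δ (suc i) j - δ (σ (suc i)) j

    -- For an n-cycle the matrix is unitriangular in the order of `pos`. Otherwise the orbit of zero
    -- misses a vertex, and the indicator of the complement of that orbit is a kernel vector: it is
    -- invariant under σ, vanishes at zero and is 1 at the missed vertex.
    det-cycleMatrix : ∀ (σ : Fin (suc m) → Fin (suc m)) → Inj σ → det (cycleMatrix σ) ≈ (if isNCycle σ then 1# else 0#)
    det-cycleMatrix {m} σ σ-inj with Orbit.shape σ σ-inj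
    ... | Orbit.cyclic eq pos pos-inj pos< pos-σ rewrite eq = trans (det-cong rows) (det-unitriangular N pos pos< pos-inj N≈0)
      where
      N : Matrix (suc m) (suc m)
      N zero    j = 0#
      N (suc i) j = - δ (σ (suc i)) j
      rows : cycleMatrix σ ≋ (λ i j → δ i j + N i j)
      rows zero    j = sym (+-identityʳ _)
      rows (suc i) j = refl
      N≈0 : ∀ i j → ¬ pos i < pos j → N i j ≈ 0#
      N≈0 zero    j ≮ = refl
      N≈0 (suc i) j ≮ = trans (-‿cong (reflexive (δ-≢ {i = σ (suc i)} {j = j} (λ { ≡.refl → ≮ (pos-σ (suc i) (λ ())) })))) (solve 0 (:- :0 := :0) refl)
    ... | Orbit.periodic eq (suc p) 0<p p<n return rewrite eq with ¬∀⟶∃¬ (suc m) Hit hit? ¬all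
      where
      open Orbit σ σ-inj
      Hit : Fin (suc m) → Set
      Hit i = ∃ λ (k : Fin (suc p)) → orbit (toℕ k) ≡ i
      hit? : ∀ i → Dec (Hit i)
      hit? i = any? (λ k → orbit (toℕ k) ≟ i)
      ¬all : ¬ (∀ i → Hit i)
      ¬all all = <⇒notInjective {f = λ i → proj₁ (all i)} p<n
        (λ {i} {j} eq → ≡.trans (≡.sym (proj₂ (all i))) (≡.trans (≡.cong (λ k → orbit (toℕ k)) eq) (proj₂ (all j))))
    ... | i , missed = begin
      det (cycleMatrix σ)
        ≈⟨ sym (*-identityʳ _) ⟩
      det (cycleMatrix σ) * 1#
        ≈⟨ *-congˡ (sym (x-missed missed)) ⟩
      det (cycleMatrix σ) * x i
        ≈⟨ det-kernel (cycleMatrix σ) x kernel i ⟩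
      0# ∎
      where
      open Orbit σ σ-inj
      Hit : Fin (suc m) → Set
      Hit i = ∃ λ (k : Fin (suc p)) → orbit (toℕ k) ≡ i
      hit? : ∀ i → Dec (Hit i)
      hit? i = any? (λ k → orbit (toℕ k) ≟ i)
      x : Vect (suc m)
      x i with hit? i
      ... | yes _ = 0#
      ... | no  _ = 1#
      x-missed : ∀ {i} → ¬ Hit i → x i ≈ 1#
      x-missed {i} ¬h with hit? i
      ... | yes h = contradiction h ¬h
      ... | no _ = refl
      x-hit : ∀ {i} → Hit i → x i ≈ 0#
      x-hit {i} h with hit? i
      ... | yes _ = refl
      ... | no ¬h = contradiction h ¬h
      hit-suc : ∀ i → Hit i → Hit (σ i)
      hit-suc i (k , ≡.refl) with suc (toℕ k) <? suc p
      ... | yes lt = fromℕ< lt , ≡.cong orbit (toℕ-fromℕ< lt)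
      ... | no ≮ = zero , ≡.trans (≡.sym return) (≡.cong orbit (ℕ.≤-antisym (≮⇒≥ ≮) (toℕ<n k)))
      hit-pred : ∀ i → Hit (σ i) → Hit i
      hit-pred i (zero , eq) = fromℕ< (n<1+n p) , σ-inj (≡.trans (≡.cong (σ ∘ orbit) (toℕ-fromℕ< (n<1+n p))) (≡.trans return eq))
      hit-pred i (suc k , eq) = fromℕ< (ℕ.m≤n⇒m≤1+n (toℕ<n k)) , σ-inj (≡.trans (≡.cong (σ ∘ orbit) (toℕ-fromℕ< (ℕ.m≤n⇒m≤1+n (toℕ<n k)))) eq)
      x-σ : ∀ i → x i ≈ x (σ i)
      x-σ i with hit? i
      ... | yes h = sym (x-hit (hit-suc i h))
      ... | no ¬h = sym (x-missed (¬h ∘ hit-pred i))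
      kernel : ∀ i → sum (λ k → cycleMatrix σ i k * x k) ≈ 0#
      kernel zero = trans (sum-δˡ zero x) (x-hit (zero , ≡.refl))
      kernel (suc i) = begin
        sum (λ k → (δ (suc i) k - δ (σ (suc i)) k) * x k)
          ≈⟨ sum-cong (λ k → solve 3 (λ a b x → (a :- b) :* x := a :* x :+ :- :1 :* (b :* x)) refl (δ (suc i) k) (δ (σ (suc i)) k) (x k)) ⟩
        sum (λ k → δ (suc i) k * x k + - 1# * (δ (σ (suc i)) k * x k))
          ≈⟨ sum-lin (- 1#) (λ k → δ (suc i) k * x k) (λ k → δ (σ (suc i)) k * x k) ⟩
        sum (λ k → δ (suc i) k * x k) + - 1# * sum (λ k → δ (σ (suc i)) k * x k)
          ≈⟨ +-cong (sum-δˡ (suc i) x) (*-congˡ (sum-δˡ (σ (suc i)) x)) ⟩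
        x (suc i) + - 1# * x (σ (suc i))
          ≈⟨ +-congʳ (x-σ (suc i)) ⟩
        x (σ (suc i)) + - 1# * x (σ (suc i))
          ≈⟨ solve 1 (λ x → x :+ :- :1 :* x := :0) refl (x (σ (suc i))) ⟩
        0# ∎

open CycleMatrices

-- The commutative ring of polynomials, compared by coefficients.

module PolynomialRings where

  open import Defs hiding (det)
  import Data.Nat.Properties as ℕ
  import Data.Rational.Properties as ℚ
  open import Data.List using ([]; _∷_; _++_; map; allFin)
  open import Data.List.Properties using (concatMap-++; map-++; ++-identityʳ)
  import Data.List.Relation.Unary.All as All
  import Data.List.Relation.Unary.All.Properties as All
  open import Data.List.Membership.Propositional.Properties using (∈-allFin)
  open import Relation.Binary.PropositionalEquality using (_≡_; refl; sym; trans; cong; cong₂; module ≡-Reasoning)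

  open Equivalence using (to; from)

  private variable
    n : ℕ

  infix 4 _≐_
  _≐_ : Mono n → Mono n → Set
  m ≐ m' = ∀ i j → m i j ≡ m' i j

  monoEq⁺ : ∀ (m m' : Mono n) → m ≐ m' → monoEq m m' ≡ true
  monoEq⁺ {n} m m' p = to T-≡ (All.all⁻ _ (All.universal (λ i → All.all⁻ _ (All.universal (λ j → ℕ.≡⇒≡ᵇ _ _ (p i j)) (allFin n))) (allFin n)))

  monoEq⁻ : ∀ (m m' : Mono n) → monoEq m m' ≡ true → m ≐ m'
  monoEq⁻ {n} m m' eq i j = ℕ.≡ᵇ⇒≡ _ _ (All.lookup (All.all⁺ _ (allFin n) (All.lookup (All.all⁺ _ (allFin n) (from T-≡ eq)) (∈-allFin i))) (∈-allFin j))

  Bool-ext : ∀ {a b : Bool} → (a ≡ true → b ≡ true) → (b ≡ true → a ≡ true) → a ≡ b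
  Bool-ext {true}  {b}     f g = sym (f refl)
  Bool-ext {false} {false} f g = refl
  Bool-ext {false} {true}  f g = g refl

  monoEq-cong : ∀ (m₁ m₂ m₃ m₄ : Mono n) → (m₁ ≐ m₂ → m₃ ≐ m₄) → (m₃ ≐ m₄ → m₁ ≐ m₂) → monoEq m₁ m₂ ≡ monoEq m₃ m₄
  monoEq-cong m₁ m₂ m₃ m₄ f g = Bool-ext (λ e → monoEq⁺ m₃ m₄ (f (monoEq⁻ m₁ m₂ e))) (λ e → monoEq⁺ m₁ m₂ (g (monoEq⁻ m₃ m₄ e)))

  coeff-++ : ∀ (p q : Poly n) m → coeff (p ++ q) m ≡ coeff p m ℚ.+ coeff q m
  coeff-++ []            q m = sym (ℚ.+-identityˡ _)
  coeff-++ ((c , k) ∷ p) q m = trans (cong (h ℚ.+_) (coeff-++ p q m)) (sym (ℚ.+-assoc h (coeff p m) (coeff q m)))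
    where h = if monoEq k m then c else 0ℚ

  if-* : ∀ c (b : Bool) x → (if b then c ℚ.* x else 0ℚ) ≡ c ℚ.* (if b then x else 0ℚ)
  if-* c true  x = refl
  if-* c false x = sym (ℚ.*-zeroʳ c)

  coeff-scale : ∀ c (p : Poly n) m → coeff (scaleₚ c p) m ≡ c ℚ.* coeff p m
  coeff-scale c []            m = sym (ℚ.*-zeroʳ c)
  coeff-scale c ((d , k) ∷ p) m = trans (cong₂ ℚ._+_ (if-* c (monoEq k m) d) (coeff-scale c p m)) (sym (ℚ.*-distribˡ-+ c (if monoEq k m then d else 0ℚ) (coeff p m)))

  Term : ℕ → Set
  Term n = ℚ × Mono n

  infixr 8 _·_
  _·_ : Term n → Poly n → Poly n
  s · q = map (λ t → (proj₁ s ℚ.* proj₁ t , monoMul (proj₂ s) (proj₂ t))) q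

  quotient : Mono n → Mono n → Mono n
  quotient m k i j = m i j ℕ.∸ k i j

  -- Multiplication by a monomial k shifts coefficients. The exponents of `quotient` are truncated
  -- differences, so divisibility is tested by multiplying back.
  coeff-· : ∀ c (k : Mono n) q m →
    coeff ((c , k) · q) m ≡ (if monoEq (monoMul k (quotient m k)) m then c ℚ.* coeff q (quotient m k) else 0ℚ)
  coeff-· c k [] m with monoEq (monoMul k (quotient m k)) m
  ... | true  = sym (ℚ.*-zeroʳ c)
  ... | false = refl
  coeff-· c k ((d , l) ∷ q) m with monoEq (monoMul k (quotient m k)) m in eq | coeff-· c k q m
  ... | true  | ih = begin
    (if monoEq (monoMul k l) m then c ℚ.* d else 0ℚ) ℚ.+ coeff ((c , k) · q) m
      ≡⟨ cong₂ (λ b x → (if b then c ℚ.* d else 0ℚ) ℚ.+ x) same ih ⟩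
    (if monoEq l (quotient m k) then c ℚ.* d else 0ℚ) ℚ.+ c ℚ.* coeff q (quotient m k)
      ≡⟨ cong (ℚ._+ c ℚ.* coeff q (quotient m k)) (if-* c (monoEq l (quotient m k)) d) ⟩
    c ℚ.* (if monoEq l (quotient m k) then d else 0ℚ) ℚ.+ c ℚ.* coeff q (quotient m k)
      ≡⟨ sym (ℚ.*-distribˡ-+ c (if monoEq l (quotient m k) then d else 0ℚ) (coeff q (quotient m k))) ⟩
    c ℚ.* coeff ((d , l) ∷ q) (quotient m k) ∎
    where
    open ≡-Reasoning
    same : monoEq (monoMul k l) m ≡ monoEq l (quotient m k)
    same = monoEq-cong (monoMul k l) m l (quotient m k)
      (λ e i j → trans (sym (ℕ.m+n∸m≡n (k i j) (l i j))) (cong (ℕ._∸ k i j) (e i j)))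
      (λ e i j → trans (cong (k i j ℕ.+_) (e i j)) (monoEq⁻ (monoMul k (quotient m k)) m eq i j))
  ... | false | ih = cong₂ (λ b x → (if b then c ℚ.* d else 0ℚ) ℚ.+ x) differ ih
    where
    differ : monoEq (monoMul k l) m ≡ false
    differ with monoEq (monoMul k l) m in eq′
    ... | false = refl
    ... | true  = contradiction (trans (sym eq) (monoEq⁺ (monoMul k (quotient m k)) m λ i j →
      trans (cong (k i j ℕ.+_) (trans (cong (ℕ._∸ k i j) (sym (monoEq⁻ (monoMul k l) m eq′ i j))) (ℕ.m+n∸m≡n (k i j) (l i j)))) (monoEq⁻ (monoMul k l) m eq′ i j))) λ ()

  infix 4 _≋ₚ_
  -- Coefficientwise equality is wrapped in a record because `≈ₚ` unfolds to a function type, from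
  -- which p and q cannot be inferred.
  record _≋ₚ_ (p q : Poly n) : Set where
    constructor mk
    field coeffs : p ≈ₚ q
  open _≋ₚ_ public

  ≋-refl : ∀ {p : Poly n} → p ≋ₚ p
  ≋-refl = mk λ _ → refl

  ≋-sym : ∀ {p q : Poly n} → p ≋ₚ q → q ≋ₚ p
  ≋-sym e = mk λ m → sym (coeffs e m)

  ≋-trans : ∀ {p q r : Poly n} → p ≋ₚ q → q ≋ₚ r → p ≋ₚ r
  ≋-trans e f = mk λ m → trans (coeffs e m) (coeffs f m)

  ≋-reflexive : ∀ {p q : Poly n} → p ≡ q → p ≋ₚ q
  ≋-reflexive refl = ≋-refl

  +ₚ-cong : ∀ {p p' q q' : Poly n} → p ≋ₚ p' → q ≋ₚ q' → p ++ q ≋ₚ p' ++ q'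
  +ₚ-cong {p = p} {p'} {q} {q'} e f = mk λ m → trans (coeff-++ p q m) (trans (cong₂ ℚ._+_ (coeffs e m) (coeffs f m)) (sym (coeff-++ p' q' m)))

  +ₚ-comm : ∀ (p q : Poly n) → p ++ q ≋ₚ q ++ p
  +ₚ-comm p q = mk λ m → trans (coeff-++ p q m) (trans (ℚ.+-comm (coeff p m) (coeff q m)) (sym (coeff-++ q p m)))

  +ₚ-assoc : ∀ (p q r : Poly n) → (p ++ q) ++ r ≋ₚ p ++ (q ++ r)
  +ₚ-assoc p q r = ≋-reflexive (Data.List.Properties.++-assoc p q r)
    where import Data.List.Properties

  scale-cong : ∀ {c d} {p q : Poly n} → c ≡ d → p ≋ₚ q → scaleₚ c p ≋ₚ scaleₚ d q
  scale-cong {c = c} {p = p} {q} refl e = mk λ m → trans (coeff-scale c p m) (trans (cong (c ℚ.*_) (coeffs e m)) (sym (coeff-scale c q m)))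

  +ₚ-inverseˡ : ∀ (p : Poly n) → (-ₚ p) ++ p ≋ₚ []
  +ₚ-inverseˡ p = mk λ m → begin
    coeff ((-ₚ p) ++ p) m                      ≡⟨ coeff-++ (-ₚ p) p m ⟩
    coeff (-ₚ p) m ℚ.+ coeff p m               ≡⟨ cong (ℚ._+ coeff p m) (trans (coeff-scale (ℚ.- 1ℚ) p m)
                                                   (trans (sym (ℚ.neg-distribˡ-* 1ℚ (coeff p m))) (cong ℚ.-_ (ℚ.*-identityˡ (coeff p m))))) ⟩
    ℚ.- coeff p m ℚ.+ coeff p m                ≡⟨ ℚ.+-inverseˡ (coeff p m) ⟩
    0ℚ                                         ∎
    where open ≡-Reasoning

  term-cong : ∀ {c d} {k l : Mono n} {p q : Poly n} → c ≡ d → k ≐ l → p ≋ₚ q → (c , k) ∷ p ≋ₚ (d , l) ∷ q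
  term-cong {c = c} {k = k} {l} refl e f = mk λ m → cong₂ (λ b x → (if b then c else 0ℚ) ℚ.+ x)
    (monoEq-cong k m l m (λ h i j → trans (sym (e i j)) (h i j)) (λ h i j → trans (e i j) (h i j))) (coeffs f m)

  ·-cong : ∀ (s : Term n) {p q} → p ≋ₚ q → s · p ≋ₚ s · q
  ·-cong (c , k) {p} {q} e = mk λ m → trans (coeff-· c k p m)
    (trans (cong (λ x → if monoEq (monoMul k (quotient m k)) m then c ℚ.* x else 0ℚ) (coeffs e (quotient m k))) (sym (coeff-· c k q m)))

  *ₚ-congˡ : ∀ (p : Poly n) {q q'} → q ≋ₚ q' → p *ₚ q ≋ₚ p *ₚ q'
  *ₚ-congˡ []      e = ≋-refl
  *ₚ-congˡ (s ∷ p) e = +ₚ-cong (·-cong s e) (*ₚ-congˡ p e)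

  *ₚ-zeroʳ : ∀ (p : Poly n) → p *ₚ [] ≋ₚ []
  *ₚ-zeroʳ []      = ≋-refl
  *ₚ-zeroʳ (s ∷ p) = *ₚ-zeroʳ p

  +ₚ-swap : ∀ (p q r : Poly n) → p ++ (q ++ r) ≋ₚ q ++ (p ++ r)
  +ₚ-swap p q r = ≋-trans (≋-sym (+ₚ-assoc p q r)) (≋-trans (+ₚ-cong (+ₚ-comm p q) ≋-refl) (+ₚ-assoc q p r))

  -- The product is defined by recursion on its left factor; this is the matching expansion in the
  -- right factor, from which commutativity follows.
  *ₚ-∷ : ∀ (q : Poly n) s p → q *ₚ (s ∷ p) ≋ₚ s · q ++ q *ₚ p
  *ₚ-∷ []      s p = ≋-refl
  *ₚ-∷ (t ∷ q) s p = term-cong (ℚ.*-comm (proj₁ t) (proj₁ s)) (λ i j → ℕ.+-comm (proj₂ t i j) (proj₂ s i j))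
    (≋-trans (+ₚ-cong {p = t · p} ≋-refl (*ₚ-∷ q s p)) (+ₚ-swap (t · p) (s · q) (q *ₚ p)))

  *ₚ-comm : ∀ (p q : Poly n) → p *ₚ q ≋ₚ q *ₚ p
  *ₚ-comm []      q = ≋-sym (*ₚ-zeroʳ q)
  *ₚ-comm (s ∷ p) q = ≋-trans (+ₚ-cong {p = s · q} ≋-refl (*ₚ-comm p q)) (≋-sym (*ₚ-∷ q s p))

  *ₚ-distribʳ : ∀ (r p q : Poly n) → (p ++ q) *ₚ r ≋ₚ p *ₚ r ++ q *ₚ r
  *ₚ-distribʳ r p q = ≋-reflexive (concatMap-++ (_· r) p q)

  *ₚ-distribˡ : ∀ (r p q : Poly n) → r *ₚ (p ++ q) ≋ₚ r *ₚ p ++ r *ₚ q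
  *ₚ-distribˡ r p q = ≋-trans (*ₚ-comm r (p ++ q)) (≋-trans (*ₚ-distribʳ r p q) (+ₚ-cong (*ₚ-comm p r) (*ₚ-comm q r)))

  ·-assoc : ∀ (s t : Term n) r → ((proj₁ s ℚ.* proj₁ t , monoMul (proj₂ s) (proj₂ t))) · r ≋ₚ s · (t · r)
  ·-assoc s t []      = ≋-refl
  ·-assoc s t (u ∷ r) = term-cong (ℚ.*-assoc (proj₁ s) (proj₁ t) (proj₁ u)) (λ i j → ℕ.+-assoc (proj₂ s i j) (proj₂ t i j) (proj₂ u i j)) (·-assoc s t r)

  ·-* : ∀ (s : Term n) q r → (s · q) *ₚ r ≋ₚ s · (q *ₚ r)
  ·-* s []      r = ≋-refl
  ·-* s (t ∷ q) r = ≋-trans (+ₚ-cong (·-assoc s t r) (·-* s q r)) (≋-reflexive (sym (map-++ _ (t · r) (q *ₚ r))))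

  *ₚ-assoc : ∀ (p q r : Poly n) → (p *ₚ q) *ₚ r ≋ₚ p *ₚ (q *ₚ r)
  *ₚ-assoc []      q r = ≋-refl
  *ₚ-assoc (s ∷ p) q r = ≋-trans (*ₚ-distribʳ r (s · q) (p *ₚ q)) (+ₚ-cong (·-* s q r) (*ₚ-assoc p q r))

  *ₚ-identityˡ : ∀ (p : Poly n) → 1ₚ *ₚ p ≋ₚ p
  *ₚ-identityˡ p = ≋-trans (≋-reflexive (++-identityʳ _)) (go p)
    where
    go : ∀ p → (1ℚ , monoOne) · p ≋ₚ p
    go []      = ≋-refl
    go (t ∷ p) = term-cong (ℚ.*-identityˡ (proj₁ t)) (λ _ _ → refl) (go p)

  polyRing : ℕ → CommutativeRing 0ℓ 0ℓ
  polyRing n = record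
    { Carrier = Poly n ; _≈_ = _≋ₚ_ ; _+_ = _+ₚ_ ; _*_ = _*ₚ_ ; -_ = -ₚ_ ; 0# = 0ₚ ; 1# = 1ₚ
    ; isCommutativeRing = record
      { isRing = record
        { +-isAbelianGroup = record
          { isGroup = record
            { isMonoid = record
              { isSemigroup = record
                { isMagma = record
                  { isEquivalence = record { refl = ≋-refl ; sym = ≋-sym ; trans = ≋-trans }
                  ; ∙-cong = +ₚ-cong }
                ; assoc = +ₚ-assoc }
              ; identity = (λ p → ≋-refl) , (λ p → ≋-reflexive (++-identityʳ p)) }
            ; inverse = +ₚ-inverseˡ , (λ p → ≋-trans (+ₚ-comm p (-ₚ p)) (+ₚ-inverseˡ p))
            ; ⁻¹-cong = scale-cong {c = ℚ.- 1ℚ} refl }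
          ; comm = +ₚ-comm }
        ; *-cong = λ {p} {p'} {q} {q'} e f → ≋-trans (*ₚ-congˡ p f) (≋-trans (*ₚ-comm p q') (≋-trans (*ₚ-congˡ q' e) (*ₚ-comm q' p')))
        ; *-assoc = *ₚ-assoc
        ; *-identity = *ₚ-identityˡ , (λ p → ≋-trans (*ₚ-comm p 1ₚ) (*ₚ-identityˡ p))
        ; distrib = *ₚ-distribˡ , *ₚ-distribʳ }
      ; *-comm = *ₚ-comm } }

  scale-const : ∀ c (p : Poly n) → scaleₚ c p ≋ₚ constₚ c *ₚ p
  scale-const c []      = ≋-refl
  scale-const c (t ∷ p) = term-cong refl (λ _ _ → refl) (scale-const c p)

  const-* : ∀ c d → constₚ {n} (c ℚ.* d) ≋ₚ constₚ c *ₚ constₚ d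
  const-* c d = term-cong refl (λ _ _ → refl) ≋-refl

  const-+ : ∀ c d → constₚ {n} (c ℚ.+ d) ≋ₚ constₚ c +ₚ constₚ d
  const-+ {n} c d = mk λ m → split (monoEq monoOne m)
    where
    split : ∀ b → (if b then c ℚ.+ d else 0ℚ) ℚ.+ 0ℚ ≡ (if b then c else 0ℚ) ℚ.+ ((if b then d else 0ℚ) ℚ.+ 0ℚ)
    split true  = ℚ.+-assoc c d 0ℚ
    split false = refl

open PolynomialRings

-- From sums over indices to sums over lists of transpositions and edges.

module TranspositionLists where

  open import Defs hiding (det)
  open import Data.List using (List; []; _∷_; _++_; map; concatMap; length; lookup; _ʳ++_)
  import Relation.Binary.PropositionalEquality as ≡

  private variable
    n m : ℕ
    X Y : Set

  module ListSum (R : CommutativeRing 0ℓ 0ℓ) where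
    open CommutativeRing R hiding (zero)
    open Determinant R

    Σᴸ : (X → Carrier) → List X → Carrier
    Σᴸ f []       = 0#
    Σᴸ f (x ∷ xs) = f x + Σᴸ f xs

    Σᴸ-cong : ∀ {f g : X → Carrier} → (∀ x → f x ≈ g x) → ∀ xs → Σᴸ f xs ≈ Σᴸ g xs
    Σᴸ-cong p []       = refl
    Σᴸ-cong p (x ∷ xs) = +-cong (p x) (Σᴸ-cong p xs)

    Σᴸ-++ : ∀ (f : X → Carrier) xs ys → Σᴸ f (xs ++ ys) ≈ Σᴸ f xs + Σᴸ f ys
    Σᴸ-++ f []       ys = sym (+-identityˡ _)
    Σᴸ-++ f (x ∷ xs) ys = trans (+-congˡ (Σᴸ-++ f xs ys)) (sym (+-assoc _ _ _))

    Σᴸ-map : ∀ (f : Y → Carrier) (g : X → Y) xs → Σᴸ f (map g xs) ≈ Σᴸ (f ∘ g) xs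
    Σᴸ-map f g []       = refl
    Σᴸ-map f g (x ∷ xs) = +-congˡ (Σᴸ-map f g xs)

    Σᴸ-concatMap : ∀ (f : Y → Carrier) (g : X → List Y) xs → Σᴸ f (concatMap g xs) ≈ Σᴸ (λ x → Σᴸ f (g x)) xs
    Σᴸ-concatMap f g []       = refl
    Σᴸ-concatMap f g (x ∷ xs) = trans (Σᴸ-++ f (g x) (concatMap g xs)) (+-congˡ (Σᴸ-concatMap f g xs))

    Σᴸ-*ˡ : ∀ c (f : X → Carrier) xs → c * Σᴸ f xs ≈ Σᴸ (λ x → c * f x) xs
    Σᴸ-*ˡ c f []       = zeroʳ c
    Σᴸ-*ˡ c f (x ∷ xs) = trans (distribˡ _ _ _) (+-congˡ (Σᴸ-*ˡ c f xs))

    sum-lookup : ∀ (f : X → Carrier) xs → sum (λ k → f (lookup xs k)) ≈ Σᴸ f xs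
    sum-lookup f []       = sum-[]
    sum-lookup f (x ∷ xs) = trans (sum-∷ (λ k → f (lookup (x ∷ xs) k))) (+-congˡ (sum-lookup f xs))

  module TranspositionList (R : CommutativeRing 0ℓ 0ℓ) {m : ℕ} (wt : Edge (suc m) → CommutativeRing.Carrier R)
    (L : List (Edge (suc m))) where
    open CommutativeRing R hiding (zero)
    open Determinant R
    open ReducedDeterminant R
    open ListSum R
    open CycleDeterminant R
    open MatrixTree R wt
    open RingSolver R
    open import Relation.Binary.Reasoning.Setoid setoid

    weights : Vect (length L)
    weights τ = wt (lookup L τ)

    roots : Matrix (length L) (suc m)
    roots τ = incidence (λ v → v) (lookup L τ)

    open TranspositionWalk R weights roots

    product : List (Edge (suc m)) → Carrier
    product []       = 1#
    product (t ∷ ts) = wt t * product ts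

    indicator : Bool → Carrier
    indicator b = if b then 1# else 0#

    laplacian≋gram : laplacian ≋ gram (λ v → v) L
    laplacian≋gram i j = trans (sum-lookup (λ e → wt e * (incidence (λ v → v) e i * incidence (λ v → v) e j)) L) (go L)
      where
      go : ∀ L → Σᴸ (λ e → wt e * (incidence (λ v → v) e i * incidence (λ v → v) e j)) L ≈ gram (λ v → v) L i j
      go []      = refl
      go (e ∷ L) = trans (+-congˡ (go L)) (+-comm _ _)

    det′-laplacian : det′ laplacian ≈ Σᴸ (λ S → product S * indicator (isSpanningTree S)) (sublists L)
    det′-laplacian = trans (det′-cong laplacian≋gram) (trans (matrix-tree L) (trees-sum [] L))
      where
      -- Choosing or omitting e is the recursion of `sublists`, and `(e ∷ C) ʳ++ S` reduces to
      -- `C ʳ++ (e ∷ S)`.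
      trees-sum : ∀ C L → trees C L ≈ Σᴸ (λ S → product S * indicator (isSpanningTree (C ʳ++ S))) (sublists L)
      trees-sum C []      = trans (sym (*-identityˡ _)) (sym (+-identityʳ _))
      trees-sum C (e ∷ L) = begin
        trees C L + wt e * trees (e ∷ C) L
          ≈⟨ +-cong (trees-sum C L) (trans (*-congˡ (trees-sum (e ∷ C) L)) (Σᴸ-*ˡ (wt e) _ (sublists L))) ⟩
        Σᴸ term (sublists L) + Σᴸ (λ S → wt e * (product S * indicator (isSpanningTree (C ʳ++ (e ∷ S))))) (sublists L)
          ≈⟨ trans (+-comm _ _) (+-congʳ (trans (Σᴸ-cong (λ S → sym (*-assoc _ _ _)) (sublists L)) (sym (Σᴸ-map term (e ∷_) (sublists L))))) ⟩
        Σᴸ term (map (e ∷_) (sublists L)) + Σᴸ term (sublists L)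
          ≈⟨ sym (Σᴸ-++ term (map (e ∷_) (sublists L)) (sublists L)) ⟩
        Σᴸ term (sublists (e ∷ L)) ∎
        where
        term : List (Edge (suc m)) → Carrier
        term S = product S * indicator (isSpanningTree (C ʳ++ S))

    -- The first row is masked, so that det (1 − M) is the first principal cofactor of 1 − σ.
    functionMatrix : (Fin (suc m) → Fin (suc m)) → Matrix (suc m) (suc m)
    functionMatrix σ zero    j = 0#
    functionMatrix σ (suc i) j = δ (σ (suc i)) j

    -- The permutation matrix of (a b) is the reflection 1 - u uᵀ for u = e_a - e_b; if a = b, both
    -- are the identity.
    δ-swap : ∀ (e : Edge (suc m)) k j → δ (swap e k) j ≈ δ k j - incidence (λ v → v) e k * incidence (λ v → v) e j
    δ-swap (a , b) k j with k ≟ a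
    ... | yes ≡.refl with a ≟ b
    ...   | yes ≡.refl = solve 2 (λ x y → y := y :- (x :- x) :* (y :- y)) refl (δ a a) (δ a j)
    ...   | no a≢b rewrite δ-refl a | δ-≢ (a≢b ∘ ≡.sym) = solve 2 (λ x y → y := x :- (:1 :- :0) :* (x :- y)) refl (δ a j) (δ b j)
    δ-swap (a , b) k j | no k≢a with k ≟ b
    ...   | yes ≡.refl rewrite δ-refl k | δ-≢ (k≢a ∘ ≡.sym) = solve 2 (λ x y → x := y :- (:0 :- :1) :* (x :- y)) refl (δ a j) (δ k j)
    ...   | no k≢b rewrite δ-≢ (k≢a ∘ ≡.sym) | δ-≢ (k≢b ∘ ≡.sym) = solve 3 (λ x y z → x := x :- (:0 :- :0) :* (y :- z)) refl (δ k j) (δ a j) (δ b j)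

    -- Right multiplication acts on the values of σ, so factors already multiplied act first, as in
    -- `prodPerm`. The erased row remains zero.
    functionMatrix-step : ∀ σ τ → functionMatrix σ ⊠ reflection τ ≋ functionMatrix (swap (lookup L τ) ∘ σ)
    functionMatrix-step σ τ zero    j = sum-zero (λ k → zeroˡ _)
    functionMatrix-step σ τ (suc i) j = trans (sum-δˡ (σ (suc i)) (λ k → reflection τ k j)) (sym (δ-swap (lookup L τ) (σ (suc i)) j))

    walk-cong : ∀ N {M M'} → M ≋ M' → walk N M ≈ walk N M'
    walk-cong zero    p = det-cong (λ i j → +-congˡ (-‿cong (p i j)))
    walk-cong (suc N) p = sum-cong (λ τ → *-congˡ (walk-cong N (⊠-cong {N = reflection τ} p (λ _ _ → refl))))

    cycleTerm : (Fin (suc m) → Fin (suc m)) → List (Edge (suc m)) → Carrier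
    cycleTerm σ ts = product ts * indicator (isNCycle (prodPerm ts ∘ σ))

    -- Stated for every injective σ, because each step of the walk replaces σ by a transposition
    -- following σ.
    walk-cycles : ∀ N σ → Inj σ → walk N (functionMatrix σ) ≈ Σᴸ (cycleTerm σ) (listsOfLength N L)
    walk-cycles zero σ σ-inj = begin
      det (λ i j → δ i j - functionMatrix σ i j)
        ≈⟨ det-cong rows ⟩
      det (cycleMatrix σ)
        ≈⟨ det-cycleMatrix σ σ-inj ⟩
      indicator (isNCycle σ)
        ≈⟨ sym (trans (+-identityʳ _) (*-identityˡ _)) ⟩
      Σᴸ (cycleTerm σ) (listsOfLength 0 L) ∎
      where
      rows : (λ i j → δ i j - functionMatrix σ i j) ≋ cycleMatrix σ
      rows zero    j = solve 1 (λ x → x :- :0 := x) refl (δ zero j)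
      rows (suc i) j = refl
    walk-cycles (suc N) σ σ-inj = begin
      sum (λ τ → weights τ * walk N (functionMatrix σ ⊠ reflection τ))
        ≈⟨ sum-cong (λ τ → *-congˡ (trans (walk-cong N (functionMatrix-step σ τ))
             (walk-cycles N (swap (lookup L τ) ∘ σ) (λ eq → σ-inj (swap-inj (lookup L τ) eq))))) ⟩
      sum (λ τ → weights τ * Σᴸ (cycleTerm (swap (lookup L τ) ∘ σ)) (listsOfLength N L))
        ≈⟨ sum-lookup (λ t → wt t * Σᴸ (cycleTerm (swap t ∘ σ)) (listsOfLength N L)) L ⟩
      Σᴸ (λ t → wt t * Σᴸ (cycleTerm (swap t ∘ σ)) (listsOfLength N L)) L
        ≈⟨ Σᴸ-cong (λ t → trans (Σᴸ-*ˡ (wt t) (cycleTerm (swap t ∘ σ)) (listsOfLength N L))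
             (trans (Σᴸ-cong (λ ts → sym (*-assoc _ _ _)) (listsOfLength N L)) (sym (Σᴸ-map (cycleTerm σ) (t ∷_) (listsOfLength N L))))) L ⟩
      Σᴸ (λ t → Σᴸ (cycleTerm σ) (map (t ∷_) (listsOfLength N L))) L
        ≈⟨ sym (Σᴸ-concatMap (cycleTerm σ) (λ t → map (t ∷_) (listsOfLength N L)) L) ⟩
      Σᴸ (cycleTerm σ) (listsOfLength (suc N) L) ∎

open TranspositionLists

-- Powers of t in the basis t^k / k!.

module FactorialCoefficients where

  module Factorials (R : CommutativeRing 0ℓ 0ℓ) where
    private
      module R = CommutativeRing R
      module RS = RingSolver R
    open HurwitzSeries R
    open CommutativeRing (hurwitz R) hiding (zero)
    open ReducedDeterminant (hurwitz R) using (_↑_)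

    ν : ℕ → R.Carrier
    ν zero    = R.0#
    ν (suc k) = R.1# R.+ ν k

    fac : ℕ → R.Carrier
    fac zero    = R.1#
    fac (suc k) = ν (suc k) R.* fac k

    t*-zero : ∀ f → (t * f) 0 R.≈ R.0#
    t*-zero f = R.zeroˡ _

    -- Multiplying t^k / k! by t gives (k + 1) t^(k+1) / (k + 1)!.
    t*-suc : ∀ f k → (t * f) (suc k) R.≈ ν (suc k) R.* f k
    t*-suc f zero    = R.trans (R.+-cong (R.*-identityˡ _) (t*-zero (∂ f)))
      (RS.solve 1 (λ x → x RS.:+ RS.:0 RS.:= (RS.:1 RS.:+ RS.:0) RS.:* x) R.refl (f 0))
    t*-suc f (suc k) = R.trans (R.+-cong (R.trans (const-⊛ R.1# f (suc k)) (R.*-identityˡ _)) (t*-suc (∂ f) k))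
      (RS.solve 2 (λ x n → x RS.:+ n RS.:* x RS.:= (RS.:1 RS.:+ n) RS.:* x) R.refl (f (suc k)) (ν (suc k)))

    -- In these terms x is the ordinary coefficient of t^k, and multiplication by t^a carries it
    -- unchanged to t^(a+k).
    t↑*-fac : ∀ a {f k x} → f k R.≈ fac k R.* x → ((t ↑ a) * f) (a ℕ.+ k) R.≈ fac (a ℕ.+ k) R.* x
    t↑*-fac zero    {f} {k} p = R.trans (*-identityˡ f k tt) p
    t↑*-fac (suc a) {f} {k} {x} p = R.trans (*-assoc t (t ↑ a) f (suc (a ℕ.+ k)) tt)
      (R.trans (t*-suc ((t ↑ a) * f) (a ℕ.+ k)) (R.trans (R.*-congˡ (t↑*-fac a p)) (R.sym (R.*-assoc _ _ _))))

    t↑*-const : ∀ a c k → ((t ↑ a) * const c) k R.≈ (if k ≡ᵇ a then fac k R.* c else R.0#)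
    t↑*-const zero    c zero    = R.refl
    t↑*-const zero    c (suc k) = *-identityˡ (const c) (suc k) tt
    t↑*-const (suc a) c zero    = R.trans (*-assoc t (t ↑ a) (const c) zero tt) (t*-zero ((t ↑ a) * const c))
    t↑*-const (suc a) c (suc k) = R.trans (*-assoc t (t ↑ a) (const c) (suc k) tt)
      (R.trans (t*-suc ((t ↑ a) * const c) k) (R.trans (R.*-congˡ (t↑*-const a c k)) (pull (k ≡ᵇ a))))
      where
      pull : ∀ b → ν (suc k) R.* (if b then fac k R.* c else R.0#) R.≈ (if b then ν (suc k) R.* fac k R.* c else R.0#)
      pull true  = R.sym (R.*-assoc _ _ _)
      pull false = R.zeroʳ _

    ↑-+ : ∀ c a b → c ↑ (a ℕ.+ b) ≈ c ↑ a * c ↑ b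
    ↑-+ c zero    b = sym (*-identityˡ _)
    ↑-+ c (suc a) b = trans (*-congˡ {c} (↑-+ c a b)) (sym (*-assoc c (c ↑ a) (c ↑ b)))

open FactorialCoefficients

-- The Taylor coefficients of φ as rational numbers.

module RationalCoefficients where

  open import Defs using (phiCoeff)
  import Data.Nat.Properties as ℕ
  open import Data.Integer using (+_)
  import Data.Integer as ℤ hiding (+_)
  import Data.Integer.Properties as ℤ
  import Data.Rational.Properties as ℚ
  open import Data.Rational.Unnormalised as ℚᵘ using (mkℚᵘ; *≡*)
  import Data.Rational.Unnormalised.Properties as ℚᵘ
  open import Relation.Binary.PropositionalEquality using (_≡_; refl; sym; trans; cong; cong₂; module ≡-Reasoning)

  natℚ : ℕ → ℚ
  natℚ k = + k ℚ./ 1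

  natᵘ : ∀ k → toℚᵘ (natℚ k) ℚᵘ.≃ mkℚᵘ (+ k) 0
  natᵘ k = ℚ.toℚᵘ-fromℚᵘ (mkℚᵘ (+ k) 0)

  natℚ-suc : ∀ k → natℚ (suc k) ≡ 1ℚ ℚ.+ natℚ k
  natℚ-suc k = ℚ.toℚᵘ-injective (begin
    toℚᵘ (natℚ (suc k))           ≈⟨ natᵘ (suc k) ⟩
    mkℚᵘ (+ suc k) 0              ≈⟨ *≡* (cong (ℤ._* + 1) (cong (λ z → + 1 ℤ.+ z) (sym (ℤ.*-identityʳ (+ k))))) ⟩
    mkℚᵘ (+ 1) 0 ℚᵘ.+ mkℚᵘ (+ k) 0  ≈⟨ ℚᵘ.+-congʳ (mkℚᵘ (+ 1) 0) (natᵘ k) ⟨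
    toℚᵘ 1ℚ ℚᵘ.+ toℚᵘ (natℚ k)     ≈⟨ ℚ.toℚᵘ-homo-+ 1ℚ (natℚ k) ⟨
    toℚᵘ (1ℚ ℚ.+ natℚ k)          ∎)
    where open ℚᵘ.≃-Reasoning

  natℚ-* : ∀ a b → natℚ (a ℕ.* b) ≡ natℚ a ℚ.* natℚ b
  natℚ-* a b = ℚ.toℚᵘ-injective (begin
    toℚᵘ (natℚ (a ℕ.* b))               ≈⟨ natᵘ (a ℕ.* b) ⟩
    mkℚᵘ (+ (a ℕ.* b)) 0                ≈⟨ *≡* (cong (ℤ._* + 1) (ℤ.pos-* a b)) ⟩
    mkℚᵘ (+ a) 0 ℚᵘ.* mkℚᵘ (+ b) 0       ≈⟨ ℚᵘ.*-cong (natᵘ a) (natᵘ b) ⟨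
    toℚᵘ (natℚ a) ℚᵘ.* toℚᵘ (natℚ b)     ≈⟨ ℚ.toℚᵘ-homo-* (natℚ a) (natℚ b) ⟨
    toℚᵘ (natℚ a ℚ.* natℚ b)            ∎)
    where open ℚᵘ.≃-Reasoning

  1/-* : ∀ d .{{_ : NonZero d}} → (+ 1 ℚ./ d) ℚ.* natℚ d ≡ 1ℚ
  1/-* (suc d) = ℚ.toℚᵘ-injective (begin
    toℚᵘ ((+ 1 ℚ./ suc d) ℚ.* natℚ (suc d))           ≈⟨ ℚ.toℚᵘ-homo-* (+ 1 ℚ./ suc d) (natℚ (suc d)) ⟩
    toℚᵘ (+ 1 ℚ./ suc d) ℚᵘ.* toℚᵘ (natℚ (suc d))      ≈⟨ ℚᵘ.*-cong (ℚ.toℚᵘ-fromℚᵘ (mkℚᵘ (+ 1) d)) (natᵘ (suc d)) ⟩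
    mkℚᵘ (+ 1) d ℚᵘ.* mkℚᵘ (+ suc d) 0                ≈⟨ *≡* (cong +_ (trans (ℕ.*-identityʳ _) (trans (ℕ.+-identityʳ (suc d)) (sym (trans (ℕ.+-identityʳ _) (ℕ.*-identityʳ (suc d))))))) ⟩
    toℚᵘ 1ℚ                                           ∎)
    where open ℚᵘ.≃-Reasoning

  infixr 8 _^ℚ_
  _^ℚ_ : ℚ → ℕ → ℚ
  c ^ℚ zero  = 1ℚ
  c ^ℚ suc k = c ℚ.* c ^ℚ k

  module ℚSolver = RingSolver ℚ.+-*-commutativeRing
  open ℚSolver

  -- k! [t^k] of (e^{t/2} − e^{−t/2}) / t.
  sinhCoeff : ℕ → ℚ
  sinhCoeff r = (½ ^ℚ suc r ℚ.- (ℚ.- ½) ^ℚ suc r) ℚ.* (+ 1 ℚ./ suc r)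

  sinhCoeff-* : ∀ r → natℚ (suc r) ℚ.* sinhCoeff r ≡ ½ ^ℚ suc r ℚ.- (ℚ.- ½) ^ℚ suc r
  sinhCoeff-* r = begin
    natℚ (suc r) ℚ.* (x ℚ.* y)  ≡⟨ solve 3 (λ n x y → n :* (x :* y) := x :* (y :* n)) refl (natℚ (suc r)) x y ⟩
    x ℚ.* (y ℚ.* natℚ (suc r))  ≡⟨ cong (x ℚ.*_) (1/-* (suc r)) ⟩
    x ℚ.* 1ℚ                    ≡⟨ ℚ.*-identityʳ x ⟩
    x                           ∎
    where
    open ≡-Reasoning
    x = ½ ^ℚ suc r ℚ.- (ℚ.- ½) ^ℚ suc r
    y = + 1 ℚ./ suc r

  ^ℚ-even : ∀ k → (ℚ.- ½) ^ℚ (k ℕ.+ k) ≡ ½ ^ℚ (k ℕ.+ k)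
  ^ℚ-even zero    = refl
  ^ℚ-even (suc k) = begin
    (ℚ.- ½) ^ℚ (suc k ℕ.+ suc k)                       ≡⟨ cong (λ j → (ℚ.- ½) ^ℚ suc j) (ℕ.+-suc k k) ⟩
    (ℚ.- ½) ℚ.* ((ℚ.- ½) ℚ.* (ℚ.- ½) ^ℚ (k ℕ.+ k))      ≡⟨ cong (λ x → (ℚ.- ½) ℚ.* ((ℚ.- ½) ℚ.* x)) (^ℚ-even k) ⟩
    (ℚ.- ½) ℚ.* ((ℚ.- ½) ℚ.* ½ ^ℚ (k ℕ.+ k))            ≡⟨ solve 2 (λ h x → :- h :* (:- h :* x) := h :* (h :* x)) refl ½ (½ ^ℚ (k ℕ.+ k)) ⟩
    ½ ℚ.* (½ ℚ.* ½ ^ℚ (k ℕ.+ k))                        ≡⟨ cong (λ j → ½ ^ℚ suc j) (ℕ.+-suc k k) ⟨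
    ½ ^ℚ (suc k ℕ.+ suc k)                              ∎
    where open ≡-Reasoning

  sinhCoeff-odd : ∀ k → sinhCoeff (suc (k ℕ.+ k)) ≡ 0ℚ
  sinhCoeff-odd k = begin
    (½ ℚ.* (½ ℚ.* e) ℚ.- (ℚ.- ½) ℚ.* ((ℚ.- ½) ℚ.* (ℚ.- ½) ^ℚ (k ℕ.+ k))) ℚ.* y
      ≡⟨ cong (λ x → (½ ℚ.* (½ ℚ.* e) ℚ.- (ℚ.- ½) ℚ.* ((ℚ.- ½) ℚ.* x)) ℚ.* y) (^ℚ-even k) ⟩
    (½ ℚ.* (½ ℚ.* e) ℚ.- (ℚ.- ½) ℚ.* ((ℚ.- ½) ℚ.* e)) ℚ.* y
      ≡⟨ solve 3 (λ h e y → (h :* (h :* e) :- :- h :* (:- h :* e)) :* y := :0) refl ½ e y ⟩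
    0ℚ ∎
    where
    open ≡-Reasoning
    e = ½ ^ℚ (k ℕ.+ k)
    y = + 1 ℚ./ suc (suc (k ℕ.+ k))

  ½^-4^ : ∀ k → ½ ^ℚ (k ℕ.+ k) ℚ.* natℚ (4 ℕ.^ k) ≡ 1ℚ
  ½^-4^ zero    = refl
  ½^-4^ (suc k) = begin
    ½ ^ℚ (suc k ℕ.+ suc k) ℚ.* natℚ (4 ℕ.* 4 ℕ.^ k)
      ≡⟨ cong₂ (λ j x → ½ ^ℚ suc j ℚ.* x) (ℕ.+-suc k k) (natℚ-* 4 (4 ℕ.^ k)) ⟩
    ½ ℚ.* (½ ℚ.* e) ℚ.* (natℚ 4 ℚ.* f)
      ≡⟨ solve 4 (λ h e n f → h :* (h :* e) :* (n :* f) := h :* (h :* n) :* (e :* f)) refl ½ e (natℚ 4) f ⟩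
    ½ ℚ.* (½ ℚ.* natℚ 4) ℚ.* (e ℚ.* f)
      ≡⟨ cong₂ ℚ._*_ {x = ½ ℚ.* (½ ℚ.* natℚ 4)} {y = 1ℚ} refl (½^-4^ k) ⟩
    1ℚ ℚ.* 1ℚ
      ≡⟨⟩
    1ℚ ∎
    where
    open ≡-Reasoning
    e = ½ ^ℚ (k ℕ.+ k)
    f = natℚ (4 ℕ.^ k)

  -- Both sides are inverse to 4^k (2k+1).
  phiCoeff-fac : ∀ k → phiCoeff k ℚ.* natℚ ((k ℕ.+ k) !) ≡ sinhCoeff (k ℕ.+ k)
  phiCoeff-fac k = begin
    x                      ≡⟨ sym (ℚ.*-identityʳ x) ⟩
    x ℚ.* 1ℚ               ≡⟨ cong (x ℚ.*_) (sym y-inverse) ⟩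
    x ℚ.* (y ℚ.* z)        ≡⟨ solve 3 (λ x y z → x :* (y :* z) := x :* z :* y) refl x y z ⟩
    x ℚ.* z ℚ.* y          ≡⟨ cong (ℚ._* y) x-inverse ⟩
    1ℚ ℚ.* y               ≡⟨ ℚ.*-identityˡ y ⟩
    y                      ∎
    where
    open ≡-Reasoning
    p = k ℕ.+ k
    x = phiCoeff k ℚ.* natℚ (p !)
    y = sinhCoeff p
    z = natℚ (4 ℕ.^ k) ℚ.* natℚ (suc p)
    2k+1 : 2 ℕ.* k ℕ.+ 1 ≡ suc p
    2k+1 = trans (ℕ.+-comm (2 ℕ.* k) 1) (cong (λ j → suc (k ℕ.+ j)) (ℕ.+-identityʳ k))
    x-inverse : x ℚ.* z ≡ 1ℚ
    x-inverse = begin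
      phiCoeff k ℚ.* natℚ (p !) ℚ.* (natℚ (4 ℕ.^ k) ℚ.* natℚ (suc p))
        ≡⟨ solve 4 (λ c f n s → c :* f :* (n :* s) := c :* (n :* (s :* f))) refl (phiCoeff k) (natℚ (p !)) (natℚ (4 ℕ.^ k)) (natℚ (suc p)) ⟩
      phiCoeff k ℚ.* (natℚ (4 ℕ.^ k) ℚ.* (natℚ (suc p) ℚ.* natℚ (p !)))
        ≡⟨ cong (λ q → phiCoeff k ℚ.* (natℚ (4 ℕ.^ k) ℚ.* q)) (sym (natℚ-* (suc p) (p !))) ⟩
      phiCoeff k ℚ.* (natℚ (4 ℕ.^ k) ℚ.* natℚ (suc p !))
        ≡⟨ cong (phiCoeff k ℚ.*_) (sym (natℚ-* (4 ℕ.^ k) (suc p !))) ⟩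
      phiCoeff k ℚ.* natℚ (4 ℕ.^ k ℕ.* suc p !)
        ≡⟨ cong (λ j → phiCoeff k ℚ.* natℚ (4 ℕ.^ k ℕ.* j !)) (sym 2k+1) ⟩
      phiCoeff k ℚ.* natℚ (4 ℕ.^ k ℕ.* (2 ℕ.* k ℕ.+ 1) !)
        ≡⟨ 1/-* (4 ℕ.^ k ℕ.* (2 ℕ.* k ℕ.+ 1) !) {{ℕ.m*n≢0 (4 ℕ.^ k) ((2 ℕ.* k ℕ.+ 1) !) {{ℕ.m^n≢0 4 k}} {{(2 ℕ.* k ℕ.+ 1) ℕ.!≢0}}}} ⟩
      1ℚ ∎
    y-inverse : y ℚ.* z ≡ 1ℚ
    y-inverse = begin
      y ℚ.* (natℚ (4 ℕ.^ k) ℚ.* natℚ (suc p))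
        ≡⟨ solve 3 (λ y n s → y :* (n :* s) := s :* y :* n) refl y (natℚ (4 ℕ.^ k)) (natℚ (suc p)) ⟩
      natℚ (suc p) ℚ.* y ℚ.* natℚ (4 ℕ.^ k)
        ≡⟨ cong (ℚ._* natℚ (4 ℕ.^ k)) (sinhCoeff-* p) ⟩
      (½ ℚ.* ½ ^ℚ p ℚ.- (ℚ.- ½) ℚ.* (ℚ.- ½) ^ℚ p) ℚ.* natℚ (4 ℕ.^ k)
        ≡⟨ cong (λ q → (½ ℚ.* ½ ^ℚ p ℚ.- (ℚ.- ½) ℚ.* q) ℚ.* natℚ (4 ℕ.^ k)) (^ℚ-even k) ⟩
      (½ ℚ.* ½ ^ℚ p ℚ.- (ℚ.- ½) ℚ.* ½ ^ℚ p) ℚ.* natℚ (4 ℕ.^ k)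
        ≡⟨ solve 3 (λ h e n → (h :* e :- :- h :* e) :* n := (h :+ h) :* (e :* n)) refl ½ (½ ^ℚ p) (natℚ (4 ℕ.^ k)) ⟩
      (½ ℚ.+ ½) ℚ.* (½ ^ℚ p ℚ.* natℚ (4 ℕ.^ k))
        ≡⟨ cong ((½ ℚ.+ ½) ℚ.*_) (½^-4^ k) ⟩
      (½ ℚ.+ ½) ℚ.* 1ℚ
        ≡⟨⟩
      1ℚ ∎

open RationalCoefficients

-- Total degree, homogeneous parts and the substitution w ↦ t w.

module PolynomialGrading where

  import Defs
  open Defs hiding (det)
  import Data.Nat.Properties as ℕ
  import Data.Rational.Properties as ℚ
  open import Data.List using ([]; _∷_; _++_; map; concatMap; allFin; tabulate; foldr; filter)
  open import Relation.Binary.PropositionalEquality as ≡ using (_≡_; _≢_; module ≡-Reasoning)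

  private variable
    n m : ℕ
    X : Set

  signℚ : ℕ → ℚ
  signℚ zero          = 1ℚ
  signℚ (suc zero)    = ℚ.- 1ℚ
  signℚ (suc (suc k)) = signℚ k

  signℚ-suc : ∀ k → signℚ (suc k) ≡ ℚ.- signℚ k
  signℚ-suc zero          = ≡.refl
  signℚ-suc (suc zero)    = ≡.refl
  signℚ-suc (suc (suc k)) = signℚ-suc k

  -- A handle on the terms of the first-row expansion: `summand` is left to unification against the
  -- definition of `det`, since its local sign function cannot be written down.
  record Summands {n} m (M : Mat n (suc m)) : Set where
    field
      summand : Fin (suc m) → Poly n
      expansion : Defs.det (suc m) M ≡ sumFin (suc m) summand
  open Summands

  summands : ∀ {n} m (M : Mat n (suc m)) → Summands m M
  summands m M = record { summand = _ ; expansion = ≡.refl }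

  -- The sign function inside the definition of det is local and cannot be named;
  -- the type of at-index, which mentions it, is therefore left to be inferred.
  mutual
    at-index : ∀ {n} m (M : Mat n (suc m)) (j : Fin (suc m)) (k : ℕ) → _

    summand≡ : ∀ {n} m (M : Mat n (suc m)) j →
      summand (summands m M) j ≡ scaleₚ (signℚ (toℕ j)) (M zero j *ₚ Defs.det m (λ a b → M (suc a) (punchIn j b)))
    summand≡ m M j with toℕ j
    ... | k = at-index m M j k

    at-index m M j zero          = ≡.refl
    at-index m M j (suc zero)    = ≡.refl
    at-index m M j (suc (suc k)) = at-index m M j k

  sumℕ : ∀ {k} → (Fin k → ℕ) → ℕ
  sumℕ {zero}  f = 0
  sumℕ {suc k} f = f zero ℕ.+ sumℕ (f ∘ suc)

  sumℕ-cong : ∀ {k} {f g : Fin k → ℕ} → (∀ i → f i ≡ g i) → sumℕ f ≡ sumℕ g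
  sumℕ-cong {zero}  p = ≡.refl
  sumℕ-cong {suc k} p = ≡.cong₂ ℕ._+_ (p zero) (sumℕ-cong (p ∘ suc))

  sumℕ-+ : ∀ {k} (f g : Fin k → ℕ) → sumℕ (λ i → f i ℕ.+ g i) ≡ sumℕ f ℕ.+ sumℕ g
  sumℕ-+ {zero}  f g = ≡.refl
  sumℕ-+ {suc k} f g = ≡.trans (≡.cong (f zero ℕ.+ g zero ℕ.+_) (sumℕ-+ (f ∘ suc) (g ∘ suc)))
    (ℕ-interchange (f zero) (g zero) (sumℕ (f ∘ suc)) (sumℕ (g ∘ suc)))
    where
    open import Algebra.Properties.CommutativeSemigroup ℕ.+-commutativeSemigroup using () renaming (interchange to ℕ-interchange)

  sumℕ-zero : ∀ {k} {f : Fin k → ℕ} → (∀ i → f i ≡ 0) → sumℕ f ≡ 0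
  sumℕ-zero {zero}  p = ≡.refl
  sumℕ-zero {suc k} p = ≡.cong₂ ℕ._+_ (p zero) (sumℕ-zero (p ∘ suc))

  sumℕ-single : ∀ {k} {f : Fin k → ℕ} x → (∀ i → i ≢ x → f i ≡ 0) → sumℕ f ≡ f x
  sumℕ-single {suc k} {f} zero    p = ≡.trans (≡.cong (f zero ℕ.+_) (sumℕ-zero (λ i → p (suc i) (λ ())))) (ℕ.+-identityʳ _)
  sumℕ-single {suc k} (suc x) p = ≡.cong₂ ℕ._+_ (p zero (λ ())) (sumℕ-single x (λ i i≢x → p (suc i) (i≢x ∘ Fin.suc-injective)))
    where import Data.Fin.Properties as Fin

  totalDeg≡ : ∀ (μ : Mono n) → totalDeg μ ≡ sumℕ (λ i → sumℕ (μ i))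
  totalDeg≡ {n} μ = outer id
    where
    row : ∀ {k} (f : Fin n → ℕ) (g : Fin k → Fin n) xs → foldr ℕ._+_ 0 (map f (tabulate g) ++ xs) ≡ sumℕ (f ∘ g) ℕ.+ foldr ℕ._+_ 0 xs
    row {zero}  f g xs = ≡.refl
    row {suc k} f g xs = ≡.trans (≡.cong (f (g zero) ℕ.+_) (row f (g ∘ suc) xs)) (≡.sym (ℕ.+-assoc (f (g zero)) _ _))
    outer : ∀ {k} (g : Fin k → Fin n) → foldr ℕ._+_ 0 (concatMap (λ i → map (λ j → μ i j) (allFin n)) (tabulate g)) ≡ sumℕ (λ i → sumℕ (μ (g i)))
    outer {zero}  g = ≡.refl
    outer {suc k} g = ≡.trans (row (μ (g zero)) id _) (≡.cong (sumℕ (μ (g zero)) ℕ.+_) (outer (g ∘ suc)))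

  totalDeg-cong : ∀ {μ μ' : Mono n} → μ ≐ μ' → totalDeg μ ≡ totalDeg μ'
  totalDeg-cong {μ = μ} {μ'} p = ≡.trans (totalDeg≡ μ) (≡.trans (sumℕ-cong (λ i → sumℕ-cong (p i))) (≡.sym (totalDeg≡ μ')))

  totalDeg-* : ∀ (μ μ' : Mono n) → totalDeg (monoMul μ μ') ≡ totalDeg μ ℕ.+ totalDeg μ'
  totalDeg-* μ μ' = ≡.trans (totalDeg≡ (monoMul μ μ')) (≡.trans (sumℕ-cong (λ i → sumℕ-+ (μ i) (μ' i)))
    (≡.trans (sumℕ-+ (λ i → sumℕ (μ i)) (λ i → sumℕ (μ' i))) (≡.sym (≡.cong₂ ℕ._+_ (totalDeg≡ μ) (totalDeg≡ μ')))))

  totalDeg-one : totalDeg {n} monoOne ≡ 0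
  totalDeg-one {n} = ≡.trans (totalDeg≡ {n} monoOne) (sumℕ-zero {n} (λ i → sumℕ-zero {n} (λ j → ≡.refl)))

  totalDeg-unit : ∀ (x y : Fin n) → totalDeg (λ a b → if does (a ≟ x) ∧ does (b ≟ y) then 1 else 0) ≡ 1
  totalDeg-unit {n} x y = ≡.trans (totalDeg≡ μ) (≡.trans (sumℕ-single x (λ i i≢x → sumℕ-zero (λ j → off i j i≢x)))
    (≡.trans (sumℕ-single y off′) on))
    where
    μ : Mono n
    μ a b = if does (a ≟ x) ∧ does (b ≟ y) then 1 else 0
    off : ∀ i j → i ≢ x → μ i j ≡ 0
    off i j i≢x rewrite dec-false (i ≟ x) i≢x = ≡.refl
    off′ : ∀ j → j ≢ y → μ x j ≡ 0
    off′ j j≢y rewrite dec-true (x ≟ x) ≡.refl | dec-false (j ≟ y) j≢y = ≡.refl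
    on : μ x y ≡ 1
    on rewrite dec-true (x ≟ x) ≡.refl | dec-true (y ≟ y) ≡.refl = ≡.refl

  totalDeg-w : ∀ {i j : Fin n} {c μ p} → w i j ≡ (c , μ) ∷ p → totalDeg μ ≡ 1
  totalDeg-w {i = i} {j} ≡.refl = totalDeg-unit (if toℕ i <ᵇ toℕ j then i else j) (if toℕ i <ᵇ toℕ j then j else i)

  coeff-homog : ∀ d (p : Poly n) μ → coeff (homog d p) μ ≡ (if totalDeg μ ≡ᵇ d then coeff p μ else 0ℚ)
  coeff-homog d [] μ with totalDeg μ ≡ᵇ d
  ... | true  = ≡.refl
  ... | false = ≡.refl
  coeff-homog d ((c , k) ∷ p) μ with totalDeg k ≡ᵇ d in eq
  ... | true  = ≡.trans (≡.cong ((if monoEq k μ then c else 0ℚ) ℚ.+_) (coeff-homog d p μ)) (kept (monoEq k μ) _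
      (λ e → ≡.trans (≡.cong (_≡ᵇ d) (≡.sym (totalDeg-cong (monoEq⁻ k μ e)))) eq))
    where
    kept : ∀ e b → (e ≡ true → b ≡ true) →
      (if e then c else 0ℚ) ℚ.+ (if b then coeff p μ else 0ℚ) ≡ (if b then (if e then c else 0ℚ) ℚ.+ coeff p μ else 0ℚ)
    kept e     true  h = ≡.refl
    kept true  false h = contradiction (h ≡.refl) λ ()
    kept false false h = ≡.refl
  ... | false = ≡.trans (coeff-homog d p μ) (dropped (monoEq k μ) _
      (λ e → ≡.trans (≡.cong (_≡ᵇ d) (≡.sym (totalDeg-cong (monoEq⁻ k μ e)))) eq))
    where
    dropped : ∀ e b → (e ≡ true → b ≡ false) →
      (if b then coeff p μ else 0ℚ) ≡ (if b then (if e then c else 0ℚ) ℚ.+ coeff p μ else 0ℚ)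
    dropped e     false h = ≡.refl
    dropped true  true  h = contradiction (h ≡.refl) λ ()
    dropped false true  h = ≡.sym (ℚ.+-identityˡ _)

  homog-cong : ∀ d {p q : Poly n} → p ≋ₚ q → homog d p ≋ₚ homog d q
  homog-cong d {p} {q} e = mk λ μ → ≡.trans (coeff-homog d p μ)
    (≡.trans (≡.cong (λ x → if totalDeg μ ≡ᵇ d then x else 0ℚ) (coeffs e μ)) (≡.sym (coeff-homog d q μ)))

  module Polynomials (n : ℕ) where
    open CommutativeRing (polyRing n) using (_≈_; refl; sym; trans; reflexive; +-cong; +-congˡ; +-congʳ; *-cong; *-congʳ; -‿cong; +-identityˡ; +-identityʳ; _+_; _*_; -_; 0#; 1#; zeroˡ; zeroʳ)
    open Determinant (polyRing n)
    open MatrixExponential (polyRing n) using (pow)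
    open ListSum (polyRing n)
    open HurwitzSeries (polyRing n) using (t; const; ∂)
    open Factorials (polyRing n)
    private
      module R = CommutativeRing (polyRing n)
      module S = CommutativeRing (hurwitz (polyRing n))
      module E = MatrixExponential (polyRing n)
    open ReducedDeterminant (hurwitz (polyRing n)) using (_↑_)

    sumₚ-Σᴸ : ∀ (f : X → Poly n) xs → sumₚ (map f xs) ≡ Σᴸ f xs
    sumₚ-Σᴸ f []       = ≡.refl
    sumₚ-Σᴸ f (x ∷ xs) = ≡.cong (f x ++_) (sumₚ-Σᴸ f xs)

    Σᴸ-tabulate : ∀ {k} (f : X → Poly n) (g : Fin k → X) → Σᴸ f (tabulate g) ≈ sum (λ i → f (g i))
    Σᴸ-tabulate {k = zero}  f g = sym sum-[]
    Σᴸ-tabulate {k = suc k} f g = trans (+-congˡ (Σᴸ-tabulate f (g ∘ suc))) (sym (sum-∷ (λ i → f (g i))))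

    sumFin≈sum : ∀ {k} (f : Fin k → Poly n) → sumFin k f ≈ sum f
    sumFin≈sum f = trans (reflexive (sumₚ-Σᴸ f (allFin _))) (Σᴸ-tabulate f id)

    const-neg : ∀ c → constₚ {n} (ℚ.- c) ≈ -ₚ constₚ c
    const-neg c = term-cong (≡.trans (≡.cong ℚ.-_ (≡.sym (ℚ.*-identityˡ c))) (ℚ.neg-distribˡ-* 1ℚ c)) (λ _ _ → ≡.refl) ≋-refl

    const-sign : ∀ {k} (j : Fin k) → constₚ {n} (signℚ (toℕ j)) ≈ sgn j
    const-sign zero    = refl
    const-sign (suc j) = trans (reflexive (≡.cong constₚ (signℚ-suc (toℕ j)))) (trans (const-neg (signℚ (toℕ j))) (-‿cong (const-sign j)))

    frozen-det : ∀ k (M : Mat n k) → Defs.det k M ≈ det M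
    frozen-det zero    M = sym (det-zero M)
    frozen-det (suc k) M = trans (reflexive (expansion (summands k M))) (trans (sumFin≈sum (summand (summands k M)))
      (trans (sum-cong term) (sym (det-suc M))))
      where
      term : ∀ j → summand (summands k M) j ≈ sgn j * (M zero j * det (minor (M ∘ suc) j))
      term j = trans (reflexive (summand≡ k M j)) (trans (scale-const (signℚ (toℕ j)) (M zero j *ₚ Defs.det k (minor (M ∘ suc) j)))
        (*-cong (const-sign j) (R.*-congˡ {M zero j} (frozen-det k (minor (M ∘ suc) j)))))

    idMat≈δ : ∀ {k} (i j : Fin k) → idMat i j ≈ δ i j
    idMat≈δ i j with i ≟ j
    ... | yes ≡.refl = reflexive (≡.sym (δ-refl i))
    ... | no i≢j     = reflexive (≡.sym (δ-≢ i≢j))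

    ^ₘ≈pow : ∀ {l} (M : Mat n l) k → (M ^ₘ k) ≋ pow M k
    ^ₘ≈pow M zero    i j = idMat≈δ i j
    ^ₘ≈pow M (suc k) i j = trans (sumFin≈sum (λ a → M i a *ₚ (M ^ₘ k) a j)) (sum-cong (λ a → R.*-congˡ {M i a} (^ₘ≈pow M k a j)))

    Σᴸ-filter : ∀ {P : X → Bool} (f : X → Poly n) xs →
      Σᴸ f (filter (λ x → P x Data.Bool.≟ true) xs) ≈ Σᴸ (λ x → f x * (if P x then 1# else 0#)) xs
    Σᴸ-filter f [] = refl
    Σᴸ-filter {P = P} f (x ∷ xs) with P x
    ... | true  = +-cong (sym (R.*-identityʳ (f x))) (Σᴸ-filter f xs)
    ... | false = trans (Σᴸ-filter f xs) (sym (trans (+-congʳ (zeroʳ (f x))) (+-identityˡ _)))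

    grade-term : Term n → S.Carrier
    grade-term s = t ↑ totalDeg (proj₂ s) S.* const (s ∷ [])

    -- The substitution w ↦ t w, carried out on each term according to its total degree.
    grade : Poly n → S.Carrier
    grade []      = S.0#
    grade (s ∷ p) = grade-term s S.+ grade p

    -- In the basis t^k / k! the power t^k has coefficient k!. Besides extracting homogeneous parts,
    -- this shows that `grade` does not depend on the list representing p.
    grade-coeff : ∀ p k → grade p k ≈ fac k * homog k p
    grade-coeff []            k = sym (zeroʳ (fac k))
    grade-coeff ((c , μ) ∷ p) k = trans (+-cong (t↑*-const (totalDeg μ) ((c , μ) ∷ []) k) (grade-coeff p k)) split
      where
      ≡ᵇ-sym : ∀ a b → (a ≡ᵇ b) ≡ (b ≡ᵇ a)
      ≡ᵇ-sym zero    zero    = ≡.refl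
      ≡ᵇ-sym zero    (suc b) = ≡.refl
      ≡ᵇ-sym (suc a) zero    = ≡.refl
      ≡ᵇ-sym (suc a) (suc b) = ≡ᵇ-sym a b
      split : (if k ≡ᵇ totalDeg μ then fac k * ((c , μ) ∷ []) else 0#) + fac k * homog k p ≈ fac k * homog k ((c , μ) ∷ p)
      split rewrite ≡ᵇ-sym k (totalDeg μ) with totalDeg μ ≡ᵇ k
      ... | true  = sym (R.distribˡ (fac k) ((c , μ) ∷ []) (homog k p))
      ... | false = refl

    grade-cong : ∀ {p q} → p ≈ q → grade p S.≈ grade q
    grade-cong {p} {q} e k _ = trans (grade-coeff p k) (trans (R.*-congˡ {fac k} (homog-cong k e)) (sym (grade-coeff q k)))

    grade-+ : ∀ p q → grade (p + q) S.≈ grade p S.+ grade q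
    grade-+ []      q = S.sym (S.+-identityˡ (grade q))
    grade-+ (s ∷ p) q = S.trans (S.+-congˡ {grade-term s} (grade-+ p q)) (S.sym (S.+-assoc (grade-term s) (grade p) (grade q)))

    grade-term-* : ∀ (s u : Term n) → grade-term (proj₁ s ℚ.* proj₁ u , monoMul (proj₂ s) (proj₂ u)) S.≈ grade-term s S.* grade-term u
    grade-term-* s u = S.trans
      (S.*-cong (S.trans (S.reflexive (≡.cong (t ↑_) (totalDeg-* (proj₂ s) (proj₂ u)))) (↑-+ t (totalDeg (proj₂ s)) (totalDeg (proj₂ u))))
                (E.cH.*-homo (s ∷ []) (u ∷ [])))
      (SS.solve 4 (λ a b x y → (a SS.:* b) SS.:* (x SS.:* y) SS.:= (a SS.:* x) SS.:* (b SS.:* y)) S.refl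
        (t ↑ totalDeg (proj₂ s)) (t ↑ totalDeg (proj₂ u)) (const (s ∷ [])) (const (u ∷ [])))
      where module SS = RingSolver (hurwitz (polyRing n))

    grade-· : ∀ s q → grade (s · q) S.≈ grade-term s S.* grade q
    grade-· s []      = S.sym (S.zeroʳ (grade-term s))
    grade-· s (u ∷ q) = S.trans (S.+-cong (grade-term-* s u) (grade-· s q)) (S.sym (S.distribˡ (grade-term s) (grade-term u) (grade q)))

    grade-* : ∀ p q → grade (p * q) S.≈ grade p S.* grade q
    grade-* []      q = S.sym (S.zeroˡ (grade q))
    grade-* (s ∷ p) q = S.trans (grade-+ (s · q) (p * q)) (S.trans (S.+-cong (grade-· s q) (grade-* p q)) (S.sym (S.distribʳ (grade q) (grade-term s) (grade p))))

    grade-const : ∀ c → grade (constₚ c) S.≈ const (constₚ c)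
    grade-const c = S.trans (S.+-identityʳ (grade-term (c , monoOne)))
      (S.trans (S.*-congʳ {const (constₚ c)} (S.reflexive (≡.cong (t ↑_) (totalDeg-one {n})))) (S.*-identityˡ (const (constₚ c))))

    grade-w : ∀ i j → grade (w i j) S.≈ t S.* const (w i j)
    grade-w i j = S.trans (S.+-identityʳ (grade-term s)) (S.*-congʳ {const (w i j)} (S.trans (S.reflexive (≡.cong (t ↑_) (totalDeg-w {i = i} {j} ≡.refl))) (S.*-identityʳ t)))
      where
      s : Term n
      s = _
      shape : w i j ≡ s ∷ []
      shape = ≡.refl

    gradeHom : Hom (polyRing n) (hurwitz (polyRing n))
    gradeHom = record { ⟦_⟧ = grade ; ⟦⟧-cong = grade-cong ; +-homo = grade-+ ; *-homo = grade-* ; 1-homo = grade-const 1ℚ }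

open PolynomialGrading

-- The matrix A as a sum over transpositions.

module Laplacians where

  import Defs
  open Defs hiding (det)
  import Data.Nat.Properties as ℕ
  open import Data.Integer using (+_)
  open import Data.Fin.Properties using (toℕ-injective)
  open import Data.List using (List; []; _∷_; map; allFin; filter)
  open import Relation.Unary using (Decidable)
  open import Relation.Binary.PropositionalEquality as ≡ using (_≡_; _≢_)

  parity : ∀ r → ∃ λ k → r ≡ k ℕ.+ k ⊎ r ≡ suc (k ℕ.+ k)
  parity zero = zero , inj₁ ≡.refl
  parity (suc r) with parity r
  ... | k , inj₁ ≡.refl = k , inj₂ ≡.refl
  ... | k , inj₂ ≡.refl = suc k , inj₁ (≡.cong suc (≡.sym (ℕ.+-suc k k)))

  w-mono-sym : ∀ {n} (a b : Fin n) → a ≢ b →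
    (λ x y → if does (x ≟ (if toℕ a <ᵇ toℕ b then a else b)) ∧ does (y ≟ (if toℕ a <ᵇ toℕ b then b else a)) then 1 else 0)
    ≐ (λ x y → if does (x ≟ (if toℕ b <ᵇ toℕ a then b else a)) ∧ does (y ≟ (if toℕ b <ᵇ toℕ a then a else b)) then 1 else 0)
  w-mono-sym a b a≢b x y with toℕ a <ᵇ toℕ b in ab | toℕ b <ᵇ toℕ a in ba
  ... | true  | false = ≡.refl
  ... | false | true  = ≡.refl
  ... | true  | true  = contradiction (ℕ.<ᵇ⇒< (toℕ b) (toℕ a) (≡.subst T (≡.sym ba) tt)) (ℕ.<-asym (ℕ.<ᵇ⇒< (toℕ a) (toℕ b) (≡.subst T (≡.sym ab) tt)))
  ... | false | false with ℕ.<-cmp (toℕ a) (toℕ b)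
  ...   | tri< lt _ _ = contradiction (≡.subst T ab (ℕ.<⇒<ᵇ lt)) id
  ...   | tri≈ _ eq _ = contradiction (toℕ-injective eq) a≢b
  ...   | tri> _ _ gt = contradiction (≡.subst T ba (ℕ.<⇒<ᵇ gt)) id

  w-sym : ∀ {n} (a b : Fin n) → a ≢ b → w a b ≋ₚ w b a
  w-sym a b a≢b = term-cong ≡.refl (w-mono-sym a b a≢b) ≋-refl

  module TranspositionSums (n : ℕ) where
    open CommutativeRing (polyRing n)
    open Determinant (polyRing n)
    open ListSum (polyRing n)
    open Polynomials n using (Σᴸ-tabulate)
    open RingSolver (polyRing n)
    open import Relation.Binary.Reasoning.Setoid setoid

    indicate : Bool → Poly n
    indicate b = if b then 1# else 0#

    Σᴸ-filter? : ∀ {X : Set} {P : X → Set} (P? : Decidable P) (f : X → Poly n) xs →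
      Σᴸ f (filter P? xs) ≈ Σᴸ (λ x → f x * indicate (does (P? x))) xs
    Σᴸ-filter? P? f [] = refl
    Σᴸ-filter? P? f (x ∷ xs) with does (P? x)
    ... | true  = +-cong (sym (*-identityʳ (f x))) (Σᴸ-filter? P? f xs)
    ... | false = trans (Σᴸ-filter? P? f xs) (sym (trans (+-congʳ (zeroʳ (f x))) (+-identityˡ _)))

    lt ne : Fin n → Fin n → Poly n
    lt a b = indicate (does (toℕ a <? toℕ b))
    ne a b = indicate (not (does (a ≟ b)))

    ne-refl : ∀ a → ne a a ≈ 0#
    ne-refl a rewrite dec-true (a ≟ a) ≡.refl = refl

    ne-≢ : ∀ {a b} → a ≢ b → ne a b ≈ 1#
    ne-≢ {a} {b} a≢b rewrite dec-false (a ≟ b) a≢b = refl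

    lt+gt : ∀ a b → lt a b + lt b a ≈ ne a b
    lt+gt a b with ℕ.<-cmp (toℕ a) (toℕ b)
    ... | tri< a<b a≢b a≯b rewrite dec-true (toℕ a <? toℕ b) a<b | dec-false (toℕ b <? toℕ a) a≯b | dec-false (a ≟ b) (a≢b ∘ ≡.cong toℕ) = +-identityʳ 1#
    ... | tri> a≮b a≢b b<a rewrite dec-false (toℕ a <? toℕ b) a≮b | dec-true (toℕ b <? toℕ a) b<a | dec-false (a ≟ b) (a≢b ∘ ≡.cong toℕ) = +-identityˡ 1#
    ... | tri≈ a≮b a≡b b≮a rewrite dec-false (toℕ a <? toℕ b) a≮b | dec-false (toℕ b <? toℕ a) b≮a | dec-true (a ≟ b) (toℕ-injective a≡b) = +-identityˡ 0#

    Σ-transpositions : ∀ (F : Fin n → Fin n → Poly n) →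
      Σᴸ (λ e → F (proj₁ e) (proj₂ e)) (transpositions n) ≈ sum (λ a → sum (λ b → F a b * lt a b))
    Σ-transpositions F = begin
      Σᴸ F′ (transpositions n)
        ≈⟨ Σᴸ-concatMap F′ row (allFin n) ⟩
      Σᴸ (λ a → Σᴸ F′ (row a)) (allFin n)
        ≈⟨ Σᴸ-tabulate (λ a → Σᴸ F′ (row a)) id ⟩
      sum (λ a → Σᴸ F′ (row a))
        ≈⟨ sum-cong (λ a → trans (Σᴸ-map F′ (a ,_) (filter (λ b → toℕ a <? toℕ b) (allFin n)))
             (trans (Σᴸ-filter? (λ b → toℕ a <? toℕ b) (F a) (allFin n)) (Σᴸ-tabulate (λ b → F a b * lt a b) id))) ⟩
      sum (λ a → sum (λ b → F a b * lt a b)) ∎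
      where
      F′ : Edge n → Poly n
      F′ e = F (proj₁ e) (proj₂ e)
      row : Fin n → List (Edge n)
      row a = map (λ b → (a , b)) (filter (λ b → toℕ a <? toℕ b) (allFin n))

    -- A sum over unordered pairs of a symmetrised quantity is a sum over ordered pairs of distinct
    -- indices; the latter can be evaluated one index at a time.
    Σ-symmetric : ∀ (F G : Fin n → Fin n → Poly n) → (∀ a b → a ≢ b → F a b ≈ G a b + G b a) →
      Σᴸ (λ e → F (proj₁ e) (proj₂ e)) (transpositions n) ≈ sum (λ a → sum (λ b → G a b * ne a b))
    Σ-symmetric F G F≈ = begin
      Σᴸ (λ e → F (proj₁ e) (proj₂ e)) (transpositions n)
        ≈⟨ Σ-transpositions F ⟩
      sum (λ a → sum (λ b → F a b * lt a b))
        ≈⟨ sum-cong (λ a → sum-cong (λ b → term a b)) ⟩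
      sum (λ a → sum (λ b → G a b * lt a b + G b a * lt a b))
        ≈⟨ trans (sum-cong (λ a → ∑-distrib-+ (λ b → G a b * lt a b) (λ b → G b a * lt a b)))
             (∑-distrib-+ (λ a → sum (λ b → G a b * lt a b)) (λ a → sum (λ b → G b a * lt a b))) ⟩
      sum (λ a → sum (λ b → G a b * lt a b)) + sum (λ a → sum (λ b → G b a * lt a b))
        ≈⟨ +-congˡ (∑-comm (λ a b → G b a * lt a b)) ⟩
      sum (λ a → sum (λ b → G a b * lt a b)) + sum (λ a → sum (λ b → G a b * lt b a))
        ≈⟨ sym (trans (sum-cong (λ a → ∑-distrib-+ (λ b → G a b * lt a b) (λ b → G a b * lt b a)))
             (∑-distrib-+ (λ a → sum (λ b → G a b * lt a b)) (λ a → sum (λ b → G a b * lt b a)))) ⟩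
      sum (λ a → sum (λ b → G a b * lt a b + G a b * lt b a))
        ≈⟨ sum-cong (λ a → sum-cong (λ b → trans (sym (distribˡ (G a b) (lt a b) (lt b a))) (*-congˡ {G a b} (lt+gt a b)))) ⟩
      sum (λ a → sum (λ b → G a b * ne a b)) ∎
      where
      term : ∀ a b → F a b * lt a b ≈ G a b * lt a b + G b a * lt a b
      term a b with a ≟ b
      ... | no a≢b = trans (*-congʳ {lt a b} (F≈ a b a≢b)) (distribʳ (lt a b) (G a b) (G b a))
      ... | yes ≡.refl rewrite dec-false (toℕ a <? toℕ a) (ℕ.<-irrefl ≡.refl) =
        trans (zeroʳ (F a a)) (sym (trans (+-cong (zeroʳ (G a a)) (zeroʳ (G a a))) (+-identityʳ 0#)))

    Amat-diagonal : ∀ i → Amat n i i ≈ sum (λ b → w i b * ne i b)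
    Amat-diagonal i rewrite dec-true (i ≟ i) ≡.refl = trans (reflexive (Polynomials.sumₚ-Σᴸ n (w i) (filter (λ k → not (does (i ≟ k)) Data.Bool.≟ true) (allFin n))))
      (trans (Polynomials.Σᴸ-filter n {P = λ k → not (does (i ≟ k))} (w i) (allFin n)) (Σᴸ-tabulate (λ b → w i b * ne i b) id))

    Amat-off-diagonal : ∀ {i j} → i ≢ j → Amat n i j ≈ - w i j
    Amat-off-diagonal {i} {j} i≢j rewrite dec-false (i ≟ j) i≢j = refl

    -- The outer product of e_a - e_b is split into two halves exchanged by a ↔ b. Summing one half
    -- over ordered pairs, the factor `δ a i` selects row i, and the two remaining terms give the
    -- diagonal and the off-diagonal entries.
    Amat≈ : ∀ i j → Amat n i j ≈ Σᴸ (λ e → w (proj₁ e) (proj₂ e) *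
      ((δ (proj₁ e) i - δ (proj₂ e) i) * (δ (proj₁ e) j - δ (proj₂ e) j))) (transpositions n)
    Amat≈ i j = sym (begin
      Σᴸ (λ e → F (proj₁ e) (proj₂ e)) (transpositions n)
        ≈⟨ Σ-symmetric F G F≈ ⟩
      sum (λ a → sum (λ b → G a b * ne a b))
        ≈⟨ sum-cong (λ a → trans (sum-cong (λ b → solve 4 (λ w x y z → w :* (x :* y) :* z := x :* (w :* y :* z)) refl (w a b) (δ a i) (δ a j - δ b j) (ne a b)))
             (sym (*-distribˡ-sum (δ a i) (λ b → w a b * (δ a j - δ b j) * ne a b)))) ⟩
      sum (λ a → δ a i * sum (λ b → w a b * (δ a j - δ b j) * ne a b))
        ≈⟨ trans (sum-cong (λ a → *-congʳ (reflexive (δ-sym a i)))) (sum-δˡ i (λ a → sum (λ b → w a b * (δ a j - δ b j) * ne a b))) ⟩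
      sum (λ b → w i b * (δ i j - δ b j) * ne i b)
        ≈⟨ sum-cong (λ b → solve 4 (λ w x y z → w :* (x :- y) :* z := w :* z :* x :+ :- :1 :* (w :* z :* y)) refl (w i b) (δ i j) (δ b j) (ne i b)) ⟩
      sum (λ b → w i b * ne i b * δ i j + - 1# * (w i b * ne i b * δ b j))
        ≈⟨ sum-lin (- 1#) (λ b → w i b * ne i b * δ i j) (λ b → w i b * ne i b * δ b j) ⟩
      sum (λ b → w i b * ne i b * δ i j) + - 1# * sum (λ b → w i b * ne i b * δ b j)
        ≈⟨ +-cong (sym (*-distribʳ-sum (δ i j) (λ b → w i b * ne i b))) (*-congˡ { - 1# } (sum-δʳ j (λ b → w i b * ne i b))) ⟩
      sum (λ b → w i b * ne i b) * δ i j + - 1# * (w i j * ne i j)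
        ≈⟨ final ⟩
      Amat n i j ∎)
      where
      F G : Fin n → Fin n → Poly n
      F a b = w a b * ((δ a i - δ b i) * (δ a j - δ b j))
      G a b = w a b * (δ a i * (δ a j - δ b j))
      F≈ : ∀ a b → a ≢ b → F a b ≈ G a b + G b a
      F≈ a b a≢b = trans (solve 5 (λ w x y z u → w :* ((x :- y) :* (z :- u)) := w :* (x :* (z :- u)) :+ w :* (y :* (u :- z))) refl
        (w a b) (δ a i) (δ b i) (δ a j) (δ b j)) (+-congˡ {G a b} (*-congʳ {δ b i * (δ b j - δ a j)} (w-sym a b a≢b)))
      row-sum : Poly n
      row-sum = sum (λ b → w i b * ne i b)
      combine : ∀ {x y z} → δ i j ≈ x → w i j * ne i j ≈ y → row-sum * x + - 1# * y ≈ z → row-sum * δ i j + - 1# * (w i j * ne i j) ≈ z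
      combine p q r = trans (+-cong (*-congˡ {row-sum} p) (*-congˡ { - 1# } q)) r
      case : Dec (i ≡ j) → row-sum * δ i j + - 1# * (w i j * ne i j) ≈ Amat n i j
      case (yes ≡.refl) = combine (reflexive (δ-refl i)) (trans (*-congˡ {w i i} (ne-refl i)) (zeroʳ (w i i)))
        (trans (solve 1 (λ s → s :* :1 :+ :- :1 :* :0 := s) refl row-sum) (sym (Amat-diagonal i)))
      case (no i≢j) = combine (reflexive (δ-≢ i≢j)) (trans (*-congˡ {w i j} (ne-≢ i≢j)) (*-identityʳ (w i j)))
        (trans (solve 2 (λ s x → s :* :0 :+ :- :1 :* x := :- x) refl row-sum (w i j)) (sym (Amat-off-diagonal i≢j)))
      final : row-sum * δ i j + - 1# * (w i j * ne i j) ≈ Amat n i j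
      final = case (i ≟ j)

    trace-Amat : sum (λ i → Amat n i i) ≈ Σᴸ (λ e → w (proj₁ e) (proj₂ e) + w (proj₁ e) (proj₂ e)) (transpositions n)
    trace-Amat = trans (sum-cong Amat-diagonal) (sym (Σ-symmetric (λ a b → w a b + w a b) w (λ a b a≢b → +-congˡ {w a b} (w-sym a b a≢b))))

open Laplacians

-- Instantiation at the polynomial ring and comparison of coefficients.

module MainFormula where

  import Defs
  open Defs hiding (det)
  import Data.Nat.Properties as ℕ
  open import Data.Integer using (+_)
  import Data.Rational.Properties as ℚ
  open import Data.List using (List; []; _∷_; filter; upTo; applyUpTo)
  open import Relation.Binary.PropositionalEquality as ≡ using (_≡_; _≢_)

  ≡ᵇ-true : ∀ {a b} → a ≡ b → (a ≡ᵇ b) ≡ true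
  ≡ᵇ-true {a} {b} eq with a ≡ᵇ b in e
  ... | true = ≡.refl
  ... | false = contradiction (≡.subst T e (ℕ.≡⇒≡ᵇ a b eq)) id

  ≡ᵇ-false : ∀ {a b} → a ≢ b → (a ≡ᵇ b) ≡ false
  ≡ᵇ-false {a} {b} ne with a ≡ᵇ b in e
  ... | false = ≡.refl
  ... | true = contradiction (ℕ.≡ᵇ⇒≡ a b (≡.subst T (≡.sym e) tt)) ne

  double-inj : ∀ {a b} → a ℕ.+ a ≡ b ℕ.+ b → a ≡ b
  double-inj {zero}  {zero}  eq = ≡.refl
  double-inj {suc a} {suc b} eq = ≡.cong suc (double-inj (ℕ.suc-injective
    (≡.trans (≡.sym (ℕ.+-suc a a)) (≡.trans (ℕ.suc-injective eq) (ℕ.+-suc b b)))))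

  even≢odd : ∀ a b → a ℕ.+ a ≢ suc (b ℕ.+ b)
  even≢odd (suc a) zero    eq = contradiction (≡.trans (≡.sym (ℕ.+-suc a a)) (ℕ.suc-injective eq)) λ ()
  even≢odd (suc a) (suc b) eq = even≢odd a b (ℕ.suc-injective
    (≡.trans (≡.sym (ℕ.+-suc a a)) (≡.trans (ℕ.suc-injective eq) (≡.cong suc (ℕ.+-suc b b)))))

  module Final (m : ℕ) where
    private
      n = suc m
    open CommutativeRing (polyRing n) hiding (zero)
    open Determinant (polyRing n)
    open ListSum (polyRing n)
    open Polynomials n
    open TranspositionSums n using (Amat≈; trace-Amat)
    open HurwitzSeries (polyRing n) using (t; const; const-⊛; sum-coeff)
    open MatrixExponential (polyRing n) using (pow; exp; exp-sum; module cH; module cHP)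
    open Factorials (polyRing n)
    private
      module S = CommutativeRing (hurwitz (polyRing n))
      module DS = Determinant (hurwitz (polyRing n))
    open ReducedDeterminant (hurwitz (polyRing n)) using (_↑_)
    open RingSolver (polyRing n)
    open import Relation.Binary.Reasoning.Setoid setoid

    L : List (Edge n)
    L = transpositions n

    wt : Edge n → Poly n
    wt e = w (proj₁ e) (proj₂ e)

    A H : Matrix n n
    A = Amat n
    H i j = constₚ ½ * A i j

    module TL = TranspositionList (polyRing n) {m} wt L
    module TW = TranspositionWalk (polyRing n) TL.weights TL.roots

    A≈laplacian : ∀ i j → A i j ≈ TW.laplacian i j
    A≈laplacian i j = trans (Amat≈ i j) (sym (sum-lookup
      (λ e → wt e * ((δ (proj₁ e) i - δ (proj₂ e) i) * (δ (proj₁ e) j - δ (proj₂ e) j))) L))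

    half : ∀ x → constₚ ½ * x + constₚ ½ * x ≈ x
    half x = trans (sym (distribʳ x (constₚ ½) (constₚ ½))) (trans (*-congʳ {x} (sym (const-+ ½ ½))) (*-identityˡ x))

    2H≈A : ∀ i j → H i j + H i j ≈ A i j
    2H≈A i j = half (A i j)

    A1≈0 : ∀ i → sum (A i) ≈ 0#
    A1≈0 i = trans (sum-cong (λ j → trans (A≈laplacian i j) (TL.laplacian≋gram i j))) (MatrixTree.gram-sum (polyRing n) {m} wt L i)

    H1≈0 : ∀ i → sum (H i) ≈ 0#
    H1≈0 i = trans (sym (*-distribˡ-sum (constₚ ½) (A i))) (trans (*-congˡ {constₚ ½} (A1≈0 i)) (zeroʳ (constₚ ½)))

    2H≈laplacian : ∀ i j → H i j + H i j ≈ TW.laplacian i j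
    2H≈laplacian i j = trans (2H≈A i j) (A≈laplacian i j)

    trH≈weights : sum (λ i → H i i) ≈ sum TL.weights
    trH≈weights = begin
      sum (λ i → H i i)
        ≈⟨ sym (*-distribˡ-sum (constₚ ½) (λ i → A i i)) ⟩
      constₚ ½ * sum (λ i → A i i)
        ≈⟨ *-congˡ {constₚ ½} trace-Amat ⟩
      constₚ ½ * Σᴸ (λ e → wt e + wt e) L
        ≈⟨ Σᴸ-*ˡ (constₚ ½) (λ e → wt e + wt e) L ⟩
      Σᴸ (λ e → constₚ ½ * (wt e + wt e)) L
        ≈⟨ Σᴸ-cong (λ e → trans (distribˡ (constₚ ½) (wt e) (wt e)) (half (wt e))) L ⟩
      Σᴸ wt L
        ≈⟨ sym (sum-lookup wt L) ⟩
      sum TL.weights ∎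

    module WF = WalkFormula (polyRing n) TL.weights TL.roots H H1≈0 2H≈laplacian trH≈weights
    module SF = SinhFactorization (polyRing n) H H1≈0

    -- φ(tA)
    Φ : DS.Matrix n n
    Φ i j r = constₚ (sinhCoeff r) * pow A r i j

    pow-scale : ∀ c {M : Matrix n n} → (∀ i j → M i j ≈ constₚ c * A i j) → ∀ k i j → pow M k i j ≈ constₚ (c ^ℚ k) * pow A k i j
    pow-scale c M≈ zero    i j = sym (*-identityˡ (δ i j))
    pow-scale c {M} M≈ (suc k) i j = trans (sum-cong (λ l → term l)) (sym (*-distribˡ-sum (constₚ (c ^ℚ suc k)) (λ l → A i l * pow A k l j)))
      where
      term : ∀ l → M i l * pow M k l j ≈ constₚ (c ^ℚ suc k) * (A i l * pow A k l j)
      term l = trans (*-cong (M≈ i l) (pow-scale c M≈ k l j))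
        (trans (solve 4 (λ c a d p → (c :* a) :* (d :* p) := (c :* d) :* (a :* p)) refl (constₚ c) (A i l) (constₚ (c ^ℚ k)) (pow A k l j))
          (*-congʳ {A i l * pow A k l j} (sym (const-* c (c ^ℚ k)))))

    ν≈ : ∀ k → ν k ≈ constₚ (natℚ k)
    ν≈ zero    = mk λ μ → ≡.sym (zero-coeff (monoEq monoOne μ))
      where
      zero-coeff : ∀ b → (if b then 0ℚ else 0ℚ) ℚ.+ 0ℚ ≡ 0ℚ
      zero-coeff true  = ≡.refl
      zero-coeff false = ≡.refl
    ν≈ (suc k) = trans (+-congˡ {1#} (ν≈ k)) (trans (sym (const-+ 1ℚ (natℚ k))) (reflexive (≡.cong constₚ (≡.sym (natℚ-suc k)))))

    fac≈ : ∀ k → fac k ≈ constₚ (natℚ (k !))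
    fac≈ zero    = refl
    fac≈ (suc k) = trans (*-cong (ν≈ (suc k)) (fac≈ k)) (trans (sym (const-* (natℚ (suc k)) (natℚ (k !)))) (reflexive (≡.cong constₚ (≡.sym (natℚ-* (suc k) (k !))))))

    -- Compared coefficientwise: the constant terms vanish on both sides. At index r + 1 the left
    -- side is (½^(r+1) - (-½)^(r+1)) A^(r+1); multiplication by t supplies the factor r + 1, which
    -- is cancelled by the denominator in `sinhCoeff r`.
    sinh : ∀ i j → exp H i j S.- exp SF.-H i j S.≈ (SF.tA DS.⊠ Φ) i j
    sinh i j zero _ = trans (-‿inverseʳ (δ i j)) (sym (trans (sum-coeff (λ l → SF.tA i l S.* Φ l j) zero)
      (sum-zero (λ l → trans (S.*-assoc t (const (SF.2H i l)) (Φ l j) zero tt) (t*-zero (const (SF.2H i l) S.* Φ l j))))))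
    sinh i j (suc r) _ = begin
      pow H (suc r) i j - pow SF.-H (suc r) i j
        ≈⟨ +-cong (pow-scale ½ (λ _ _ → refl) (suc r) i j) (-‿cong (pow-scale (ℚ.- ½) -H≈ (suc r) i j)) ⟩
      constₚ (½ ^ℚ suc r) * P - constₚ ((ℚ.- ½) ^ℚ suc r) * P
        ≈⟨ solve 3 (λ a b p → a :* p :- b :* p := (a :- b) :* p) refl (constₚ (½ ^ℚ suc r)) (constₚ ((ℚ.- ½) ^ℚ suc r)) P ⟩
      (constₚ (½ ^ℚ suc r) - constₚ ((ℚ.- ½) ^ℚ suc r)) * P
        ≈⟨ *-congʳ {P} (trans (+-congˡ {constₚ (½ ^ℚ suc r)} (sym (const-neg ((ℚ.- ½) ^ℚ suc r)))) (sym (const-+ (½ ^ℚ suc r) (ℚ.- ((ℚ.- ½) ^ℚ suc r))))) ⟩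
      constₚ (½ ^ℚ suc r ℚ.- (ℚ.- ½) ^ℚ suc r) * P
        ≈⟨ *-congʳ {P} (trans (reflexive (≡.cong constₚ (≡.sym (sinhCoeff-* r)))) (trans (const-* (natℚ (suc r)) (sinhCoeff r)) (*-congʳ {c} (sym (ν≈ (suc r)))))) ⟩
      ν (suc r) * c * P
        ≈⟨ *-assoc (ν (suc r)) c P ⟩
      ν (suc r) * (c * P)
        ≈⟨ *-congˡ {ν (suc r)} (trans (*-distribˡ-sum c (λ l → A i l * pow A r l j)) (sum-cong (λ l →
             trans (solve 3 (λ c a p → c :* (a :* p) := a :* (c :* p)) refl c (A i l) (pow A r l j)) (*-congʳ {Φ l j r} (sym (2H≈A i l)))))) ⟩
      ν (suc r) * sum (λ l → SF.2H i l * Φ l j r)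
        ≈⟨ *-distribˡ-sum (ν (suc r)) (λ l → SF.2H i l * Φ l j r) ⟩
      sum (λ l → ν (suc r) * (SF.2H i l * Φ l j r))
        ≈⟨ sum-cong (λ l → sym (trans (S.*-assoc t (const (SF.2H i l)) (Φ l j) (suc r) tt) (trans (t*-suc (const (SF.2H i l) S.* Φ l j) r)
             (*-congˡ {ν (suc r)} (const-⊛ (SF.2H i l) (Φ l j) r))))) ⟩
      sum (λ l → (SF.tA i l S.* Φ l j) (suc r))
        ≈⟨ sym (sum-coeff (λ l → SF.tA i l S.* Φ l j) (suc r)) ⟩
      (SF.tA DS.⊠ Φ) i j (suc r) ∎
      where
      P c : Poly n
      P = pow A (suc r) i j
      c = constₚ (sinhCoeff r)
      -H≈ : ∀ i j → SF.-H i j ≈ constₚ (ℚ.- ½) * A i j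
      -H≈ i j = trans (solve 2 (λ h a → :- (h :* a) := :- h :* a) refl (constₚ ½) (A i j)) (*-congʳ {A i j} (sym (const-neg ½)))

    Φ1≈1 : ∀ i → DS.sum (Φ i) S.≈ S.1#
    Φ1≈1 i r _ = trans (sum-coeff (Φ i) r) (trans (sym (*-distribˡ-sum (constₚ (sinhCoeff r)) (pow A r i)))
      (trans (*-congˡ {constₚ (sinhCoeff r)} (trans (sym (sum-coeff (exp A i) r)) (exp-sum A A1≈0 i r tt))) (at r)))
      where
      at : ∀ r → constₚ (sinhCoeff r) * const 1# r ≈ const 1# r
      at zero    = *-identityˡ 1#
      at (suc r) = zeroʳ (constₚ (sinhCoeff (suc r)))

    grade-Σᴸ : ∀ {X : Set} (f : X → Poly n) xs r → grade (Σᴸ f xs) r ≈ Σᴸ (λ x → grade (f x) r) xs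
    grade-Σᴸ f []       r = refl
    grade-Σᴸ f (x ∷ xs) r = trans (grade-+ (f x) (Σᴸ f xs) r tt) (+-congˡ {grade (f x) r} (grade-Σᴸ f xs r))

    module GH = HomProperties gradeHom

    -- The entries of A are linear forms in w. The sum over edges is used here, as in it every
    -- variable is an explicit factor beside a constant.
    grade-A : ∀ i j → grade (A i j) S.≈ t S.* const (A i j)
    grade-A i j = S.trans (grade-cong (Amat≈ i j)) (S.trans (list L) (S.*-congˡ {t} (cH.⟦⟧-cong (sym (Amat≈ i j)))))
      where
      x : Edge n → Poly n
      x e = (δ (proj₁ e) i - δ (proj₂ e) i) * (δ (proj₁ e) j - δ (proj₂ e) j)
      grade-δ : ∀ (a b : Fin n) → grade (δ a b) S.≈ const (δ a b)
      grade-δ a b = S.trans (GH.δ-homo a b) (S.sym (cHP.δ-homo a b))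
      grade-− : ∀ a b → grade (a - b) S.≈ grade a S.- grade b
      grade-− a b = S.trans (grade-+ a (- b)) (S.+-congˡ {grade a} (Hom.neg-homo gradeHom b))
      const-− : ∀ a b → const (a - b) S.≈ const a S.- const b
      const-− a b = S.trans (cH.+-homo a (- b)) (S.+-congˡ {const a} (cH.neg-homo b))
      grade-x : ∀ e → grade (x e) S.≈ const (x e)
      grade-x e = S.trans (grade-* (δ (proj₁ e) i - δ (proj₂ e) i) (δ (proj₁ e) j - δ (proj₂ e) j))
        (S.trans (S.*-cong (diff i) (diff j)) (S.sym (cH.*-homo (δ (proj₁ e) i - δ (proj₂ e) i) (δ (proj₁ e) j - δ (proj₂ e) j))))
        where
        diff : ∀ k → grade (δ (proj₁ e) k - δ (proj₂ e) k) S.≈ const (δ (proj₁ e) k - δ (proj₂ e) k)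
        diff k = S.trans (grade-− (δ (proj₁ e) k) (δ (proj₂ e) k)) (S.trans (S.+-cong (grade-δ (proj₁ e) k) (S.-‿cong (grade-δ (proj₂ e) k)))
          (S.sym (const-− (δ (proj₁ e) k) (δ (proj₂ e) k))))
      term : ∀ e → grade (wt e * x e) S.≈ t S.* const (wt e * x e)
      term e = S.trans (grade-* (wt e) (x e)) (S.trans (S.*-cong (grade-w (proj₁ e) (proj₂ e)) (grade-x e))
        (S.trans (S.*-assoc t (const (wt e)) (const (x e))) (S.*-congˡ {t} (S.sym (cH.*-homo (wt e) (x e))))))
      list : ∀ xs → grade (Σᴸ (λ e → wt e * x e) xs) S.≈ t S.* const (Σᴸ (λ e → wt e * x e) xs)
      list []       = S.sym (S.trans (S.*-congˡ {t} cH.0-homo) (S.zeroʳ t))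
      list (e ∷ xs) = S.trans (grade-+ (wt e * x e) (Σᴸ (λ e → wt e * x e) xs)) (S.trans (S.+-cong (term e) (list xs))
        (S.trans (S.sym (S.distribˡ t (const (wt e * x e)) (const (Σᴸ (λ e → wt e * x e) xs))))
          (S.*-congˡ {t} (S.sym (cH.+-homo (wt e * x e) (Σᴸ (λ e → wt e * x e) xs))))))

    grade-pow : ∀ k i j → grade (pow A k i j) S.≈ t ↑ k S.* const (pow A k i j)
    grade-pow zero    i j = S.trans (GH.δ-homo i j) (S.sym (S.trans (S.*-identityˡ (const (δ i j))) (cHP.δ-homo i j)))
    grade-pow (suc k) i j = S.trans (GH.⊠-homo A (pow A k) i j) (S.trans (DS.sum-cong (λ l → term l))
      (S.trans (S.sym (DS.*-distribˡ-sum (t ↑ suc k) (λ l → const (A i l) S.* const (pow A k l j)))) (S.*-congˡ {t ↑ suc k} (S.sym (cHP.⊠-homo A (pow A k) i j)))))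
      where
      module SS = RingSolver (hurwitz (polyRing n))
      term : ∀ l → grade (A i l) S.* grade (pow A k l j) S.≈ t ↑ suc k S.* (const (A i l) S.* const (pow A k l j))
      term l = S.trans (S.*-cong (grade-A i l) (grade-pow k l j))
        (SS.solve 4 (λ t a u b → (t SS.:* a) SS.:* (u SS.:* b) SS.:= (t SS.:* u) SS.:* (a SS.:* b)) S.refl t (const (A i l)) (t ↑ k) (const (pow A k l j)))

    Σᴸ-zero : ∀ (f : ℕ → Poly n) (h : ℕ → ℕ) K → (∀ k → f (h k) ≈ 0#) → Σᴸ f (applyUpTo h K) ≈ 0#
    Σᴸ-zero f h zero    p = refl
    Σᴸ-zero f h (suc K) p = trans (+-cong (p 0) (Σᴸ-zero f (h ∘ suc) K (p ∘ suc))) (+-identityʳ 0#)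

    Σᴸ-single : ∀ (f : ℕ → Poly n) (h : ℕ → ℕ) {K} k₀ → k₀ ℕ.< K → (∀ k → k ≢ k₀ → f (h k) ≈ 0#) → Σᴸ f (applyUpTo h K) ≈ f (h k₀)
    Σᴸ-single f h {suc K} zero     _          p = trans (+-congˡ {f (h 0)} (Σᴸ-zero f (h ∘ suc) K (λ k → p (suc k) (λ ())))) (+-identityʳ (f (h 0)))
    Σᴸ-single f h {suc K} (suc k₀) (s≤s k₀<K) p = trans (+-cong (p 0 (λ ())) (Σᴸ-single f (h ∘ suc) k₀ k₀<K (λ k ne → p (suc k) (ne ∘ ℕ.suc-injective)))) (+-identityˡ (f (h (suc k₀))))

    -- For r = 2k exactly the summand with index k contributes, and r ≤ 2g ensures that it is
    -- present in the truncation. For odd r no summand contributes, and `sinhCoeff r` is zero.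
    grade-φ : ∀ g i j r → r ≤ 2 ℕ.* g → grade (phiTrunc g A i j) r ≈ Φ i j r
    grade-φ g i j r r≤2g = begin
      grade (phiTrunc g A i j) r
        ≈⟨ grade-cong (reflexive (sumₚ-Σᴸ f (upTo (suc g)))) r tt ⟩
      grade (Σᴸ f (upTo (suc g))) r
        ≈⟨ grade-Σᴸ f (upTo (suc g)) r ⟩
      Σᴸ (λ k → grade (f k) r) (upTo (suc g))
        ≈⟨ Σᴸ-cong coefficient (upTo (suc g)) ⟩
      Σᴸ summand (upTo (suc g))
        ≈⟨ select (parity r) ⟩
      Φ i j r ∎
      where
      f summand : ℕ → Poly n
      f k = scaleₚ (phiCoeff k) ((A ^ₘ (2 ℕ.* k)) i j)
      summand k = constₚ (phiCoeff k) * (if r ≡ᵇ 2 ℕ.* k then fac r * pow A (2 ℕ.* k) i j else 0#)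
      coefficient : ∀ k → grade (f k) r ≈ summand k
      coefficient k = trans (grade-cong (trans (scale-const (phiCoeff k) ((A ^ₘ (2 ℕ.* k)) i j)) (*-congˡ {constₚ (phiCoeff k)} (^ₘ≈pow A (2 ℕ.* k) i j))) r tt)
        (trans (grade-* (constₚ (phiCoeff k)) (pow A (2 ℕ.* k) i j) r tt)
        (trans (S.*-cong (grade-const (phiCoeff k)) (grade-pow (2 ℕ.* k) i j) r tt)
        (trans (const-⊛ (constₚ (phiCoeff k)) (t ↑ (2 ℕ.* k) S.* const (pow A (2 ℕ.* k) i j)) r)
          (*-congˡ {constₚ (phiCoeff k)} (t↑*-const (2 ℕ.* k) (pow A (2 ℕ.* k) i j) r)))))
      2* : ∀ k → 2 ℕ.* k ≡ k ℕ.+ k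
      2* k = ≡.cong (k ℕ.+_) (ℕ.+-identityʳ k)
      off : ∀ k → r ≢ k ℕ.+ k → summand k ≈ 0#
      off k ne = trans (*-congˡ {constₚ (phiCoeff k)} (reflexive (≡.cong (if_then fac r * pow A (2 ℕ.* k) i j else 0#) (≡ᵇ-false (λ eq → ne (≡.trans eq (2* k)))))))
        (zeroʳ (constₚ (phiCoeff k)))
      on : ∀ k → r ≡ k ℕ.+ k → summand k ≈ Φ i j r
      on k eq = begin
        summand k
          ≈⟨ *-congˡ {constₚ (phiCoeff k)} (reflexive (≡.cong (if_then fac r * pow A (2 ℕ.* k) i j else 0#) (≡ᵇ-true (≡.trans eq (≡.sym (2* k)))))) ⟩
        constₚ (phiCoeff k) * (fac r * pow A (2 ℕ.* k) i j)
          ≈⟨ sym (*-assoc (constₚ (phiCoeff k)) (fac r) (pow A (2 ℕ.* k) i j)) ⟩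
        constₚ (phiCoeff k) * fac r * pow A (2 ℕ.* k) i j
          ≈⟨ *-cong (trans (*-congˡ {constₚ (phiCoeff k)} (fac≈ r)) (trans (sym (const-* (phiCoeff k) (natℚ (r !)))) (reflexive (≡.cong constₚ scalar))))
               (reflexive (≡.cong (λ q → pow A q i j) (≡.trans (2* k) (≡.sym eq)))) ⟩
        Φ i j r ∎
        where
        scalar : phiCoeff k ℚ.* natℚ (r !) ≡ sinhCoeff r
        scalar = ≡.subst (λ q → phiCoeff k ℚ.* natℚ (q !) ≡ sinhCoeff q) (≡.sym eq) (phiCoeff-fac k)
      select : (∃ λ k → r ≡ k ℕ.+ k ⊎ r ≡ suc (k ℕ.+ k)) → Σᴸ summand (upTo (suc g)) ≈ Φ i j r
      select (k , inj₁ eq) = trans (Σᴸ-single summand id k (s≤s k≤g) (λ l l≢k → off l (λ eq′ → l≢k (double-inj (≡.trans (≡.sym eq′) eq))))) (on k eq)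
        where
        k≤g : k ≤ g
        k≤g = ℕ.*-cancelˡ-≤ 2 (≡.subst (_≤ 2 ℕ.* g) (≡.trans eq (≡.sym (2* k))) r≤2g)
      select (k , inj₂ eq) = trans (Σᴸ-zero summand id (suc g) (λ l → off l (λ eq′ → even≢odd l k (≡.trans (≡.sym eq′) eq)))) (sym (trans
        (*-congʳ {pow A r i j} (trans (reflexive (≡.cong constₚ (≡.trans (≡.cong sinhCoeff eq) (sinhCoeff-odd k)))) (sym (ν≈ 0)))) (zeroˡ (pow A r i j))))

    -- The graded entries of `phiTrunc` agree with those of φ(tA) only up to t^(2g), so the
    -- determinants are compared in the truncated series ring. There the coefficient 2g of the
    -- graded determinant gives the homogeneous part.
    det-Φ : ∀ g → DS.det Φ (2 ℕ.* g) ≈ fac (2 ℕ.* g) * Rpoly g n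
    det-Φ g = begin
      DS.det Φ N
        ≈⟨ TH.det-homo Φ N ℕ.≤-refl ⟩
      DT.det Φ N
        ≈⟨ DT.det-cong {M = Φ} {N = λ i j → grade (φ i j)} (λ i j r r≤N → sym (grade-φ g i j r r≤N)) N ℕ.≤-refl ⟩
      DT.det (λ i j → grade (φ i j)) N
        ≈⟨ sym (TH.det-homo (λ i j → grade (φ i j)) N ℕ.≤-refl) ⟩
      DS.det (λ i j → grade (φ i j)) N
        ≈⟨ sym (GH.det-homo φ N tt) ⟩
      grade (det φ) N
        ≈⟨ grade-cong (sym (frozen-det n φ)) N tt ⟩
      grade (Defs.det n φ) N
        ≈⟨ grade-coeff (Defs.det n φ) N ⟩
      fac N * Rpoly g n ∎
      where
      N = 2 ℕ.* g
      φ = phiTrunc g A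
      module TH = HomProperties (truncHom (polyRing n) N)
      module DT = Determinant (hurwitz≤ (polyRing n) N)

    weight≡product : ∀ ts → weight ts ≡ TL.product ts
    weight≡product []       = ≡.refl
    weight≡product (t ∷ ts) = ≡.cong (wt t *ₚ_) (weight≡product ts)

    TreePoly≈ : TreePoly n ≈ ReducedDeterminant.det′ (polyRing n) TW.laplacian
    TreePoly≈ = begin
      TreePoly n
        ≈⟨ reflexive (sumₚ-Σᴸ weight trees) ⟩
      Σᴸ weight trees
        ≈⟨ Σᴸ-filter {P = isSpanningTree} weight (sublists L) ⟩
      Σᴸ (λ S → weight S * TL.indicator (isSpanningTree S)) (sublists L)
        ≈⟨ Σᴸ-cong (λ S → reflexive (≡.cong (_* TL.indicator (isSpanningTree S)) (weight≡product S))) (sublists L) ⟩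
      Σᴸ (λ S → TL.product S * TL.indicator (isSpanningTree S)) (sublists L)
        ≈⟨ sym TL.det′-laplacian ⟩
      ReducedDeterminant.det′ (polyRing n) TW.laplacian ∎
      where
      trees = filter (λ E → isSpanningTree E Data.Bool.≟ true) (sublists L)

    Hurwitz≈ : ∀ g → Hurwitz g n ≈ TW.walk (m ℕ.+ 2 ℕ.* g) WF.masked
    Hurwitz≈ g = begin
      Hurwitz g n
        ≈⟨ reflexive (sumₚ-Σᴸ weight cycles) ⟩
      Σᴸ weight cycles
        ≈⟨ Σᴸ-filter {P = λ ts → isNCycle (prodPerm ts)} weight (listsOfLength N L) ⟩
      Σᴸ (λ ts → weight ts * TL.indicator (isNCycle (prodPerm ts))) (listsOfLength N L)
        ≈⟨ Σᴸ-cong (λ ts → reflexive (≡.cong (_* TL.indicator (isNCycle (prodPerm ts))) (weight≡product ts))) (listsOfLength N L) ⟩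
      Σᴸ (TL.cycleTerm id) (listsOfLength N L)
        ≈⟨ sym (TL.walk-cycles N id id) ⟩
      TW.walk N (TL.functionMatrix id)
        ≈⟨ TL.walk-cong N (λ { zero j → refl ; (suc i) j → refl }) ⟩
      TW.walk N WF.masked ∎
      where
      N = m ℕ.+ 2 ℕ.* g
      cycles = filter (λ ts → isNCycle (prodPerm ts) Data.Bool.≟ true) (listsOfLength N L)

    hurwitz-formula : ∀ g → Hurwitz g n ≈ scaleₚ (natℚ ((m ℕ.+ 2 ℕ.* g) !)) (TreePoly n *ₚ Rpoly g n)
    hurwitz-formula g = begin
      Hurwitz g n
        ≈⟨ Hurwitz≈ g ⟩
      TW.walk N WF.masked
        ≈⟨ WF.walk-formula Φ Φ1≈1 sinh N ⟩
      (t ↑ m S.* const τ S.* DS.det Φ) N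
        ≈⟨ S.*-assoc (t ↑ m) (const τ) (DS.det Φ) N tt ⟩
      (t ↑ m S.* (const τ S.* DS.det Φ)) N
        -- The factor (2g)! from `det-Φ` becomes (m + 2g)! when t^m is multiplied in; this is the
        -- factorial of the formula.
        ≈⟨ t↑*-fac m {const τ S.* DS.det Φ} {2 ℕ.* g} {τ * Rpoly g n} (trans (const-⊛ τ (DS.det Φ) (2 ℕ.* g)) (trans (*-congˡ {τ} (det-Φ g))
             (solve 3 (λ a b c → a :* (b :* c) := b :* (a :* c)) refl τ (fac (2 ℕ.* g)) (Rpoly g n)))) ⟩
      fac N * (τ * Rpoly g n)
        ≈⟨ *-cong (fac≈ N) (*-congʳ {Rpoly g n} (sym TreePoly≈)) ⟩
      constₚ (natℚ (N !)) * (TreePoly n * Rpoly g n)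
        ≈⟨ sym (scale-const (natℚ (N !)) (TreePoly n *ₚ Rpoly g n)) ⟩
      scaleₚ (natℚ (N !)) (TreePoly n *ₚ Rpoly g n) ∎
      where
      N = m ℕ.+ 2 ℕ.* g
      τ = ReducedDeterminant.det′ (polyRing n) TW.laplacian

open MainFormula

open import Defs
open import Data.Nat using (_+_; _*_; _∸_)
open import Data.Integer using (+_)
open import Data.Rational using (_/_)

theorem1 : (n g : ℕ) → 1 ≤ n →
    Hurwitz g n ≈ₚ scaleₚ (+ ((n + 2 * g ∸ 1) !) / 1) (TreePoly n *ₚ Rpoly g n)
-- For n = m + 1 the number n + 2g ∸ 1 reduces to m + 2g, so the formula applies without rewriting.
theorem1 (suc m) g _ = coeffs (Final.hurwitz-formula m g)
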